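{- For an integer $k\ge 3$ let $\xi(k)$ denote the maximum $g$ such that there exists a simple cubic graph of girth $g$ and path-width $k$. For each $k\in\{3,\dots,10\}\setminus\{4\}$ there is, up to isomorphism, a unique smallest (i.e. with the minimum number of vertices) cubic graph of path-width $k$ and girth $\xi(k)$, namely: - $k=3$: $K_{3,3}$; - $k=5$: the Petersen graph; - $k=6$: the Heawood graph; - $k=7$: the Pappus graph; - $k=8$: the McGee graph; - $k=9$: the Tutte–Coxeter graph; - $k=10$: the graph $G(10)$ on 34 vertices. For $k=4$ there are, up to isomorphism, exactly two smallest cubic graphs of path-width $4$ and girth $\xi(4)=4$, namely the cube and the twisted cube.
   Context: All graphs are non-empty, finite and simple. A graph is cubic if all its vertices have degree 3. The girth of a graph is the minimum length of a cycle in it. A path-decomposition of a graph $G$ is a sequence $V_1,\dots,V_{n'}$ of subsets (bags) of $V(G)$ such that every vertex lies in some bag, both ends of every edge lie together in some bag, and for each vertex $v$ the set $\{i : v\in V_i\}$ is an interval of consecutive integers. Its width is $\max_i |V_i| - 1$, and the path-width of $G$ is the minimum width of a path-decomposition of $G$. The graphs in the list, except for $K_{3,3}$ and the Petersen graph, are described as a Hamiltonian cycle $1,2,\dots,n,1$ (edges $\{i,i+1\}$ and $\{n,1\}$) together with the listed chords: - cube ($n=8$): $\{1,6\},\{2,5\},\{3,8\},\{4,7\}$; - twisted cube ($n=8$): $\{1,5\},\{2,6\},\{3,8\},\{4,7\}$; - Heawood graph ($n=14$): $\{14,5\},\{2,7\},\{4,9\},\{6,11\},\{8,13\},\{1,10\},\{3,12\}$;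 - Pappus graph ($n=18$): $\{1,6\},\{2,9\},\{3,14\},\{4,11\},\{5,16\},\{7,12\},\{8,15\},\{10,17\},\{13,18\}$; - McGee graph ($n=24$): $\{1,13\},\{7,19\},\{2,9\},\{24,17\},\{12,5\},\{8,15\},\{14,21\},\{3,20\},\{6,23\},\{11,18\},\{4,16\},\{10,22\}$; - Tutte–Coxeter graph ($n=30$): $\{1,10\},\{4,25\},\{7,16\},\{13,22\},\{19,28\},\{2,15\},\{3,20\},\{8,21\},\{9,26\},\{14,27\},\{5,12\},\{6,29\},\{11,18\},\{17,24\},\{23,30\}$; - $G(10)$ ($n=34$): $\{3,10\},\{4,31\},\{11,18\},\{14,21\},\{17,24\},\{34,7\},\{1,16\},\{5,20\},\{6,25\},\{15,30\},\{2,27\},\{19,28\},\{23,32\},\{8,29\},\{9,22\},\{12,33\},\{13,26\}$. -}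

module Defs where

open import Data.Bool.Base using (Bool; true; false; not; _∧_; _∨_; T)
open import Data.Bool.ListAction using (any)
open import Data.Bool.Properties using (∨-comm)
open import Data.Fin.Base using (Fin; toℕ) renaming (_≤_ to _≤ᶠ_)
open import Data.Fin.Subset using (Subset; ∣_∣; _∈_)
open import Data.List.Base using (List; []; _∷_; _∷ʳ_; _++_; length; map; cartesianProduct; upTo; tabulate)
open import Data.List.Extrema.Nat using (max)
open import Data.List.Relation.Unary.Linked using (Linked)
open import Data.List.Relation.Unary.Unique.Propositional using (Unique)
open import Data.Nat.Base using (ℕ; zero; suc; pred; _≤_; _≡ᵇ_; NonZero)
open import Data.Product.Base using (Σ; ∃; ∃-syntax; _×_; _,_)
import Data.Vec.Base as Vec
open import Function.Bundles using (_↔_; Inverse)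
open import Relation.Binary.PropositionalEquality using (_≡_; refl; cong₂)

IsMinimum : (ℕ → Set) → ℕ → Set
IsMinimum P m = P m × (∀ n → P n → m ≤ n)

IsMaximum : (ℕ → Set) → ℕ → Set
IsMaximum P m = P m × (∀ n → P n → n ≤ m)

-- Non-empty finite simple graphs. Adjacency is Bool-valued, so decidable.
record Graph : Set where
  field
    order       : ℕ
    .⦃ nonEmpty ⦄ : NonZero order
    adj         : Fin order → Fin order → Bool
    adj-sym     : ∀ u v → adj u v ≡ adj v u
    adj-irrefl  : ∀ v → adj v v ≡ false

  Vertex : Set
  Vertex = Fin order

  Adj : Vertex → Vertex → Set
  Adj u v = T (adj u v)

  neighbours : Vertex → Subset order
  neighbours v = Vec.tabulate (adj v)

  degree : Vertex → ℕ
  degree v = ∣ neighbours v ∣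

open Graph using (order; Vertex)

infix 4 _≅_

record _≅_ (G H : Graph) : Set where
  field
    bijection     : Vertex G ↔ Vertex H
    preserves-adj : ∀ u v →
      Graph.adj G u v ≡ Graph.adj H (Inverse.to bijection u) (Inverse.to bijection v)

Cubic : Graph → Set
Cubic G = ∀ v → Graph.degree G v ≡ 3

-- The cycle visits start, then the vertices of rest in order, then start again.
record Cycle (G : Graph) (ℓ : ℕ) : Set where
  field
    start    : Vertex G
    rest     : List (Vertex G)
    distinct : Unique (start ∷ rest)
    closed   : Linked (Graph.Adj G) (start ∷ rest ∷ʳ start)
    size     : length (start ∷ rest) ≡ ℓ
    3≤ℓ      : 3 ≤ ℓ

HasGirth : Graph → ℕ → Set
HasGirth G = IsMinimum (Cycle G)

record PathDecomposition (G : Graph) : Set where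
  field
    #bags       : ℕ
    bag         : Fin #bags → Subset (order G)
    covers      : ∀ v → ∃[ i ] v ∈ bag i
    coversEdges : ∀ u v → Graph.Adj G u v → ∃[ i ] (u ∈ bag i × v ∈ bag i)
    interval    : ∀ v i j l → i ≤ᶠ j → j ≤ᶠ l → v ∈ bag i → v ∈ bag l → v ∈ bag j

  -- Some bag is non-empty, because G has a vertex, so pred does not truncate.
  width : ℕ
  width = pred (max 0 (tabulate (λ i → ∣ bag i ∣)))

HasPathWidth : Graph → ℕ → Set
HasPathWidth G = IsMinimum (λ w → Σ (PathDecomposition G) λ D → PathDecomposition.width D ≡ w)

CubicOf : (pathWidth girth : ℕ) → Graph → Set
CubicOf k g G = Cubic G × HasGirth G g × HasPathWidth G k

-- Isξ k g says that ξ(k) exists and equals g.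
Isξ : ℕ → ℕ → Set
Isξ k = IsMaximum (λ g → ∃ (CubicOf k g))

Smallest : (Graph → Set) → Graph → Set
Smallest P G = P G × (∀ H → P H → order G ≤ order H)

UniqueSmallest : (Graph → Set) → Graph → Set
UniqueSmallest P G = Smallest P G × (∀ H → Smallest P H → H ≅ G)

-- Edge lists name the vertices 1, …, n; the label of v : Fin n is suc (toℕ v).
fromEdges : (n : ℕ) .⦃ _ : NonZero n ⦄ → List (ℕ × ℕ) → Graph
fromEdges n edges = record
  { order      = n
  ; adj        = λ u v → adjacent (suc (toℕ u)) (suc (toℕ v))
  ; adj-sym    = λ u v → adjacent-sym (suc (toℕ u)) (suc (toℕ v))
  ; adj-irrefl = λ v → adjacent-irrefl (suc (toℕ v))
  }
  where
  listed : ℕ → ℕ → Bool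
  listed a b = any (λ (c , d) → (a ≡ᵇ c) ∧ (b ≡ᵇ d)) edges

  adjacent : ℕ → ℕ → Bool
  adjacent a b = not (a ≡ᵇ b) ∧ (listed a b ∨ listed b a)

  ≡ᵇ-sym : ∀ a b → (a ≡ᵇ b) ≡ (b ≡ᵇ a)
  ≡ᵇ-sym zero    zero    = refl
  ≡ᵇ-sym zero    (suc b) = refl
  ≡ᵇ-sym (suc a) zero    = refl
  ≡ᵇ-sym (suc a) (suc b) = ≡ᵇ-sym a b

  ≡ᵇ-refl : ∀ a → (a ≡ᵇ a) ≡ true
  ≡ᵇ-refl zero    = refl
  ≡ᵇ-refl (suc a) = ≡ᵇ-refl a

  adjacent-sym : ∀ a b → adjacent a b ≡ adjacent b a
  adjacent-sym a b =
    cong₂ (λ x y → not x ∧ y) (≡ᵇ-sym a b) (∨-comm (listed a b) (listed b a))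

  adjacent-irrefl : ∀ a → adjacent a a ≡ false
  adjacent-irrefl a rewrite ≡ᵇ-refl a = refl

-- The cycle 1, 2, …, n, 1 together with the given chords.
hamiltonian : (n : ℕ) .⦃ _ : NonZero n ⦄ → List (ℕ × ℕ) → Graph
hamiltonian n chords =
  fromEdges n ((n , 1) ∷ map (λ i → suc i , suc (suc i)) (upTo (pred n)) ++ chords)

K₃,₃ : Graph
K₃,₃ = fromEdges 6 (cartesianProduct (1 ∷ 2 ∷ 3 ∷ []) (4 ∷ 5 ∷ 6 ∷ []))

-- Outer pentagon, spokes, inner pentagram.
petersen : Graph
petersen = fromEdges 10
  ( (1 , 2) ∷ (2 , 3) ∷ (3 , 4) ∷ (4 , 5) ∷ (5 , 1)
  ∷ (1 , 6) ∷ (2 , 7) ∷ (3 , 8) ∷ (4 , 9) ∷ (5 , 10)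
  ∷ (6 , 8) ∷ (8 , 10) ∷ (10 , 7) ∷ (7 , 9) ∷ (9 , 6) ∷ [])

cube : Graph
cube = hamiltonian 8 ((1 , 6) ∷ (2 , 5) ∷ (3 , 8) ∷ (4 , 7) ∷ [])

twistedCube : Graph
twistedCube = hamiltonian 8 ((1 , 5) ∷ (2 , 6) ∷ (3 , 8) ∷ (4 , 7) ∷ [])

heawood : Graph
heawood = hamiltonian 14
  ( (14 , 5) ∷ (2 , 7) ∷ (4 , 9) ∷ (6 , 11) ∷ (8 , 13) ∷ (1 , 10) ∷ (3 , 12) ∷ [])

pappus : Graph
pappus = hamiltonian 18
  ( (1 , 6) ∷ (2 , 9) ∷ (3 , 14) ∷ (4 , 11) ∷ (5 , 16) ∷ (7 , 12) ∷ (8 , 15)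
  ∷ (10 , 17) ∷ (13 , 18) ∷ [])

mcGee : Graph
mcGee = hamiltonian 24
  ( (1 , 13) ∷ (7 , 19) ∷ (2 , 9) ∷ (24 , 17) ∷ (12 , 5) ∷ (8 , 15) ∷ (14 , 21)
  ∷ (3 , 20) ∷ (6 , 23) ∷ (11 , 18) ∷ (4 , 16) ∷ (10 , 22) ∷ [])

tutteCoxeter : Graph
tutteCoxeter = hamiltonian 30
  ( (1 , 10) ∷ (4 , 25) ∷ (7 , 16) ∷ (13 , 22) ∷ (19 , 28) ∷ (2 , 15) ∷ (3 , 20)
  ∷ (8 , 21) ∷ (9 , 26) ∷ (14 , 27) ∷ (5 , 12) ∷ (6 , 29) ∷ (11 , 18) ∷ (17 , 24)
  ∷ (23 , 30) ∷ [])

G10 : Graph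
G10 = hamiltonian 34
  ( (3 , 10) ∷ (4 , 31) ∷ (11 , 18) ∷ (14 , 21) ∷ (17 , 24) ∷ (34 , 7) ∷ (1 , 16)
  ∷ (5 , 20) ∷ (6 , 25) ∷ (15 , 30) ∷ (2 , 27) ∷ (19 , 28) ∷ (23 , 32) ∷ (8 , 29)
  ∷ (9 , 22) ∷ (12 , 33) ∷ (13 , 26) ∷ [])

{-# OPTIONS --safe #-}

-- Upper bounds on the girth. A path-decomposition of width w gives a linear order of the
-- vertices in which every initial segment P has at most w vertices with a neighbour outside P.
-- The vertices of P with at most one neighbour outside P form a set with at most w outgoing
-- edges, and the size of this set grows by at most 4 from one segment to the next. So for every
-- a ≤ |G| some set S with a ≤ |S| ≤ a + 3 has at most w outgoing edges, hence many inner edges.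
-- In a cubic graph of large girth small sets are too sparse for that: repeatedly deleting a
-- vertex with at most one neighbour in the set leaves a core, and three disjoint arms issue from
-- a vertex of degree 3 of the core. The cube, the twisted cube, the Pappus graph and G(10) need
-- sharper sparsity bounds, which come from a search for small cores in these graphs.
--
-- Uniqueness. Small cubic graphs of given girth are classified by a search over the partial
-- graphs that embed into such a graph: a vertex with fewer than three known neighbours has a
-- further neighbour, which is either new or a known vertex that is not yet full and not too
-- near. A certificate prescribes the vertex to branch on and disposes of a partial graph into
-- which an earlier one embeds.

module Submission where

open import Data.Bool.Base using (Bool; T; _∧_; _∨_; false; if_then_else_; not; true)
open import Data.Bool.ListAction using (all; any)
open import Data.Bool.Properties as Bool
  using (T-≡; T?; not-involutive; not-¬; ∧-assoc; ∧-identityʳ)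
open import Data.Char.Base as Char using (Char)
open import Data.Empty using (⊥; ⊥-elim)
open import Data.Fin using (#_)
open import Data.Fin.Base using (Fin; combine; fromℕ<; punchOut; suc; toℕ; zero)
open import Data.Fin.Permutation using (↔⇒≡)
import Data.Fin.Properties as Fin
open import Data.Fin.Subset as Subset using (Subset; ∣_∣)
open import Data.List.Base as List
  using (List; []; _++_; _ʳ++_; _∷_; _∷ʳ_; allFin; concatMap; drop; filter; filterᵇ; foldr;
    length; map; reverse; tabulate; take; upTo)
open import Data.List.Extrema.Nat using (max; max≤v⁺; xs≤max)
open import Data.List.Membership.Propositional using (_∈_; _∉_; find)
open import Data.List.Membership.Propositional.Properties
  using (∈-++⁺ʳ; ∈-++⁺ˡ; ∈-++⁻; ∈-allFin; ∈-concatMap⁺; ∈-filter⁺; ∈-filter⁻; ∈-map⁺; ∈-map⁻;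
    ∈-tabulate⁺; ∈-upTo⁺; ∈-upTo⁻; ∈-∃++)
open import Data.List.Properties using (length-++; length-map; length-ʳ++; tabulate-cong; ʳ++-defn)
open import Data.List.Relation.Unary.All as All using (All; []; _∷_)
import Data.List.Relation.Unary.All.Properties as All
open import Data.List.Relation.Unary.AllPairs using ([]; _∷_)
open import Data.List.Relation.Unary.Any as Any using (Any; here; there)
import Data.List.Relation.Unary.Any.Properties as Any
open import Data.List.Relation.Unary.Linked using (Linked; [-]; []; _∷_; linked?)
import Data.List.Relation.Unary.Unique.DecPropositional as DecUnique
open import Data.List.Relation.Unary.Unique.Propositional using (Unique)
import Data.List.Relation.Unary.Unique.Propositional.Properties as Unique
open import Data.Maybe.Base using (Maybe; _>>=_; fromMaybe; is-just; just; nothing)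
open import Data.Nat.Base
open import Data.Nat.Properties
open import Data.Nat.Tactic.RingSolver using (solve-∀)
open import Data.Product.Base using (_,_; _×_; proj₁; proj₂; Σ; ∃-syntax)
open import Data.String.Base as String using (String)
open import Data.Sum.Base using ([_,_]′; _⊎_; inj₁; inj₂)
open import Data.Unit.Base using (⊤)
open import Data.Vec.Base as Vec using (Vec)
import Data.Vec.Properties as Vec
open import Defs
open import Function.Base using (_∘_; id)
open import Function.Bundles using (Equivalence; Inverse; mk↔ₛ′)
open import Relation.Binary.PropositionalEquality
open import Relation.Nullary.Decidable
  using (Dec; True; _×-dec_; _→-dec_; decidable-stable; does; no; toWitness; yes; ¬?)
open import Relation.Nullary.Negation using (contradiction; ¬_)
open import Algebra.Properties.CommutativeMonoid.Sum +-0-commutativeMonoid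
  using (sum; sum-cong-≗; sum-permute; sum-replicate-zero; ∑-comm; ∑-distrib-+)

-- Vertices with two or more outside neighbours are left out of the set because only then does a
-- bound on boundary vertices bound edges: such a vertex has at most one neighbour in the set, so
-- every boundary vertex accounts for at most one outgoing edge. The 4 is the entering vertex with
-- its three neighbours; it leaves a window of four possible sizes, all of which have to be blocked.
-- A set `S` with at most `c / 2` more inner edges than vertices has at least `|S| - c` outgoing
-- edges, so it is blocked once `c + w < |S|`. Girth `g` yields `c = 0` up to about `3 g / 2`
-- vertices, but the window reaches further. There a loss of 2 in `c` per vertex is too much:
-- adjacent vertices of degree 2 are removed in pairs, and a core without such pairs would need too
-- many vertices of degree 3. Girth alone cannot separate `K₃,₃` from the cube, the Heawood from the
-- Pappus graph, or the Tutte-Coxeter graph from `G10`. The unwanted graphs that the search by girth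
-- finds are removed by their order or by explicit path-decompositions of smaller width.

private variable
  ν : ℕ

open Graph using (order; Vertex)
open PathDecomposition using (width)

T⇒≡ : ∀ {b} → T b → b ≡ true
T⇒≡ = Equivalence.to T-≡

≡⇒T : ∀ {b} → b ≡ true → T b
≡⇒T = Equivalence.from T-≡

T∧⁻ : ∀ {a b} → T (a ∧ b) → T a × T b
T∧⁻ {true} t = _ , t

T∧⁺ : ∀ {a b} → T a → T b → T (a ∧ b)
T∧⁺ {true} _ t = t

T∨⁻ : ∀ {a b} → T (a ∨ b) → T a ⊎ T b
T∨⁻ {true}  t = inj₁ t
T∨⁻ {false} t = inj₂ t

Tnot : ∀ {b} → ¬ T b → T (not b)
Tnot {true}  f = f _
Tnot {false} _ = _

Tnot⁻ : ∀ {b} → T (not b) → ¬ T b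
Tnot⁻ {false} _ ()

-- Counting

𝟙 : Bool → ℕ
𝟙 true  = 1
𝟙 false = 0

sum-mono-≤ : {f g : Fin ν → ℕ} → (∀ i → f i ≤ g i) → sum f ≤ sum g
sum-mono-≤ {zero}  f≤g = z≤n
sum-mono-≤ {suc n} f≤g = +-mono-≤ (f≤g zero) (sum-mono-≤ (f≤g ∘ suc))

-- The equality case of a termwise estimate. It turns a tight double count into information on every
-- single vertex.
sum-rigid : {f g : Fin ν → ℕ} → (∀ i → f i ≤ g i) → sum g ≤ sum f → ∀ i → g i ≤ f i
sum-rigid f≤g Σg≤Σf zero =
  +-cancelʳ-≤ _ _ _ (≤-trans Σg≤Σf (+-monoʳ-≤ _ (sum-mono-≤ (f≤g ∘ suc))))
sum-rigid f≤g Σg≤Σf (suc i) =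
  sum-rigid (f≤g ∘ suc) (+-cancelˡ-≤ _ _ _ (≤-trans Σg≤Σf (+-monoˡ-≤ _ (f≤g zero)))) i

sum<⇒∃< : {f g : Fin ν → ℕ} → sum f < sum g → ∃[ i ] f i < g i
sum<⇒∃< {f = f} {g} Σf<Σg with Fin.any? (λ i → f i <? g i)
... | yes found = found
... | no  none  = contradiction Σf<Σg (≤⇒≯ (sum-mono-≤ (λ i → ≮⇒≥ (none ∘ (i ,_)))))

sum-*ˡ : ∀ c (f : Fin ν → ℕ) → sum (λ i → c * f i) ≡ c * sum f
sum-*ˡ {zero}  c f = sym (*-zeroʳ c)
sum-*ˡ {suc n} c f = trans (cong (c * f zero +_) (sum-*ˡ c (f ∘ suc))) (sym (*-distribˡ-+ c _ _))

sum-point : ∀ (i : Fin ν) (f : Fin ν → ℕ) → sum (λ j → 𝟙 (does (i Fin.≟ j)) * f j) ≡ f i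
sum-point {suc n} zero    f =
  trans (cong₂ _+_ (+-identityʳ (f zero)) (sum-replicate-zero n)) (+-identityʳ (f zero))
sum-point {suc n} (suc i) f = sum-point i (f ∘ suc)

count : (Fin ν → Bool) → ℕ
count p = sum (𝟙 ∘ p)

𝟙-mono : ∀ {a b} → (T a → T b) → 𝟙 a ≤ 𝟙 b
𝟙-mono {false}         _ = z≤n
𝟙-mono {true}  {true}  _ = ≤-refl
𝟙-mono {true}  {false} f = ⊥-elim (f _)

count-mono : {p q : Fin ν → Bool} → (∀ i → T (p i) → T (q i)) → count p ≤ count q
count-mono p⊆q = sum-mono-≤ (𝟙-mono ∘ p⊆q)

𝟙≤1 : ∀ b → 𝟙 b ≤ 1
𝟙≤1 true  = ≤-refl
𝟙≤1 false = z≤n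

count-true : ∀ n → count {n} (λ _ → true) ≡ n
count-true zero    = refl
count-true (suc n) = cong suc (count-true n)

∣tabulate∣ : (p : Fin ν → Bool) → ∣ Vec.tabulate p ∣ ≡ count p
∣tabulate∣ {zero}  p = refl
∣tabulate∣ {suc n} p with p zero
... | true  = cong suc (∣tabulate∣ (p ∘ suc))
... | false = ∣tabulate∣ (p ∘ suc)

∣lookup∣ : (p : Subset ν) → ∣ p ∣ ≡ count (Vec.lookup p)
∣lookup∣ Vec.[]            = refl
∣lookup∣ (true  Vec.∷ p) = cong suc (∣lookup∣ p)
∣lookup∣ (false Vec.∷ p) = ∣lookup∣ p

members : (Fin ν → Bool) → List (Fin ν)
members p = filter (T? ∘ p) (allFin _)

length-members : (p : Fin ν → Bool) → length (members p) ≡ count p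
length-members p = go id
  where
  go : ∀ {m} (h : Fin m → Fin _) → length (filter (T? ∘ p) (List.tabulate h)) ≡ count (p ∘ h)
  go {zero}  h = refl
  go {suc m} h with p (h zero)
  ... | true  = cong suc (go (h ∘ suc))
  ... | false = go (h ∘ suc)

members-unique : (p : Fin ν → Bool) → Unique (members p)
members-unique p = Unique.filter⁺ (T? ∘ p) (Unique.allFin⁺ _)

∈-members⁺ : (p : Fin ν → Bool) {i : Fin ν} → T (p i) → i ∈ members p
∈-members⁺ p = ∈-filter⁺ (T? ∘ p) (∈-allFin _)

∈-members⁻ : (p : Fin ν → Bool) {i : Fin ν} → i ∈ members p → T (p i)
∈-members⁻ p = proj₂ ∘ ∈-filter⁻ (T? ∘ p) {xs = allFin _}

unique-⊆⇒length≤ : {A : Set} {xs ys : List A} → Unique xs → (∀ {x} → x ∈ xs → x ∈ ys) →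
                   length xs ≤ length ys
unique-⊆⇒length≤ {xs = []} _ _ = z≤n
unique-⊆⇒length≤ {xs = x ∷ xs} (x∉xs ∷ uxs) xs⊆ys with ∈-∃++ (xs⊆ys (here refl))
... | as , bs , refl = begin
  suc (length xs)              ≤⟨ s≤s (unique-⊆⇒length≤ uxs sub) ⟩
  suc (length (as ++ bs))      ≡⟨ cong suc (length-++ as) ⟩
  suc (length as + length bs)  ≡⟨ +-suc (length as) (length bs) ⟨
  length as + suc (length bs)  ≡⟨ length-++ as ⟨
  length (as ++ x ∷ bs)        ∎
  where
  open ≤-Reasoning
  sub : ∀ {y} → y ∈ xs → y ∈ as ++ bs
  sub {y} y∈xs with ∈-++⁻ as (xs⊆ys (there y∈xs))
  ... | inj₁ y∈as         = ∈-++⁺ˡ y∈as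
  ... | inj₂ (here y≡x)   = contradiction (sym y≡x) (All.lookup x∉xs y∈xs)
  ... | inj₂ (there y∈bs) = ∈-++⁺ʳ as y∈bs

length≤count : {p : Fin ν → Bool} {xs : List (Fin ν)} → Unique xs → All (T ∘ p) xs →
               length xs ≤ count p
length≤count {p = p} {xs} uxs pxs =
  ≤-trans (unique-⊆⇒length≤ uxs (∈-members⁺ p ∘ All.lookup pxs)) (≤-reflexive (length-members p))

count≤length : {p : Fin ν → Bool} {xs : List (Fin ν)} → (∀ i → T (p i) → i ∈ xs) →
               count p ≤ length xs
count≤length {p = p} p⊆xs =
  ≤-trans (≤-reflexive (sym (length-members p)))
          (unique-⊆⇒length≤ (members-unique p) (λ {i} i∈ → p⊆xs i (∈-members⁻ p i∈)))

_∖_ : (Fin ν → Bool) → Fin ν → (Fin ν → Bool)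
(p ∖ x) i = p i ∧ not (does (x Fin.≟ i))

𝟙-∖ : (p : Fin ν → Bool) {x : Fin ν} → T (p x) → ∀ i →
      𝟙 (p i) ≡ 𝟙 ((p ∖ x) i) + 𝟙 (does (x Fin.≟ i))
𝟙-∖ p {x} px i with x Fin.≟ i
... | yes refl with true ← p x = refl
... | no  _    with p i
...   | true  = refl
...   | false = refl

count-∖ : (p : Fin ν → Bool) {x : Fin ν} → T (p x) → count p ≡ suc (count (p ∖ x))
count-∖ p {x} px = begin
  count p                                           ≡⟨ sum-cong-≗ (𝟙-∖ p px) ⟩
  sum (λ i → 𝟙 ((p ∖ x) i) + 𝟙 (does (x Fin.≟ i)))      ≡⟨ ∑-distrib-+ (𝟙 ∘ (p ∖ x)) _ ⟩
  count (p ∖ x) + sum (λ i → 𝟙 (does (x Fin.≟ i)))      ≡⟨ cong (count (p ∖ x) +_) point ⟩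
  count (p ∖ x) + 1                                 ≡⟨ +-comm _ 1 ⟩
  suc (count (p ∖ x))                               ∎
  where
  open ≡-Reasoning
  point : sum (λ i → 𝟙 (does (x Fin.≟ i))) ≡ 1
  point = trans (sum-cong-≗ (λ i → sym (*-identityʳ (𝟙 (does (x Fin.≟ i)))))) (sum-point x (λ _ → 1))

-- Punching the missed value `y` out of the codomain leaves an injection into one element fewer.
injective-< : ∀ {m n} {f : Fin m → Fin n} → (∀ {i j} → f i ≡ f j → i ≡ j) →
              ∀ y → (∀ i → f i ≢ y) → m < n
injective-< {n = suc n} f-inj y y∉f =
  s≤s (Fin.injective⇒≤ {f = λ i → punchOut (≢-sym (y∉f i))}
    (λ {i} {j} eq → f-inj (Fin.punchOut-injective (≢-sym (y∉f i)) (≢-sym (y∉f j)) eq)))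

-- Walks and girth

Girth≥ : ℕ → Graph → Set
Girth≥ g G = ∀ {ℓ} → Cycle G ℓ → g ≤ ℓ

unique-++⁻ : ∀ {A : Set} (l : List A) {m} → Unique (l ++ m) →
             Unique l × Unique m × (∀ {x} → x ∈ l → x ∉ m)
unique-++⁻ []      um        = [] , um , λ ()
unique-++⁻ (x ∷ l) (x∉ ∷ u) with unique-++⁻ l u
... | ul , um , disjoint = All.++⁻ˡ l x∉ ∷ ul , um , λ where
  (here refl) x∈m → All.lookup (All.++⁻ʳ l x∉) x∈m refl
  (there y∈l)     → disjoint y∈l

module Walks (G : Graph) where
  open Graph G using (adj; Adj; adj-sym; adj-irrefl; degree)

  Adj-sym : ∀ {u v} → Adj u v → Adj v u
  Adj-sym {u} {v} = subst T (adj-sym u v)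

  Adj⇒≢ : ∀ {u v} → Adj u v → u ≢ v
  Adj⇒≢ {u} uv refl = subst T (adj-irrefl u) uv

  -- Only a turn back along the edge just used is forbidden, a condition that can be maintained step
  -- by step. Distinctness of the vertices of a short walk then comes from the girth, in
  -- `nb-unique`.
  data NonBacktracking : List (Vertex G) → Set where
    one  : ∀ x → NonBacktracking (x ∷ [])
    two  : ∀ {x y} → Adj x y → NonBacktracking (x ∷ y ∷ [])
    step : ∀ {x y z l} → Adj x y → x ≢ z → NonBacktracking (y ∷ z ∷ l) →
           NonBacktracking (x ∷ y ∷ z ∷ l)

  nb-tail : ∀ {x y l} → NonBacktracking (x ∷ y ∷ l) → NonBacktracking (y ∷ l)
  nb-tail (two _)      = one _
  nb-tail (step _ _ w) = w

  nb-head : ∀ {x y l} → NonBacktracking (x ∷ y ∷ l) → Adj x y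
  nb-head (two xy)      = xy
  nb-head (step xy _ _) = xy

  Avoids : Vertex G → List (Vertex G) → Set
  Avoids x []      = ⊤
  Avoids x (y ∷ _) = x ≢ y

  nb-cons : ∀ {x y l} → Adj x y → Avoids x l → NonBacktracking (y ∷ l) →
            NonBacktracking (x ∷ y ∷ l)
  nb-cons {l = []}    xy _   _ = two xy
  nb-cons {l = _ ∷ _} xy x≢z w = step xy x≢z w

  nb-avoids : ∀ {x y l} → NonBacktracking (x ∷ y ∷ l) → Avoids x l
  nb-avoids (two _)        = _
  nb-avoids (step _ x≢z _) = x≢z

  DifferentHeads : List (Vertex G) → List (Vertex G) → Set
  DifferentHeads []      _ = ⊤
  DifferentHeads (x ∷ _) l = Avoids x l

  -- Two walks leaving v by different edges form one walk through v.
  nb-join : ∀ {v} l m → NonBacktracking (v ∷ l) → NonBacktracking (v ∷ m) →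
            DifferentHeads l m → NonBacktracking (l ʳ++ v ∷ m)
  nb-join         []          m _ w _    = w
  nb-join {v} (x ∷ [])    m (two vx) w diff = nb-cons (Adj-sym vx) diff w
  nb-join {v} (x ∷ y ∷ l) m (step vx v≢y w′) w diff =
    nb-join (y ∷ l) (v ∷ m) w′ (nb-cons (Adj-sym vx) diff w) (≢-sym v≢y)

  private
    linked : ∀ {x y} l m → NonBacktracking (x ∷ l ++ y ∷ m) → Linked Adj (x ∷ l ∷ʳ y)
    linked []      m w = nb-head w ∷ [-]
    linked (z ∷ l) m w = nb-head w ∷ linked l m (nb-tail w)

  -- A return to `x` after one step would be a loop, and after two steps a turn back. A later return
  -- closes a cycle, which is shorter than `g` because the walk lists `x` twice among at most `g`
  -- vertices.
  nb-fresh : ∀ {g x l} → Girth≥ g G → NonBacktracking (x ∷ l) → length (x ∷ l) ≤ g →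
             Unique l → x ∉ l
  nb-fresh {g} {x} girth w len ul x∈l with ∈-∃++ x∈l
  ... | [] , _ , refl = Adj⇒≢ (nb-head w) refl
  ... | _ ∷ [] , _ , refl = nb-avoids w refl
  ... | as@(_ ∷ _ ∷ _) , bs , refl = <⇒≱ short (girth cycle)
    where
    short : length (x ∷ as) < g
    short = ≤-trans (s≤s (≤-trans (m≤m+n (suc (length as)) (length bs))
      (≤-reflexive (trans (sym (+-suc (length as) (length bs))) (sym (length-++ as)))))) len

    x∉as : All (x ≢_) as
    x∉as = All.tabulate λ { y∈as refl → proj₂ (proj₂ (unique-++⁻ as ul)) y∈as (here refl) }

    cycle : Cycle G (length (x ∷ as))
    cycle = record
      { start = x ; rest = as ; distinct = x∉as ∷ proj₁ (unique-++⁻ as ul)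
      ; closed = linked as bs w ; size = refl ; 3≤ℓ = s≤s (s≤s (s≤s z≤n)) }

  nb-unique : ∀ {g} l → Girth≥ g G → NonBacktracking l → length l ≤ g → Unique l
  nb-unique (x ∷ [])        girth w len = [] ∷ []
  nb-unique (x ∷ l@(_ ∷ _)) girth w len =
    let ul = nb-unique l girth (nb-tail w) (≤-trans (n≤1+n _) len)
    in All.¬Any⇒All¬ l (nb-fresh girth w len ul) ∷ ul

  degree≡count : ∀ v → degree v ≡ count (adj v)
  degree≡count v = ∣tabulate∣ (adj v)


-- Classification by search

-- The bound on the order makes `ψ` surjective. Non-edges are preserved too, since an additional
-- edge at `ψ u` would give it a fourth neighbour.
injective-hom⇒≅ : ∀ {G H} → Cubic G → Cubic H → order G ≤ order H →
  (ψ : Vertex H → Vertex G) → (∀ {u v} → ψ u ≡ ψ v → u ≡ v) →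
  (∀ {u v} → Graph.Adj H u v → Graph.Adj G (ψ u) (ψ v)) → G ≅ H
injective-hom⇒≅ {G} {H} cubicG cubicH G≤H ψ inj hom = record
  { bijection = mk↔ₛ′ ψ⁻¹ ψ (λ u → inj (ψψ⁻¹ (ψ u))) ψψ⁻¹
  ; preserves-adj = λ x y → trans (cong₂ (Graph.adj G) (sym (ψψ⁻¹ x)) (sym (ψψ⁻¹ y)))
                                  (adj-ψ (ψ⁻¹ x) (ψ⁻¹ y)) }
  where
  module G′ = Walks G
  module H′ = Walks H

  preimage : ∀ y → ∃[ u ] ψ u ≡ y
  preimage y with Fin.any? (λ u → ψ u Fin.≟ y)
  ... | yes found = found
  ... | no  none  = contradiction G≤H (<⇒≱ (injective-< inj y (λ u → none ∘ (u ,_))))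

  ψ⁻¹ : Vertex G → Vertex H
  ψ⁻¹ = proj₁ ∘ preimage

  ψψ⁻¹ : ∀ y → ψ (ψ⁻¹ y) ≡ y
  ψψ⁻¹ = proj₂ ∘ preimage

  adj-ψ : ∀ u v → Graph.adj G (ψ u) (ψ v) ≡ Graph.adj H u v
  adj-ψ u v with Graph.adj H u v in uv
  ... | true  = T⇒≡ (hom (≡⇒T uv))
  ... | false with Graph.adj G (ψ u) (ψ v) in ψuψv
  ...   | false = refl
  ...   | true  = contradiction (subst (_≤ count (Graph.adj G (ψ u))) (length-map ψ ns) four)
                                (<⇒≱ (≤-reflexive (cong suc three)))
    where
    ns : List (Vertex H)
    ns = v ∷ members (Graph.adj H u)

    ns-unique : Unique ns
    ns-unique = All.¬Any⇒All¬ _ (λ v∈ → subst T uv (∈-members⁻ _ v∈)) ∷ members-unique _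

    all-adj : ∀ {w} → w ∈ ns → Graph.Adj G (ψ u) (ψ w)
    all-adj (here refl) = ≡⇒T ψuψv
    all-adj (there w∈)  = hom (∈-members⁻ _ w∈)

    four : length (map ψ ns) ≤ count (Graph.adj G (ψ u))
    four = length≤count (Unique.map⁺ inj ns-unique) (All.map⁺ (All.tabulate all-adj))

    three : count (Graph.adj G (ψ u)) ≡ length (members (Graph.adj H u))
    three = trans (trans (sym (G′.degree≡count (ψ u))) (cubicG (ψ u)))
      (sym (trans (length-members (Graph.adj H u)) (trans (sym (H′.degree≡count u)) (cubicH u))))

lookupᵐ : {A : Set} → List A → ℕ → Maybe A
lookupᵐ []       _       = nothing
lookupᵐ (x ∷ xs) zero    = just x
lookupᵐ (x ∷ xs) (suc i) = lookupᵐ xs i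

lookupᵐ-∈ : {A : Set} (xs : List A) (i : ℕ) {x : A} → lookupᵐ xs i ≡ just x → x ∈ xs
lookupᵐ-∈ (x ∷ xs) zero    refl = here refl
lookupᵐ-∈ (x ∷ xs) (suc i) eq   = there (lookupᵐ-∈ xs i eq)

unique-map : {A B : Set} (f : A → B) {xs : List A} → Unique xs →
             (∀ {x y} → x ∈ xs → y ∈ xs → f x ≡ f y → x ≡ y) → Unique (map f xs)
unique-map f []          inj = []
unique-map f (x∉ ∷ uxs) inj =
  All.map⁺ (All.tabulate λ y∈ fx≡fy → All.lookup x∉ y∈ (inj (here refl) (there y∈) fx≡fy)) ∷
  unique-map f uxs (λ x∈ y∈ → inj (there x∈) (there y∈))

EdgeList : Set
EdgeList = List (ℕ × ℕ)

elem : ℕ → List ℕ → Bool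
elem x = any (x ≡ᵇ_)

distinct : List ℕ → Bool
distinct []       = true
distinct (x ∷ xs) = not (elem x xs) ∧ distinct xs

joins : EdgeList → ℕ → ℕ → Bool
joins es a b = any (λ (c , d) → ((a ≡ᵇ c) ∧ (b ≡ᵇ d)) ∨ ((a ≡ᵇ d) ∧ (b ≡ᵇ c))) es

nbrs : EdgeList → ℕ → List ℕ
nbrs []             v = []
nbrs ((a , b) ∷ es) v =
  if a ≡ᵇ v then b ∷ nbrs es v else if b ≡ᵇ v then a ∷ nbrs es v else nbrs es v

elem⁻ : ∀ {x} xs → T (elem x xs) → x ∈ xs
elem⁻ xs t = Any.map (≡ᵇ⇒≡ _ _) (Any.any⁻ _ xs t)

elem⁺ : ∀ {x xs} → x ∈ xs → T (elem x xs)
elem⁺ x∈ = Any.any⁺ _ (Any.map (≡⇒≡ᵇ _ _) x∈)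

distinct⇒unique : ∀ xs → T (distinct xs) → Unique xs
distinct⇒unique []       _ = []
distinct⇒unique (x ∷ xs) t =
  All.¬Any⇒All¬ xs (Tnot⁻ (proj₁ (T∧⁻ t)) ∘ elem⁺) ∷
  distinct⇒unique xs (proj₂ (T∧⁻ {not (elem x xs)} t))

joins⁻ : ∀ es {a b} → T (joins es a b) → (a , b) ∈ es ⊎ (b , a) ∈ es
joins⁻ (_ ∷ es) {a} {b} t with T∨⁻ t
... | inj₂ t′ = [ inj₁ ∘ there , inj₂ ∘ there ]′ (joins⁻ es t′)
... | inj₁ t′ with T∨⁻ t′
...   | inj₁ eq with a≡ , b≡ ← T∧⁻ {a ≡ᵇ _} eq
        with refl ← ≡ᵇ⇒≡ a _ a≡ | refl ← ≡ᵇ⇒≡ b _ b≡ = inj₁ (here refl)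
...   | inj₂ eq with a≡ , b≡ ← T∧⁻ {a ≡ᵇ _} eq
        with refl ← ≡ᵇ⇒≡ a _ a≡ | refl ← ≡ᵇ⇒≡ b _ b≡ = inj₂ (here refl)

nbrs⁻ : ∀ es {v x} → x ∈ nbrs es v → (v , x) ∈ es ⊎ (x , v) ∈ es
nbrs⁻ ((a , b) ∷ es) {v} x∈ with a ≡ᵇ v in a≡v | b ≡ᵇ v in b≡v | x∈
... | true  | _     | here refl rewrite ≡ᵇ⇒≡ a v (≡⇒T a≡v) = inj₁ (here refl)
... | true  | _     | there x∈′ = [ inj₁ ∘ there , inj₂ ∘ there ]′ (nbrs⁻ es x∈′)
... | false | true  | here refl rewrite ≡ᵇ⇒≡ b v (≡⇒T b≡v) = inj₂ (here refl)
... | false | true  | there x∈′ = [ inj₁ ∘ there , inj₂ ∘ there ]′ (nbrs⁻ es x∈′)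
... | false | false | x∈′       = [ inj₁ ∘ there , inj₂ ∘ there ]′ (nbrs⁻ es x∈′)

nbrs⁺ : ∀ es {v x} → (v , x) ∈ es → x ∈ nbrs es v
nbrs⁺ ((a , b) ∷ es) {v} (here refl) rewrite T⇒≡ (≡⇒≡ᵇ v v refl) = here refl
nbrs⁺ ((a , b) ∷ es) {v} (there ∈es) with a ≡ᵇ v | b ≡ᵇ v
... | true  | _     = there (nbrs⁺ es ∈es)
... | false | true  = there (nbrs⁺ es ∈es)
... | false | false = nbrs⁺ es ∈es

nbrs-sym : ∀ es {v x} → x ∈ nbrs es v → v ∈ nbrs es x
nbrs-sym es = [ nbrs⁺ʳ es , nbrs⁺ es ]′ ∘ nbrs⁻ es
  where
  nbrs⁺ʳ : ∀ es {v x} → (v , x) ∈ es → v ∈ nbrs es x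
  nbrs⁺ʳ ((a , b) ∷ es) {v} {x} (here refl) with v ≡ᵇ x in eq
  ... | true = here (≡ᵇ⇒≡ v x (≡⇒T eq))
  ... | false rewrite T⇒≡ (≡⇒≡ᵇ x x refl) = here refl
  nbrs⁺ʳ ((a , b) ∷ es) {v} {x} (there ∈es) with a ≡ᵇ x | b ≡ᵇ x
  ... | true  | _     = there (nbrs⁺ʳ es ∈es)
  ... | false | true  = there (nbrs⁺ʳ es ∈es)
  ... | false | false = nbrs⁺ʳ es ∈es

nbrs-unique : ∀ es {a b} → (∀ v → Unique (nbrs es v)) → a ≢ b → b ∉ nbrs es a →
              ∀ v → Unique (nbrs ((a , b) ∷ es) v)
nbrs-unique es {a} {b} u a≢b b∉ v with a ≡ᵇ v in a≡v | b ≡ᵇ v in b≡v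
... | true  | _     rewrite ≡ᵇ⇒≡ a v (≡⇒T a≡v) = All.¬Any⇒All¬ _ b∉ ∷ u v
... | false | true  rewrite ≡ᵇ⇒≡ b v (≡⇒T b≡v) = All.¬Any⇒All¬ _ (b∉ ∘ nbrs-sym es) ∷ u v
... | false | false = u v

-- The vertices at the ends of the non-backtracking walks of length at most r from c
-- whose first step does not lead to p.
ball  : EdgeList → (r p c : ℕ) → List ℕ
balls : EdgeList → (r p c : ℕ) → List ℕ → List ℕ
ball es zero    p c = c ∷ []
ball es (suc r) p c = c ∷ balls es r p c (nbrs es c)
balls es r p c []       = []
balls es r p c (x ∷ xs) =
  if x ≡ᵇ p then balls es r p c xs else ball es r c x ++ balls es r p c xs

balls⁻ : ∀ es r p c xs {w} → w ∈ balls es r p c xs →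
         ∃[ x ] x ∈ xs × x ≢ p × w ∈ ball es r c x
balls⁻ es r p c (x ∷ xs) w∈ with x ≡ᵇ p in x≡p
... | true  = let y , y∈ , rest = balls⁻ es r p c xs w∈ in y , there y∈ , rest
... | false with ∈-++⁻ (ball es r c x) w∈
...   | inj₁ w∈ball = x , here refl , (λ { refl → subst T x≡p (≡⇒≡ᵇ x x refl) }) , w∈ball
...   | inj₂ w∈rest = let y , y∈ , rest = balls⁻ es r p c xs w∈rest in y , there y∈ , rest

balls⁺ : ∀ es r p c xs {x} → x ∈ xs → x ≢ p → x ∈ balls es r p c xs
balls⁺ es r p c (x ∷ xs) x∈ x≢p with x ≡ᵇ p in x≡p | x∈
... | true  | here refl = contradiction (≡ᵇ⇒≡ x p (≡⇒T x≡p)) x≢p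
... | true  | there x∈′ = balls⁺ es r p c xs x∈′ x≢p
... | false | there x∈′ = ∈-++⁺ʳ (ball es r c x) (balls⁺ es r p c xs x∈′ x≢p)
... | false | here refl with r
...   | zero  = here refl
...   | suc _ = here refl


order>0 : ∀ G → 0 < order G
order>0 record { order = n ; nonEmpty = n≢0 } = >-nonZero⁻¹ n ⦃ n≢0 ⦄

-- The vertices are the numbers below labels, numbered in the order of their discovery.
record PartialGraph : Set where
  constructor partialGraph
  field
    labels : ℕ
    links  : EdgeList

open PartialGraph using (labels; links)

-- branch v cs: treat the possible further neighbours of v in turn; image i σ: the partial graph
-- treated i + 1 steps ago embeds via σ; leaf t σ cs: the t-th target embeds via σ, so either the
-- graph is this target or, treated by cs, it has a vertex outside.
data Certificate : Set where
  branch : (v : ℕ) → List Certificate → Certificate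
  image  : (i : ℕ) (σ : ℕ → ℕ) → Certificate
  leaf   : (t : ℕ) (σ : ℕ → ℕ) → List Certificate → Certificate

candidates : EdgeList → ℕ → List ℕ → List ℕ
candidates es k near = filterᵇ (λ w → not (elem w near) ∧ (length (nbrs es w) <ᵇ 3)) (upTo k)

embeds : (ℕ → ℕ) → PartialGraph → PartialGraph → Bool
embeds σ (partialGraph k es) (partialGraph l fs) =
  all (_<ᵇ l) σs ∧ (distinct σs ∧ all (λ (a , b) → joins fs (σ a) (σ b)) es)
  where σs = map σ (upTo k)

labelled : Graph → PartialGraph
labelled H = partialGraph (order H)
  (concatMap (λ u → map (λ v → toℕ u , toℕ v) (members (Graph.adj H u))) (allFin _))

labelled-edge : ∀ H {u v} → Graph.Adj H u v → (toℕ u , toℕ v) ∈ links (labelled H)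
labelled-edge H {u} {v} uv =
  ∈-concatMap⁺ (λ u → map (λ v → toℕ u , toℕ v) (members (Graph.adj H u)))
    (Any.map (λ { refl → ∈-map⁺ _ (∈-members⁺ (Graph.adj H u) uv) }) (∈-allFin u))

unique-map⁻ : {A B : Set} (f : A → B) (xs : List A) → Unique (map f xs) →
              ∀ {x y} → x ∈ xs → y ∈ xs → f x ≡ f y → x ≡ y
unique-map⁻ f (_ ∷ xs) _          (here refl) (here refl) _ = refl
unique-map⁻ f (_ ∷ xs) (fx∉ ∷ _) (here refl) (there y∈)  eq =
  contradiction eq (All.lookup fx∉ (∈-map⁺ f y∈))
unique-map⁻ f (_ ∷ xs) (fy∉ ∷ _) (there x∈)  (here refl) eq =
  contradiction (sym eq) (All.lookup fy∉ (∈-map⁺ f x∈))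
unique-map⁻ f (_ ∷ xs) (_ ∷ u)    (there x∈)  (there y∈)  eq = unique-map⁻ f xs u x∈ y∈ eq

whenᵐ : {A : Set} → Bool → Maybe A → Maybe A
whenᵐ b m = if b then m else nothing

whenᵐ⁻ : {A : Set} (b : Bool) {m : Maybe A} {x : A} → whenᵐ b m ≡ just x → T b × m ≡ just x
whenᵐ⁻ true eq = _ , eq

>>=⁻ : {A B : Set} (m : Maybe A) {f : A → Maybe B} {y : B} → (m >>= f) ≡ just y →
       ∃[ x ] m ≡ just x × f x ≡ just y
>>=⁻ (just x) eq = x , refl , eq

-- N bounds the order and 3 + r the girth of the graphs that are searched.
module Search (N r : ℕ) (targets : List PartialGraph) where

  -- Once a target has been filled in, all known vertices have their three neighbours. A vertex
  -- outside then lies in another component and has to be introduced without an edge.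
  extensions : PartialGraph → List PartialGraph
  extensions (partialGraph k es) = if k <ᵇ N then partialGraph (suc k) es ∷ [] else []

  children : PartialGraph → ℕ → List PartialGraph
  children (partialGraph k es) v =
    (if k <ᵇ N then partialGraph (suc k) ((v , k) ∷ es) ∷ [] else []) ++
    -- A walk of length at most `r + 1` from `v` to `w` and a new edge between them would close a
    -- cycle of length at most `r + 2`, below the girth. The argument `k` is not a label of this
    -- partial graph, so no first step is excluded.
    map (λ w → partialGraph k ((v , w) ∷ es)) (candidates es k (ball es (suc r) k v))

  -- The list `done` holds the partial graphs already disposed of. `P` joins it only after its own
  -- subtree has been checked, so an `image` never appeals to a case that is still open.
  check    : Certificate → PartialGraph → List PartialGraph → Maybe (List PartialGraph)
  checkAll : List Certificate → List PartialGraph → List PartialGraph → Maybe (List PartialGraph)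
  check (branch v cs) P done =
    whenᵐ ((v <ᵇ labels P) ∧ (length (nbrs (links P) v) <ᵇ 3))
      (checkAll cs (children P v) done >>= λ done′ → just (P ∷ done′))
  check (image i σ) P done =
    lookupᵐ done i >>= λ Q → whenᵐ (embeds σ Q P) (just (P ∷ done))
  check (leaf t σ cs) P done =
    lookupᵐ targets t >>= λ Q → whenᵐ ((labels Q ≡ᵇ labels P) ∧ embeds σ Q P)
      (checkAll cs (extensions P) done >>= λ done′ → just (P ∷ done′))
  checkAll []       []       done = just done
  checkAll (c ∷ cs) (P ∷ Ps) done = check c P done >>= checkAll cs Ps
  checkAll _        _        done = nothing

Proper : PartialGraph → Set
Proper (partialGraph k es) =
  (∀ {a b} → (a , b) ∈ es → a < k × b < k) × (∀ v → Unique (nbrs es v))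

module _ {k es} (proper : Proper (partialGraph k es)) where

  nbrs-< : ∀ {v x} → x ∈ nbrs es v → v < k × x < k
  nbrs-< x∈ with nbrs⁻ es x∈
  ... | inj₁ ∈es = proj₁ proper ∈es
  ... | inj₂ ∈es = let x<k , v<k = proj₁ proper ∈es in v<k , x<k

  proper-edge : ∀ {v w} → v < k → w < k → v ≢ w → w ∉ nbrs es v →
                Proper (partialGraph k ((v , w) ∷ es))
  proper-edge v<k w<k v≢w w∉ =
    (λ { (here refl) → v<k , w<k ; (there ∈es) → proj₁ proper ∈es }) ,
    nbrs-unique es (proj₂ proper) v≢w w∉

  proper-extension : Proper (partialGraph (suc k) es)
  proper-extension =
    (λ ∈es → let a<k , b<k = proj₁ proper ∈es in m<n⇒m<1+n a<k , m<n⇒m<1+n b<k) , proj₂ proper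

module Soundness (N r : ℕ) (targets : List Graph) (cubic-targets : All Cubic targets)
  (G : Graph) (cubic : Cubic G) (girth : Girth≥ (3 + r) G) (bounded : order G ≤ N) where

  open Search N r (map labelled targets)
  open Graph G using (adj; Adj)
  open Walks G

  -- `φ` is defined on all numbers so that it can be composed with the maps of a certificate without
  -- carrying bounds; the conditions concern labels only.
  record Embedding (P : PartialGraph) : Set where
    field
      φ   : ℕ → Vertex G
      inj : ∀ {i j} → i < labels P → j < labels P → φ i ≡ φ j → i ≡ j
      hom : ∀ {a b} → (a , b) ∈ links P → Adj (φ a) (φ b)

  Good : PartialGraph → Set
  Good P = Embedding P → Any (G ≅_) targets

  Sound : PartialGraph → Set
  Sound P = Proper P × Good P

  degree3 : ∀ v → count (adj v) ≡ 3
  degree3 v = trans (sym (degree≡count v)) (cubic v)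

  module _ {k es} (proper : Proper (partialGraph k es)) (E : Embedding (partialGraph k es)) where
    open Embedding E

    φ-adj : ∀ {v x} → x ∈ nbrs es v → Adj (φ v) (φ x)
    φ-adj x∈ = [ hom , Adj-sym ∘ hom ]′ (nbrs⁻ es x∈)

    unnamed⇒k<order : ∀ z → (∀ {w} → w < k → φ w ≢ z) → k < order G
    unnamed⇒k<order z unnamed = injective-< {f = φ ∘ toℕ}
      (λ {i} {j} eq → Fin.toℕ-injective (inj (Fin.toℕ<n i) (Fin.toℕ<n j) eq))
      z (λ i → unnamed (Fin.toℕ<n i))

    named? : ∀ z → Dec (∃[ w ] w < k × φ w ≡ z)
    named? z with Any.any? (λ w → φ w Fin.≟ z) (upTo k)
    ... | yes found = let w , w∈ , eq = find found in yes (w , ∈-upTo⁻ w∈ , eq)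
    ... | no  none  = no λ (w , w<k , eq) → none (Any.map (λ { refl → eq }) (∈-upTo⁺ w<k))

    extend : ∀ z → (∀ {w} → w < k → φ w ≢ z) →
             ∃[ E′ ] Embedding.φ {partialGraph (suc k) es} E′ k ≡ z × (∀ {i} → i < k → Embedding.φ E′ i ≡ φ i)
    extend z unnamed = record { φ = φ′ ; inj = inj′ ; hom = hom′ } , new , old
      where
      φ′ : ℕ → Vertex G
      φ′ i = if i ≡ᵇ k then z else φ i

      old : ∀ {i} → i < k → φ′ i ≡ φ i
      old {i} i<k with i ≡ᵇ k in eq
      ... | true  = contradiction (≡ᵇ⇒≡ i k (≡⇒T eq)) (<⇒≢ i<k)
      ... | false = refl

      new : φ′ k ≡ z
      new rewrite T⇒≡ (≡⇒≡ᵇ k k refl) = refl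

      below : ∀ {i} → i < suc k → (i ≡ᵇ k) ≡ false → i < k
      below {i} (s≤s i≤k) eq = ≤∧≢⇒< i≤k λ { refl → subst T eq (≡⇒≡ᵇ i i refl) }

      inj′ : ∀ {i j} → i < suc k → j < suc k → φ′ i ≡ φ′ j → i ≡ j
      inj′ {i} {j} i≤k j≤k eq with i ≡ᵇ k in i≡k | j ≡ᵇ k in j≡k
      ... | true  | true  = trans (≡ᵇ⇒≡ i k (≡⇒T i≡k)) (sym (≡ᵇ⇒≡ j k (≡⇒T j≡k)))
      ... | true  | false = contradiction (sym eq) (unnamed (below j≤k j≡k))
      ... | false | true  = contradiction eq (unnamed (below i≤k i≡k))
      ... | false | false = inj (below i≤k i≡k) (below j≤k j≡k) eq

      hom′ : ∀ {a b} → (a , b) ∈ es → Adj (φ′ a) (φ′ b)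
      hom′ ∈es = let a<k , b<k = proj₁ proper ∈es in
        subst₂ Adj (sym (old a<k)) (sym (old b<k)) (hom ∈es)

    -- The walk is stated together with its predecessor `y`, which makes the induction work: the ban
    -- on stepping to `p` becomes the absence of a turn back at `φ c`. Injectivity of `φ` carries
    -- the ban from labels to vertices.
    ball-walk : ∀ r p c y {w} → c < k → Adj y (φ c) →
      (∀ {x} → x ∈ nbrs es c → x ≢ p → y ≢ φ x) → w ∈ ball es r p c →
      ∃[ l ] NonBacktracking (y ∷ φ c ∷ l) × length l ≤ r × φ w ∈ φ c ∷ l
    ball-walk zero    p c y c<k yc avoid (here refl) = [] , two yc , z≤n , here refl
    ball-walk (suc r) p c y c<k yc avoid (here refl) = [] , two yc , z≤n , here refl
    ball-walk (suc r) p c y c<k yc avoid (there w∈) =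
      let x , x∈ , x≢p , w∈ball = balls⁻ es r p c (nbrs es c) w∈
          l , walk , len , φw∈ = ball-walk r c x (φ c) (proj₂ (nbrs-< proper x∈)) (φ-adj x∈)
            (λ x′∈ x′≢c eq → x′≢c (sym (inj c<k (proj₂ (nbrs-< proper x′∈)) eq))) w∈ball
      in φ x ∷ l , step yc (avoid x∈ x≢p) walk , s≤s len , there φw∈

    new-neighbour : ∀ v → length (nbrs es v) < 3 →
                    ∃[ z ] Adj (φ v) z × z ∉ map φ (nbrs es v)
    new-neighbour v few
      with Fin.any? (λ z → T? (adj (φ v) z) ×-dec ¬? (Any.any? (z Fin.≟_) (map φ (nbrs es v))))
    ... | yes found = found
    ... | no  none  = contradiction few (≤⇒≯ (begin
      3                            ≡⟨ degree3 (φ v) ⟨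
      count (adj (φ v))            ≤⟨ count≤length {p = adj (φ v)} (λ z vz →
        decidable-stable (Any.any? (z Fin.≟_) (map φ (nbrs es v))) (λ z∉ → none (z , vz , z∉))) ⟩
      length (map φ (nbrs es v))   ≡⟨ length-map φ (nbrs es v) ⟩
      length (nbrs es v)           ∎))
      where open ≤-Reasoning

    -- Otherwise w would have a fourth neighbour.
    not-full : ∀ {v w} → v < k → w < k → Adj (φ v) (φ w) → φ w ∉ map φ (nbrs es v) →
               length (nbrs es w) < 3
    not-full {v} {w} v<k w<k vw new = ≰⇒> λ full → contradiction
      (length≤count {p = adj (φ w)} {xs = map φ (v ∷ nbrs es w)}
        (unique-map φ (All.¬Any⇒All¬ _ v∉ ∷ proj₂ proper w)
          (λ x∈ y∈ → inj (range x∈) (range y∈)))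
        (All.map⁺ (All.tabulate λ { (here refl) → Adj-sym vw ; (there x∈) → φ-adj x∈ })))
      (<⇒≱ (≤-trans (s≤s (≤-reflexive (degree3 (φ w))))
        (≤-trans (s≤s full) (≤-reflexive (cong suc (sym (length-map φ (nbrs es w))))))))
      where
      v∉ : v ∉ nbrs es w
      v∉ v∈ = new (∈-map⁺ φ (nbrs-sym es v∈))

      range : ∀ {x} → x ∈ v ∷ nbrs es w → x < k
      range (here refl) = v<k
      range (there x∈)  = proj₂ (nbrs-< proper x∈)

    -- The edge from `φ w` to `φ v`, followed by the walk that the ball provides, would meet `φ w`
    -- twice within `3 + r` vertices.
    not-near : ∀ {v w} → v < k → Adj (φ v) (φ w) → φ w ∉ map φ (nbrs es v) →
               w ∉ ball es (suc r) k v
    not-near {v} {w} v<k vw new w∈ =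
      let l , walk , len , φw∈ = ball-walk (suc r) k v (φ w) v<k (Adj-sym vw)
            (λ x∈ _ eq → new (subst (_∈ map φ (nbrs es v)) (sym eq) (∈-map⁺ φ x∈))) w∈
      in nb-fresh girth walk (s≤s (s≤s len))
           (nb-unique (φ v ∷ l) girth (nb-tail walk) (s≤s (≤-trans len (n≤1+n _)))) φw∈

    is-candidate : ∀ {v w} → v < k → w < k → Adj (φ v) (φ w) → φ w ∉ map φ (nbrs es v) →
                   w ∈ candidates es k (ball es (suc r) k v)
    is-candidate v<k w<k vw new = ∈-filter⁺ _ (∈-upTo⁺ w<k)
      (T∧⁺ (Tnot (not-near v<k vw new ∘ elem⁻ _)) (<⇒<ᵇ (not-full v<k w<k vw new)))

  proper-children : ∀ {k es v} → v < k → Proper (partialGraph k es) →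
                    ∀ {Q} → Q ∈ children (partialGraph k es) v → Proper Q
  proper-children {k} {es} {v} v<k proper {Q} Q∈
    with ∈-++⁻ (if k <ᵇ N then partialGraph (suc k) ((v , k) ∷ es) ∷ [] else []) Q∈
  ... | inj₁ Q∈fresh with k <ᵇ N | Q∈fresh
  ...   | true | here refl = proper-edge (proper-extension proper) (m<n⇒m<1+n v<k) ≤-refl
            (<⇒≢ v<k) (λ k∈ → <-irrefl refl (proj₂ (nbrs-< proper k∈)))
  proper-children {k} {es} {v} v<k proper {Q} Q∈ | inj₂ Q∈old
    with w , w∈ , refl ← ∈-map⁻ (λ w → partialGraph k ((v , w) ∷ es)) Q∈old
    with w∈k , ok ← ∈-filter⁻ _ {xs = upTo k} w∈ =
    proper-edge proper v<k (∈-upTo⁻ w∈k)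
      (λ { refl → far (here refl) })
      (λ w∈nbrs → far (there (balls⁺ es r k v (nbrs es v) w∈nbrs
        (λ { refl → <-irrefl refl (proj₂ (nbrs-< proper w∈nbrs)) }))))
    where
    far : w ∉ ball es (suc r) k v
    far = Tnot⁻ (proj₁ (T∧⁻ {not (elem w (ball es (suc r) k v))} ok)) ∘ elem⁺

  branch-good : ∀ {k es v} → v < k → length (nbrs es v) < 3 → Proper (partialGraph k es) →
                (∀ {Q} → Q ∈ children (partialGraph k es) v → Good Q) →
                Good (partialGraph k es)
  branch-good {k} {es} {v} v<k few proper good E
    with z , vz , z∉ ← new-neighbour proper E v few
    with named? proper E z
  ... | yes (w , w<k , refl) =
    good (∈-++⁺ʳ _ (∈-map⁺ _ (is-candidate proper E v<k w<k vz z∉)))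
      record { φ = φ ; inj = inj ; hom = λ { (here refl) → vz ; (there ∈es) → hom ∈es } }
    where open Embedding E
  ... | no unnamed =
    let E′ , new , old = extend proper E z (λ w<k eq → unnamed (_ , w<k , eq))
        open Embedding E′
    in good fresh record { φ = φ ; inj = inj ; hom = λ where
         (here refl)  → subst₂ Adj (sym (old v<k)) (sym new) vz
         (there ∈es) → hom ∈es }
    where
    k<N : k < N
    k<N = ≤-trans (unnamed⇒k<order proper E z (λ w<k eq → unnamed (_ , w<k , eq))) bounded

    fresh : partialGraph (suc k) ((v , k) ∷ es) ∈ children (partialGraph k es) v
    fresh rewrite T⇒≡ (<⇒<ᵇ k<N) = here refl

  compose : ∀ {σ Q P} → T (embeds σ Q P) → Embedding P → Embedding Q
  compose {σ} {partialGraph k es} {partialGraph l fs} t E = record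
    { φ   = φ ∘ σ
    ; inj = λ i<k j<k eq → σ-inj i<k j<k (inj (below i<k) (below j<k) eq)
    ; hom = λ ∈es → [ hom , Adj-sym ∘ hom ]′ (joins⁻ fs (All.lookup joined ∈es)) }
    where
    open Embedding E
    σs = map σ (upTo k)
    t₁ = T∧⁻ {all (_<ᵇ l) σs} t
    t₂ = T∧⁻ {distinct σs} (proj₂ t₁)

    joined : All (λ (a , b) → T (joins fs (σ a) (σ b))) es
    joined = All.all⁺ _ es (proj₂ t₂)

    below : ∀ {i} → i < k → σ i < l
    below i<k = <ᵇ⇒< _ _ (All.lookup (All.all⁺ (_<ᵇ l) σs (proj₁ t₁)) (∈-map⁺ σ (∈-upTo⁺ i<k)))

    σ-inj : ∀ {i j} → i < k → j < k → σ i ≡ σ j → i ≡ j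
    σ-inj i<k j<k = unique-map⁻ σ (upTo k) (distinct⇒unique σs (proj₁ t₂)) (∈-upTo⁺ i<k) (∈-upTo⁺ j<k)

  extensions-sound : ∀ {P} → Proper P → ∀ {Q} → Q ∈ extensions P → Proper Q
  extensions-sound {partialGraph k es} proper Q∈ with k <ᵇ N | Q∈
  ... | true | here refl = proper-extension proper

  -- If every vertex of `G` has a label, then `G` is no larger than the target, and an embedding of
  -- one cubic graph into another that is no larger is an isomorphism. Otherwise an unlabelled
  -- vertex leads to the extension.
  leaf-good : ∀ {σ H P} → H ∈ targets → order H ≡ labels P → T (embeds σ (labelled H) P) → Proper P →
              (∀ {Q} → Q ∈ extensions P → Good Q) → Good P
  leaf-good {σ} {H} {partialGraph k es} H∈ H≡k t proper good E
    with Fin.any? (λ z → ¬? (named? proper E z))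
  ... | yes (z , unnamed) =
    good extension (proj₁ (extend proper E z (λ w<k eq → unnamed (_ , w<k , eq))))
    where
    k<N : k < N
    k<N = ≤-trans (unnamed⇒k<order proper E z (λ w<k eq → unnamed (_ , w<k , eq))) bounded

    extension : partialGraph (suc k) es ∈ extensions (partialGraph k es)
    extension rewrite T⇒≡ (<⇒<ᵇ k<N) = here refl
  ... | no all-named = Any.map (λ { refl → iso }) H∈
    where
    open Embedding E using (φ)
    open Embedding (compose {Q = labelled H} {partialGraph k es} t E)
      using () renaming (φ to φ′; inj to inj′; hom to hom′)

    label : ∀ z → ∃[ w ] w < k × φ w ≡ z
    label z = decidable-stable (named? proper E z) (λ unnamed → all-named (z , unnamed))

    order≤k : order G ≤ k
    order≤k = Fin.injective⇒≤ {f = λ z → fromℕ< (proj₁ (proj₂ (label z)))} λ {x} {y} eq →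
      trans (sym (proj₂ (proj₂ (label x)))) (trans (cong φ (Fin.fromℕ<-injective _ _ _ _ eq))
        (proj₂ (proj₂ (label y))))

    iso : G ≅ H
    iso = injective-hom⇒≅ cubic (All.lookup cubic-targets H∈) (≤-trans order≤k (≤-reflexive (sym H≡k)))
      (φ′ ∘ toℕ) (λ {u} {v} → Fin.toℕ-injective ∘ inj′ (Fin.toℕ<n u) (Fin.toℕ<n v))
      (hom′ ∘ labelled-edge H)

  check-sound : ∀ c P {done done′} → Proper P → All Sound done → check c P done ≡ just done′ →
                All Sound done′ × Good P
  checkAll-sound : ∀ cs Ps {done done′} → (∀ {P} → P ∈ Ps → Proper P) → All Sound done →
                   checkAll cs Ps done ≡ just done′ → All Sound done′ × (∀ {P} → P ∈ Ps → Good P)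

  check-sound (branch v cs) P@(partialGraph k es) proper sound eq
    with ok , eq₁ ← whenᵐ⁻ ((v <ᵇ k) ∧ (length (nbrs es v) <ᵇ 3)) eq
    with v<k , few ← T∧⁻ {v <ᵇ k} ok
    with done₁ , eq₂ , refl ← >>=⁻ (checkAll cs (children P v) _) eq₁
    with sound₁ , good ← checkAll-sound cs (children P v)
           (proper-children (<ᵇ⇒< v k v<k) proper) sound eq₂ =
    let goodP = branch-good (<ᵇ⇒< v k v<k) (<ᵇ⇒< _ 3 few) proper good
    in (proper , goodP) ∷ sound₁ , goodP
  check-sound (image i σ) P {done} proper sound eq
    with Q , eq₁ , eq₂ ← >>=⁻ (lookupᵐ done i) eq
    with ok , refl ← whenᵐ⁻ (embeds σ Q P) eq₂ =
    let goodP = proj₂ (All.lookup sound (lookupᵐ-∈ done i eq₁)) ∘ compose {Q = Q} {P} ok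
    in (proper , goodP) ∷ sound , goodP
  check-sound (leaf t σ cs) P proper sound eq
    with Q , eq₁ , eq₂ ← >>=⁻ (lookupᵐ (map labelled targets) t) eq
    with H , H∈ , refl ← ∈-map⁻ labelled (lookupᵐ-∈ (map labelled targets) t eq₁)
    with ok , eq₃ ← whenᵐ⁻ ((order H ≡ᵇ labels P) ∧ embeds σ (labelled H) P) eq₂
    with H≡P , ok′ ← T∧⁻ {order H ≡ᵇ labels P} ok
    with done₁ , eq₄ , refl ← >>=⁻ (checkAll cs (extensions P) _) eq₃
    with sound₁ , good ← checkAll-sound cs (extensions P) (extensions-sound proper) sound eq₄ =
    let goodP = leaf-good H∈ (≡ᵇ⇒≡ _ _ H≡P) ok′ proper good
    in (proper , goodP) ∷ sound₁ , goodP

  checkAll-sound []       []       proper sound refl = sound , λ ()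
  checkAll-sound (c ∷ cs) (P ∷ Ps) {done} proper sound eq
    with done₁ , eq₁ , eq₂ ← >>=⁻ (check c P done) eq
    with sound₁ , goodP ← check-sound c P (proper (here refl)) sound eq₁
    with sound₂ , goodPs ← checkAll-sound cs Ps (proper ∘ there) sound₁ eq₂ =
    sound₂ , λ { (here refl) → goodP ; (there P∈) → goodPs P∈ }

-- The search starts from a single vertex. The definition is opaque because a case
-- distinction on its result would otherwise run the search again.
opaque
  classify : ∀ N r targets c →
    is-just (Search.check N r (map labelled targets) c (partialGraph 1 []) []) ≡ true →
    All Cubic targets → ∀ G → Cubic G → Girth≥ (3 + r) G → order G ≤ N → Any (G ≅_) targets
  classify N r targets c ok cubic-targets G cubic girth bounded
    with just _ ← Search.check N r (map labelled targets) c (partialGraph 1 []) [] in eq =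
    proj₂ (check-sound c (partialGraph 1 []) ((λ ()) , λ _ → []) [] eq)
      record { φ = λ _ → vertex ; inj = λ { (s≤s z≤n) (s≤s z≤n) _ → refl } ; hom = λ () }
    where
    open Soundness N r targets cubic-targets G cubic girth bounded

    vertex : Vertex G
    vertex = fromℕ< (order>0 G)


-- Path-decompositions

∈-tabulate : ∀ {n} (p : Fin n → Bool) {i} → T (p i) → i Subset.∈ Vec.tabulate p
∈-tabulate p {i} pi = Vec.lookup⇒[]= i _ (trans (Vec.lookup∘tabulate p i) (T⇒≡ pi))

∈⇒lookup : ∀ {n} {p : Subset n} {i} → i Subset.∈ p → T (Vec.lookup p i)
∈⇒lookup i∈ = ≡⇒T (Vec.[]=⇒lookup i∈)

∈-tabulate⁻ : ∀ {n} (p : Fin n → Bool) {i} → i Subset.∈ Vec.tabulate p → T (p i)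
∈-tabulate⁻ p {i} i∈ = ≡⇒T (trans (sym (Vec.lookup∘tabulate p i)) (Vec.[]=⇒lookup i∈))

∣bag∣≤ : ∀ {G w} (D : PathDecomposition G) → width D ≤ w → ∀ i → ∣ PathDecomposition.bag D i ∣ ≤ suc w
∣bag∣≤ D width≤w i = ≤-trans
  (All.lookup (xs≤max 0 (tabulate (∣_∣ ∘ PathDecomposition.bag D))) (∈-tabulate⁺ i))
  (≤-trans (m≤suc[pred[m]] _) (s≤s width≤w))
  where
  m≤suc[pred[m]] : ∀ m → m ≤ suc (pred m)
  m≤suc[pred[m]] zero    = z≤n
  m≤suc[pred[m]] (suc m) = ≤-refl

hasPathWidth : ∀ {G k} → (Σ (PathDecomposition G) λ D → width D ≤ k) →
               (∀ D → k ≤ width {G} D) → HasPathWidth G k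
hasPathWidth (D , ≤k) lower = (D , ≤-antisym ≤k (lower D)) , λ { _ (D′ , refl) → lower D′ }

pathWidth≤ : ∀ {G k w} → HasPathWidth G k → (Σ (PathDecomposition G) λ D → width D ≤ w) → k ≤ w
pathWidth≤ (_ , minimal) (D , ≤w) = ≤-trans (minimal _ (D , refl)) ≤w

≅⇒order≡ : ∀ {G H} → G ≅ H → order G ≡ order H
≅⇒order≡ iso = ↔⇒≡ (_≅_.bijection iso)

transport : ∀ {G H} → G ≅ H → (D : PathDecomposition H) →
            Σ (PathDecomposition G) λ D′ → width D′ ≡ width D
transport {G} {H} iso D = D′ , cong (pred ∘ max 0) (tabulate-cong same-size)
  where
  open _≅_ iso
  open Inverse bijection using (to)
  open PathDecomposition D using (#bags; bag; covers; coversEdges; interval)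

  bag′ : Fin (#bags) → Subset (order G)
  bag′ i = Vec.tabulate (Vec.lookup (bag i) ∘ to)

  bag′⁺ : ∀ {i v} → to v Subset.∈ bag i → v Subset.∈ bag′ i
  bag′⁺ = ∈-tabulate _ ∘ ∈⇒lookup

  bag′⁻ : ∀ {i v} → v Subset.∈ bag′ i → to v Subset.∈ bag i
  bag′⁻ v∈ = Vec.lookup⇒[]= _ _ (T⇒≡ (∈-tabulate⁻ _ v∈))

  D′ : PathDecomposition G
  D′ = record
    { #bags       = #bags
    ; bag         = bag′
    ; covers      = λ v → let i , v∈ = covers (to v) in i , bag′⁺ v∈
    ; coversEdges = λ u v uv →
        let i , u∈ , v∈ = coversEdges (to u) (to v) (subst T (preserves-adj u v) uv)
        in i , bag′⁺ u∈ , bag′⁺ v∈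
    ; interval    = λ v i j l i≤j j≤l v∈i v∈l →
        bag′⁺ (interval (to v) i j l i≤j j≤l (bag′⁻ v∈i) (bag′⁻ v∈l)) }

  same-size : ∀ i → ∣ bag′ i ∣ ≡ ∣ bag i ∣
  same-size i = trans (∣tabulate∣ (Vec.lookup (bag i) ∘ to))
    (sym (trans (∣lookup∣ (bag i)) (sum-permute (𝟙 ∘ Vec.lookup (bag i)) bijection)))

-- A path-decomposition in which v lies in the bags numbered from lo v to hi v.
module Intervals (G : Graph) (intervals : List (ℕ × ℕ)) where
  open Graph G using (adj)

  private
    ends : Vertex G → ℕ × ℕ
    ends v = fromMaybe (0 , 0) (lookupᵐ intervals (toℕ v))

    lo hi : Vertex G → ℕ
    lo = proj₁ ∘ ends
    hi = proj₂ ∘ ends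

    inBag : ℕ → Vertex G → Bool
    inBag i v = (lo v ≤ᵇ i) ∧ (i ≤ᵇ hi v)

  fits : ℕ → Bool
  fits w =
    all (λ v → (lo v ≤ᵇ hi v) ∧ (hi v <ᵇ order G)) (allFin (order G)) ∧
    (all (λ u → all (λ v → not (adj u v) ∨ (lo u ≤ᵇ hi v)) (allFin (order G))) (allFin (order G)) ∧
     all (λ i → count (inBag (toℕ i)) ≤ᵇ suc w) (allFin (order G)))

  decomposition : ∀ w → fits w ≡ true → Σ (PathDecomposition G) λ D → width D ≤ w
  decomposition w ok = D , ≤-pred-pred (max≤v⁺ z≤n (All.tabulate⁺ small))
    where
    ok₁ = T∧⁻ {all (λ v → (lo v ≤ᵇ hi v) ∧ (hi v <ᵇ order G)) (allFin (order G))} (≡⇒T ok)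
    ok₂ = T∧⁻ {all (λ u → all (λ v → not (adj u v) ∨ (lo u ≤ᵇ hi v)) (allFin (order G))) (allFin (order G))} (proj₂ ok₁)

    lo≤hi : ∀ v → lo v ≤ hi v
    lo≤hi v = ≤ᵇ⇒≤ _ _ (proj₁ (T∧⁻ {lo v ≤ᵇ hi v} (All.lookup (All.all⁺ _ (allFin (order G)) (proj₁ ok₁)) (∈-allFin v))))

    hi<n : ∀ v → hi v < order G
    hi<n v = <ᵇ⇒< _ _ (proj₂ (T∧⁻ {lo v ≤ᵇ hi v} (All.lookup (All.all⁺ _ (allFin (order G)) (proj₁ ok₁)) (∈-allFin v))))

    meet : ∀ {u v} → Graph.Adj G u v → lo u ≤ hi v
    meet {u} {v} uv = [ (λ no → contradiction uv (Tnot⁻ no)) , ≤ᵇ⇒≤ _ _ ]′ (T∨⁻ {not (adj u v)}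
      (All.lookup (All.all⁺ _ (allFin (order G)) (All.lookup (All.all⁺ _ (allFin (order G)) (proj₁ ok₂)) (∈-allFin u)))
        (∈-allFin v)))

    bag′ : Fin (order G) → Subset (order G)
    bag′ i = Vec.tabulate (inBag (toℕ i))

    small : ∀ i → ∣ bag′ i ∣ ≤ suc w
    small i = ≤-trans (≤-reflexive (∣tabulate∣ (inBag (toℕ i))))
      (≤ᵇ⇒≤ _ _ (All.lookup (All.all⁺ _ (allFin (order G)) (proj₂ ok₂)) (∈-allFin i)))

    ≤-pred-pred : ∀ {m} → m ≤ suc w → pred m ≤ w
    ≤-pred-pred {zero}  _         = z≤n
    ≤-pred-pred {suc m} (s≤s m≤w) = m≤w

    bag′⁺ : ∀ {v i} → lo v ≤ toℕ i → toℕ i ≤ hi v → v Subset.∈ bag′ i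
    bag′⁺ lo≤ ≤hi = ∈-tabulate _ (T∧⁺ (≤⇒≤ᵇ lo≤) (≤⇒≤ᵇ ≤hi))

    bag′⁻ : ∀ {v i} → v Subset.∈ bag′ i → lo v ≤ toℕ i × toℕ i ≤ hi v
    bag′⁻ {v} {i} v∈ = let a , b = T∧⁻ {lo v ≤ᵇ toℕ i} (∈-tabulate⁻ (inBag (toℕ i)) v∈)
                     in ≤ᵇ⇒≤ _ _ a , ≤ᵇ⇒≤ _ _ b

    at : ∀ v i (i<n : i < order G) → lo v ≤ i → i ≤ hi v → v Subset.∈ bag′ (fromℕ< i<n)
    at v i i<n lo≤ ≤hi = bag′⁺ (≤-trans lo≤ (≤-reflexive (sym (Fin.toℕ-fromℕ< i<n))))
                               (≤-trans (≤-reflexive (Fin.toℕ-fromℕ< i<n)) ≤hi)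

    D : PathDecomposition G
    D = record
      { #bags       = order G
      ; bag         = bag′
      ; covers      = λ v → fromℕ< (hi<n v) , at v (hi v) (hi<n v) (lo≤hi v) ≤-refl
      ; coversEdges = λ u v uv →
          -- Two intersecting intervals share the larger of their lower ends, which serves as the
          -- index of the common bag.
          let ≤hiu = ⊔-lub (lo≤hi u) (meet (subst T (Graph.adj-sym G u v) uv))
              ≤hiv = ⊔-lub (meet uv) (lo≤hi v)
              i<n  = ≤-<-trans ≤hiu (hi<n u)
          in fromℕ< i<n , at u _ i<n (m≤m⊔n _ _) ≤hiu , at v _ i<n (m≤n⊔m _ _) ≤hiv
      ; interval    = λ v i j l i≤j j≤l v∈i v∈l →
          bag′⁺ {v} {j} (≤-trans (proj₁ (bag′⁻ {v} {i} v∈i)) i≤j) (≤-trans j≤l (proj₂ (bag′⁻ {v} {l} v∈l))) }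


-- Sparse cuts from path-decompositions

count-false : ∀ n → count {n} (λ _ → false) ≡ 0
count-false = sum-replicate-zero

count>0⇒∃ : ∀ {n} {p : Fin n → Bool} → 0 < count p → ∃[ i ] T (p i)
count>0⇒∃ {n} {p} 0<p with Fin.any? (λ i → T? (p i))
... | yes found = found
... | no  none  = contradiction 0<p (≤⇒≯ (≤-trans
  (count-mono {p = p} {q = λ _ → false} (λ i pi → none (i , pi))) (≤-reflexive (count-false n))))

minimal : ∀ {n} (f : Fin n → ℕ) (p : Fin n → Bool) {i} → T (p i) →
          ∃[ j ] T (p j) × (∀ l → T (p l) → f j ≤ f l)
minimal {n} f p {i} pi = go (f i) i ≤-refl pi
  where
  go : ∀ b i → f i ≤ b → T (p i) → ∃[ j ] T (p j) × (∀ l → T (p l) → f j ≤ f l)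
  go b i fi≤b pi with Fin.any? (λ l → T? (p l) ×-dec f l <? f i)
  ... | no  none = i , pi , λ l pl → ≮⇒≥ (λ fl<fi → none (l , pl , fl<fi))
  ... | yes (l , pl , fl<fi) with b | ≤-trans fl<fi fi≤b
  ...   | suc b′ | s≤s fl≤b′ = go b′ l fl≤b′ pl

-- A discrete intermediate value argument: a jump of at most 4 cannot pass over the four values from
-- `a` to `a + 3`.
crossing : (f : ℕ → ℕ) (a m : ℕ) → f 0 < a → a ≤ f m → (∀ t → f (suc t) ≤ f t + 4) →
           ∃[ t ] a ≤ f t × f t ≤ a + 3
crossing f a zero    f0<a a≤f0 _    = contradiction a≤f0 (<⇒≱ f0<a)
crossing f a (suc m) f0<a a≤fm jump with a ≤? f m
... | yes a≤f = crossing f a m f0<a a≤f jump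
... | no  a≰f = suc m , a≤fm , (begin
  f (suc m)      ≤⟨ jump m ⟩
  f m + 4        ≡⟨ +-suc (f m) 3 ⟩
  suc (f m) + 3  ≤⟨ +-monoˡ-≤ 3 (≰⇒> a≰f) ⟩
  a + 3          ∎)
  where open ≤-Reasoning

module Density (G : Graph) (cubic : Cubic G) where
  open Graph G using (adj; Adj; adj-sym)
  open Walks G

  VertexSet : Set
  VertexSet = Vertex G → Bool

  ∁ : VertexSet → VertexSet
  ∁ S = not ∘ S

  deg : VertexSet → Vertex G → ℕ
  deg S u = count (λ v → adj u v ∧ S v)

  between : VertexSet → VertexSet → ℕ
  between P Q = sum (λ u → 𝟙 (P u) * deg Q u)

  -- Counts every edge inside S twice.
  inner : VertexSet → ℕ
  inner S = between S S

  degree3 : ∀ v → count (adj v) ≡ 3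
  degree3 v = trans (sym (degree≡count v)) (cubic v)

  deg-split : ∀ P Q R → (∀ v → 𝟙 (P v) ≡ 𝟙 (Q v) + 𝟙 (R v)) → ∀ u → deg P u ≡ deg Q u + deg R u
  deg-split P Q R split u = trans (sum-cong-≗ pointwise) (∑-distrib-+ _ (λ v → 𝟙 (adj u v ∧ R v)))
    where
    pointwise : ∀ v → 𝟙 (adj u v ∧ P v) ≡ 𝟙 (adj u v ∧ Q v) + 𝟙 (adj u v ∧ R v)
    pointwise v with adj u v
    ... | true  = split v
    ... | false = refl

  deg-∁ : ∀ S u → deg S u + deg (∁ S) u ≡ 3
  deg-∁ S u = trans (sym (deg-split (λ _ → true) S (∁ S) split u))
    (trans (sum-cong-≗ (λ v → cong 𝟙 (∧-true (adj u v)))) (degree3 u))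
    where
    split : ∀ v → 1 ≡ 𝟙 (S v) + 𝟙 (∁ S v)
    split v with S v
    ... | true  = refl
    ... | false = refl

    ∧-true : ∀ b → b ∧ true ≡ b
    ∧-true true  = refl
    ∧-true false = refl

  deg≤3 : ∀ S u → deg S u ≤ 3
  deg≤3 S u = ≤-trans (m≤m+n _ _) (≤-reflexive (deg-∁ S u))

  deg-mono : ∀ {P Q} → (∀ v → T (P v) → T (Q v)) → ∀ u → deg P u ≤ deg Q u
  deg-mono {P} {Q} P⊆Q u = count-mono {p = λ v → adj u v ∧ P v} {q = λ v → adj u v ∧ Q v}
    (λ v t → let uv , pv = T∧⁻ {adj u v} t in T∧⁺ uv (P⊆Q v pv))

  between-sym : ∀ P Q → between P Q ≡ between Q P
  between-sym P Q = begin
    between P Q                                                 ≡⟨ expand P Q ⟩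
    sum (λ u → sum (λ v → 𝟙 (P u) * 𝟙 (adj u v ∧ Q v)))       ≡⟨ ∑-comm (λ u v → 𝟙 (P u) * 𝟙 (adj u v ∧ Q v)) ⟩
    sum (λ v → sum (λ u → 𝟙 (P u) * 𝟙 (adj u v ∧ Q v)))       ≡⟨ sum-cong-≗ (λ v → sum-cong-≗ (swap v)) ⟩
    sum (λ v → sum (λ u → 𝟙 (Q v) * 𝟙 (adj v u ∧ P u)))       ≡⟨ expand Q P ⟨
    between Q P                                                 ∎
    where
    open ≡-Reasoning
    expand : ∀ P Q → between P Q ≡ sum (λ u → sum (λ v → 𝟙 (P u) * 𝟙 (adj u v ∧ Q v)))
    expand P Q = sum-cong-≗ (λ u → sym (sum-*ˡ (𝟙 (P u)) (λ v → 𝟙 (adj u v ∧ Q v))))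

    swap : ∀ v u → 𝟙 (P u) * 𝟙 (adj u v ∧ Q v) ≡ 𝟙 (Q v) * 𝟙 (adj v u ∧ P u)
    swap v u rewrite adj-sym u v with adj v u | P u | Q v
    ... | true  | true  | true  = refl
    ... | true  | true  | false = refl
    ... | true  | false | true  = refl
    ... | true  | false | false = refl
    ... | false | true  | true  = refl
    ... | false | true  | false = refl
    ... | false | false | true  = refl
    ... | false | false | false = refl

  between-∖ : ∀ S Q {x} → T (S x) → between S Q ≡ between (S ∖ x) Q + deg Q x
  between-∖ S Q {x} Sx = begin
    between S Q
      ≡⟨ sum-cong-≗ (λ u → cong (_* deg Q u) (𝟙-∖ S Sx u)) ⟩
    sum (λ u → (𝟙 ((S ∖ x) u) + 𝟙 (does (x Fin.≟ u))) * deg Q u)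
      ≡⟨ sum-cong-≗ (λ u → *-distribʳ-+ (deg Q u) (𝟙 ((S ∖ x) u)) _) ⟩
    sum (λ u → 𝟙 ((S ∖ x) u) * deg Q u + 𝟙 (does (x Fin.≟ u)) * deg Q u)
      ≡⟨ ∑-distrib-+ (λ u → 𝟙 ((S ∖ x) u) * deg Q u) _ ⟩
    between (S ∖ x) Q + sum (λ u → 𝟙 (does (x Fin.≟ u)) * deg Q u)
      ≡⟨ cong (between (S ∖ x) Q +_) (sum-point x (deg Q)) ⟩
    between (S ∖ x) Q + deg Q x ∎
    where open ≡-Reasoning

  deg-∖-self : ∀ S x → deg (S ∖ x) x ≡ deg S x
  deg-∖-self S x = sum-cong-≗ pointwise
    where
    pointwise : ∀ v → 𝟙 (adj x v ∧ (S ∖ x) v) ≡ 𝟙 (adj x v ∧ S v)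
    pointwise v with adj x v in xv | x Fin.≟ v
    ... | false | _        = refl
    ... | true  | yes refl = contradiction refl (Adj⇒≢ (≡⇒T xv))
    ... | true  | no _     with S v
    ...   | true  = refl
    ...   | false = refl

  inner-∖ : ∀ S {x} → T (S x) → inner S ≡ inner (S ∖ x) + 2 * deg S x
  inner-∖ S {x} Sx = begin
    between S S                                     ≡⟨ between-∖ S S Sx ⟩
    between (S ∖ x) S + deg S x                     ≡⟨ cong (_+ deg S x) (between-sym (S ∖ x) S) ⟩
    between S (S ∖ x) + deg S x                     ≡⟨ cong (_+ deg S x) (between-∖ S (S ∖ x) Sx) ⟩
    inner (S ∖ x) + deg (S ∖ x) x + deg S x       ≡⟨ cong (λ d → inner (S ∖ x) + d + deg S x) (deg-∖-self S x) ⟩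
    inner (S ∖ x) + deg S x + deg S x             ≡⟨ double (inner (S ∖ x)) (deg S x) ⟩
    inner (S ∖ x) + 2 * deg S x                   ∎
    where
    open ≡-Reasoning
    double : ∀ a b → a + b + b ≡ a + 2 * b
    double = solve-∀

  -- The sweep: the vertices enter in the order of the first bag containing them, and
  -- L consists of those entered vertices that have at most one neighbour not yet entered.
  module Sweep (D : PathDecomposition G) where
    open PathDecomposition D using (#bags; bag; covers; coversEdges; interval)

    first-bag : ∀ v → ∃[ i ] T (Vec.lookup (bag i) v) ×
                (∀ j → T (Vec.lookup (bag j) v) → toℕ i ≤ toℕ j)
    first-bag v = minimal toℕ (λ i → Vec.lookup (bag i) v) (∈⇒lookup (proj₂ (covers v)))

    first : Vertex G → Fin #bags
    first = proj₁ ∘ first-bag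

    -- Lexicographic in the first bag and the vertex number. Breaking ties makes the vertices enter
    -- one at a time, on which the bound for the jump depends.
    key : Vertex G → ℕ
    key v = toℕ (combine (first v) v)

    key-injective : ∀ {u v} → key u ≡ key v → u ≡ v
    key-injective {u} {v} eq =
      proj₂ (Fin.combine-injective (first u) u (first v) v (Fin.toℕ-injective eq))

    key-≤⇒first-≤ : ∀ {u v} → key u ≤ key v → toℕ (first u) ≤ toℕ (first v)
    key-≤⇒first-≤ {u} {v} ≤k = ≮⇒≥ λ fv<fu → <⇒≱ (Fin.combine-monoˡ-< v u fv<fu) ≤k

    P : ℕ → VertexSet
    P t u = key u <ᵇ t

    out : ℕ → Vertex G → ℕ
    out t = deg (∁ (P t))

    L : ℕ → VertexSet
    L t u = P t u ∧ (out t u ≤ᵇ 1)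

    ∂ : ℕ → VertexSet
    ∂ t u = P t u ∧ (1 ≤ᵇ out t u)

    all-entered : ∀ u → T (P (#bags * order G) u)
    all-entered u = <⇒<ᵇ (Fin.toℕ<n (combine (first u) u))

    L-end : order G ≤ count (L (#bags * order G))
    L-end = ≤-trans (≤-reflexive (sym (count-true (order G)))) (count-mono {p = λ _ → true} (λ u _ →
      T∧⁺ (all-entered u) (≤⇒≤ᵇ (≤-trans (count-mono {q = λ _ → false} (λ v t →
        Tnot⁻ (proj₂ (T∧⁻ {adj u v} t)) (all-entered v))) (≤-trans (≤-reflexive (count-false (order G))) z≤n)))))

    -- Only the entering vertex and its three neighbours can become members: every other entered
    -- vertex keeps exactly its outside neighbours.
    L-jump : ∀ t → count (L (suc t)) ≤ count (L t) + 4
    L-jump t with Fin.any? (λ x → key x ≟ t)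
    ... | no none = ≤-trans (count-mono stays) (m≤m+n _ 4)
      where
      entered : ∀ u → T (P (suc t) u) → T (P t u)
      entered u u∈ = <⇒<ᵇ (≤∧≢⇒< (s≤s⁻¹ (<ᵇ⇒< _ _ u∈)) (λ eq → none (u , eq)))

      stays : ∀ u → T (L (suc t) u) → T (L t u)
      stays u t′ = let u∈ , few = T∧⁻ {P (suc t) u} t′ in
        T∧⁺ (entered u u∈) (≤⇒≤ᵇ (≤-trans (deg-mono (λ v v∉ → Tnot (Tnot⁻ v∉ ∘ entered v)) u)
          (≤ᵇ⇒≤ _ _ few)))
    ... | yes (x , refl) = begin
      count (L (suc t))
        ≤⟨ sum-mono-≤ bound ⟩
      sum (λ u → 𝟙 (L t u) + (𝟙 (does (x Fin.≟ u)) * 1 + 𝟙 (adj x u)))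
        ≡⟨ ∑-distrib-+ (𝟙 ∘ L t) _ ⟩
      count (L t) + sum (λ u → 𝟙 (does (x Fin.≟ u)) * 1 + 𝟙 (adj x u))
        ≡⟨ cong (count (L t) +_) (∑-distrib-+ (λ u → 𝟙 (does (x Fin.≟ u)) * 1) (𝟙 ∘ adj x)) ⟩
      count (L t) + (sum (λ u → 𝟙 (does (x Fin.≟ u)) * 1) + count (adj x))
        ≡⟨ cong (count (L t) +_) (cong₂ _+_ (sum-point x (λ _ → 1)) (degree3 x)) ⟩
      count (L t) + 4 ∎
      where
      open ≤-Reasoning
      entered : ∀ u → u ≢ x → T (P (suc t) u) → T (P t u)
      entered u u≢x u∈ = <⇒<ᵇ (≤∧≢⇒< (s≤s⁻¹ (<ᵇ⇒< _ _ u∈)) (u≢x ∘ key-injective))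

      stays : ∀ u → u ≢ x → ¬ Adj x u → T (L (suc t) u) → T (L t u)
      stays u u≢x x≁u t′ = let u∈ , few = T∧⁻ {P (suc t) u} t′ in
        T∧⁺ (entered u u≢x u∈) (≤⇒≤ᵇ (≤-trans
          (count-mono {p = λ v → adj u v ∧ not (P t v)} {q = λ v → adj u v ∧ not (P (suc t) v)}
            (λ v t″ → let uv , v∉ = T∧⁻ {adj u v} t″ in
              T∧⁺ uv (Tnot (Tnot⁻ v∉ ∘ entered v (λ { refl → x≁u (Adj-sym uv) })))))
          (≤ᵇ⇒≤ _ _ few)))

      bound : ∀ u → 𝟙 (L (suc t) u) ≤ 𝟙 (L t u) + (𝟙 (does (x Fin.≟ u)) * 1 + 𝟙 (adj x u))
      bound u with x Fin.≟ u | adj x u in xu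
      ... | yes _  | _     = ≤-trans (𝟙≤1 (L (suc t) u)) (≤-trans (m≤m+n 1 _) (m≤n+m _ (𝟙 (L t u))))
      ... | no _   | true  = ≤-trans (𝟙≤1 (L (suc t) u)) (m≤n+m 1 (𝟙 (L t u)))
      ... | no x≢u | false = ≤-trans (𝟙-mono (stays u (x≢u ∘ sym) (subst T xu))) (m≤m+n _ _)

    -- Let `v` be the next vertex to enter. A boundary vertex appears no later than `v` does, and it
    -- shares a bag with a neighbour that has not entered, hence appears no earlier than `v`. By the
    -- interval property it lies in the first bag of `v`, and `v` itself takes the one remaining
    -- place there.
    ∂-bound : ∀ {w} → width D ≤ w → ∀ t → count (∂ t) ≤ w
    ∂-bound {w} width≤w t with Fin.any? (λ u → T? (∂ t u))
    ... | no none = ≤-trans (count-mono {q = λ _ → false} (λ u u∈ → none (u , u∈)))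
                            (≤-trans (≤-reflexive (count-false (order G))) z≤n)
    ... | yes (u , u∈∂)
      with z , uz∧z∉ ← count>0⇒∃ (≤ᵇ⇒≤ 1 _ (proj₂ (T∧⁻ {P t u} u∈∂)))
      with v , v∉ , v-min ← minimal key (∁ (P t)) (proj₂ (T∧⁻ {adj u z} uz∧z∉)) = s≤s⁻¹ (begin
        suc (count (∂ t))    ≤⟨ s≤s (count-mono {p = ∂ t} {q = q ∖ v} in-bag) ⟩
        suc (count (q ∖ v))  ≡⟨ count-∖ q v∈q ⟨
        count q              ≡⟨ ∣lookup∣ (bag (first v)) ⟨
        ∣ bag (first v) ∣    ≤⟨ ∣bag∣≤ D width≤w (first v) ⟩
        suc w                ∎)
      where
      open ≤-Reasoning
      q : VertexSet
      q = Vec.lookup (bag (first v))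

      v∈q : T (q v)
      v∈q = proj₁ (proj₂ (first-bag v))

      in-bag : ∀ x → T (∂ t x) → T ((q ∖ v) x)
      in-bag x x∈∂
        with x∈P , some ← T∧⁻ {P t x} x∈∂
        with y , xy∧y∉ ← count>0⇒∃ (≤ᵇ⇒≤ 1 _ some)
        with xy , y∉ ← T∧⁻ {adj x y} xy∧y∉
        with j , x∈j , y∈j ← coversEdges x y xy =
        T∧⁺ (∈⇒lookup (interval x (first x) (first v) j
               (key-≤⇒first-≤ (≤-trans (<⇒≤ (<ᵇ⇒< _ _ x∈P)) t≤key-v))
               (≤-trans (key-≤⇒first-≤ (v-min y y∉)) (proj₂ (proj₂ (first-bag y)) j (∈⇒lookup y∈j)))
               (Vec.lookup⇒[]= x _ (T⇒≡ (proj₁ (proj₂ (first-bag x))))) x∈j))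
            (v≠x (v Fin.≟ x))
        where
        t≤key-v : t ≤ key v
        t≤key-v = ≮⇒≥ (Tnot⁻ v∉ ∘ <⇒<ᵇ)

        v≠x : (d : Dec (v ≡ x)) → T (not (does d))
        v≠x (yes refl) = contradiction (<ᵇ⇒< _ _ x∈P) (≤⇒≯ t≤key-v)
        v≠x (no _)     = _

    -- The edges leaving `L t` go to vertices not yet entered or to `M`. The latter are recounted
    -- from the side of `M`: a vertex of `M` has two neighbours outside, hence at most one in `L t`.
    -- A vertex of `L t` has at most one outside. So every boundary vertex pays for at most one
    -- edge.
    L-cut : ∀ {w} → width D ≤ w → ∀ t → 3 * count (L t) ≤ inner (L t) + w
    L-cut {w} width≤w t = begin
      3 * count (L t)
        ≡⟨ sum-*ˡ 3 (𝟙 ∘ L t) ⟨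
      sum (λ u → 3 * 𝟙 (L t u))
        ≡⟨ sum-cong-≗ split ⟩
      sum (λ u → 𝟙 (L t u) * deg (L t) u + (𝟙 (L t u) * out t u + 𝟙 (L t u) * deg M u))
        ≡⟨ ∑-distrib-+ (λ u → 𝟙 (L t u) * deg (L t) u) _ ⟩
      inner (L t) + sum (λ u → 𝟙 (L t u) * out t u + 𝟙 (L t u) * deg M u)
        ≡⟨ cong (inner (L t) +_) (∑-distrib-+ (λ u → 𝟙 (L t u) * out t u) _) ⟩
      inner (L t) + (between (L t) (∁ (P t)) + between (L t) M)
        ≡⟨ cong (λ e → inner (L t) + (between (L t) (∁ (P t)) + e)) (between-sym (L t) M) ⟩
      inner (L t) + (between (L t) (∁ (P t)) + between M (L t))
        ≡⟨ cong (inner (L t) +_) (∑-distrib-+ (λ u → 𝟙 (L t u) * out t u) _) ⟨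
      inner (L t) + sum (λ u → 𝟙 (L t u) * out t u + 𝟙 (M u) * deg (L t) u)
        ≤⟨ +-monoʳ-≤ (inner (L t)) (sum-mono-≤ boundary) ⟩
      inner (L t) + count (∂ t)
        ≤⟨ +-monoʳ-≤ (inner (L t)) (∂-bound width≤w t) ⟩
      inner (L t) + w ∎
      where
      open ≤-Reasoning
      M : VertexSet
      M u = P t u ∧ not (L t u)

      deg-P : ∀ u → deg (P t) u ≡ deg (L t) u + deg M u
      deg-P = deg-split (P t) (L t) M λ v → lemma v
        where
        lemma : ∀ v → 𝟙 (P t v) ≡ 𝟙 (L t v) + 𝟙 (M v)
        lemma v with P t v | out t v ≤ᵇ 1
        ... | true  | true  = refl
        ... | true  | false = refl
        ... | false | _     = refl

      split : ∀ u → 3 * 𝟙 (L t u) ≡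
              𝟙 (L t u) * deg (L t) u + (𝟙 (L t u) * out t u + 𝟙 (L t u) * deg M u)
      split u = trans (cong (_* 𝟙 (L t u)) (trans (sym (deg-∁ (P t) u)) (cong (_+ out t u) (deg-P u))))
        (distribute (deg (L t) u) (deg M u) (out t u) (𝟙 (L t u)))
        where
        distribute : ∀ a b c l → (a + b + c) * l ≡ l * a + (l * c + l * b)
        distribute = solve-∀

      boundary : ∀ u → 𝟙 (L t u) * out t u + 𝟙 (M u) * deg (L t) u ≤ 𝟙 (∂ t u)
      boundary u with P t u | out t u in out-u
      ... | false | _           = z≤n
      ... | true  | 0           = z≤n
      ... | true  | 1           = ≤-refl
      ... | true  | suc (suc d) = +-cancelʳ-≤ 2 _ 1 (begin
        deg (L t) u + 0 + 2          ≡⟨ cong (_+ 2) (+-identityʳ (deg (L t) u)) ⟩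
        deg (L t) u + 2              ≤⟨ +-monoʳ-≤ (deg (L t) u) (s≤s (s≤s z≤n)) ⟩
        deg (L t) u + suc (suc d)    ≤⟨ +-monoˡ-≤ _ (m≤m+n (deg (L t) u) (deg M u)) ⟩
        deg (L t) u + deg M u + suc (suc d) ≡⟨ cong₂ _+_ (deg-P u) out-u ⟨
        deg (P t) u + out t u        ≡⟨ deg-∁ (P t) u ⟩
        3                            ∎)

  sparse-cut : ∀ {w} (D : PathDecomposition G) → width D ≤ w →
               ∀ a → 0 < a → a ≤ order G →
               ∃[ S ] a ≤ count S × count S ≤ a + 3 × 3 * count S ≤ inner S + w
  sparse-cut D width≤w a 0<a a≤n =
    let t , a≤ , ≤a+3 = crossing (count ∘ L) a (PathDecomposition.#bags D * order G) start (≤-trans a≤n L-end) L-jump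
    in L t , a≤ , ≤a+3 , L-cut width≤w t
    where
    open Sweep D
    start : count (L 0) < a
    start = ≤-trans (s≤s (≤-trans (count-mono {p = L 0} {q = λ _ → false} (λ _ ()))
      (≤-reflexive (count-false (order G))))) 0<a


-- Sparsity

module Sparsity (G : Graph) (cubic : Cubic G) where
  open Graph G using (adj; Adj; adj-sym)
  open Walks G
  open Density G cubic

  Core : VertexSet → Set
  Core S = ∀ {x} → T (S x) → 2 ≤ deg S x

  -- As `inner` counts every edge twice, up to `c / 2` edges more than vertices are allowed; for
  -- `c = 0` no connected set of this size carries two independent cycles.
  Sparse : (c m : ℕ) → Set
  Sparse c m = ∀ S → count S ≤ m → inner S ≤ 2 * count S + c

  inside : VertexSet → Vertex G → List (Vertex G)
  inside S x = members (λ v → adj x v ∧ S v)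

  inside⁻ : ∀ S {x v} → v ∈ inside S x → Adj x v × T (S v)
  inside⁻ S {x} v∈ = T∧⁻ {adj x _} (∈-members⁻ _ v∈)

  another-neighbour : ∀ {S} → Core S → ∀ {x} → T (S x) → ∀ u → ∃[ y ] Adj x y × T (S y) × u ≢ y
  another-neighbour {S} core {x} Sx u
    with inside S x | inside⁻ S {x} | members-unique (λ v → adj x v ∧ S v)
       | length-members (λ v → adj x v ∧ S v)
  ... | []         | _   | _                  | len = contradiction (core Sx) (<⇒≱ (subst (_< 2) len (s≤s z≤n)))
  ... | _ ∷ []     | _   | _                  | len = contradiction (core Sx) (<⇒≱ (subst (_< 2) len (s≤s (s≤s z≤n))))
  ... | y ∷ z ∷ _ | ins | (y≢z ∷ _) ∷ _ | _ with u Fin.≟ y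
  ...   | no u≢y   = y , proj₁ (ins (here refl)) , proj₂ (ins (here refl)) , u≢y
  ...   | yes refl = z , proj₁ (ins (there (here refl))) , proj₂ (ins (there (here refl))) , y≢z

  -- In a core a walk can always be continued without turning back.
  arm : ∀ {S} → Core S → ∀ h {u x} → Adj u x → T (S x) →
        ∃[ l ] length l ≡ h × NonBacktracking (u ∷ x ∷ l) × All (T ∘ S) (x ∷ l)
  arm core zero    ux Sx = [] , refl , two ux , Sx ∷ []
  arm core (suc h) {u} {x} ux Sx =
    let y , xy , Sy , u≢y = another-neighbour core Sx u
        l , len , w , Sl = arm core h xy Sy
    in y ∷ l , cong suc len , step ux u≢y w , Sx ∷ Sl

  -- Reversing one arm and joining it to the other at `v` gives a single walk without backtracking
  -- on at most `g` vertices, so all of them are distinct.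
  arms-disjoint : ∀ {g v} l m → Girth≥ g G → NonBacktracking (v ∷ l) → NonBacktracking (v ∷ m) →
                  DifferentHeads l m → length l + suc (length m) ≤ g → ∀ {x} → x ∈ l → x ∉ v ∷ m
  arms-disjoint {v = v} l m girth wl wm diff short x∈l x∈m =
    proj₂ (proj₂ (unique-++⁻ (reverse l) (subst Unique (ʳ++-defn l)
      (nb-unique (l ʳ++ v ∷ m) girth (nb-join l m wl wm diff)
        (≤-trans (≤-reflexive (length-ʳ++ l)) short))))) (Any.reverse⁺ x∈l) x∈m

  full-vertex : ∀ S → 2 * count S < inner S → ∃[ v ] T (S v) × 3 ≤ deg S v
  full-vertex S dense with sum<⇒∃< {f = λ u → 2 * 𝟙 (S u)} {g = λ u → 𝟙 (S u) * deg S u}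
                             (subst (_< inner S) (sym (sum-*ˡ 2 (𝟙 ∘ S))) dense)
  ... | v , 2<d with S v in Sv
  ...   | true  = v , ≡⇒T Sv , subst (3 ≤_) (+-identityʳ (deg S v)) 2<d

  -- One arm has `suc h` vertices and the other two have `suc k`; the two inequalities say that any
  -- two arms fit together with `v` into `g` vertices. Two parameters are kept because for even `g`
  -- the best arms are not all equal.
  three-arms : ∀ {g S v} → Girth≥ g G → Core S → T (S v) → 3 ≤ deg S v →
    ∀ h k → suc h + suc (suc k) ≤ g → suc k + suc (suc k) ≤ g →
    suc (suc h + (suc k + suc k)) ≤ count S
  three-arms {g} {S} {v} girth core Sv full h k hk≤g kk≤g
    with inside S v | inside⁻ S {v} | members-unique (λ x → adj v x ∧ S x)
       | length-members (λ x → adj v x ∧ S x)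
  ... | []         | _ | _ | len = contradiction full (<⇒≱ (subst (_< 3) len (s≤s z≤n)))
  ... | _ ∷ []     | _ | _ | len = contradiction full (<⇒≱ (subst (_< 3) len (s≤s (s≤s z≤n))))
  ... | _ ∷ _ ∷ [] | _ | _ | len = contradiction full (<⇒≱ (subst (_< 3) len (s≤s (s≤s (s≤s z≤n)))))
  ... | a ∷ b ∷ c ∷ _ | ins | (a≢b ∷ a≢c ∷ _) ∷ (b≢c ∷ _) ∷ _ | _
    with la , ∣la∣ , wa , Sa ← arm core h (proj₁ (ins (here refl))) (proj₂ (ins (here refl)))
       | lb , ∣lb∣ , wb , Sb ← arm core k (proj₁ (ins (there (here refl)))) (proj₂ (ins (there (here refl))))
       | lc , ∣lc∣ , wc , Sc ← arm core k (proj₁ (ins (there (there (here refl)))))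
                                          (proj₂ (ins (there (there (here refl))))) =
    ≤-trans (≤-reflexive (sym size)) (length≤count unique (Sv ∷ All.++⁺ Sa (All.++⁺ Sb Sc)))
    where
    A = a ∷ la
    B = b ∷ lb
    C = c ∷ lc

    size : length (v ∷ A ++ B ++ C) ≡ suc (suc h + (suc k + suc k))
    size = cong suc (trans (length-++ A) (cong₂ _+_ (cong suc ∣la∣)
      (trans (length-++ B) (cong₂ _+_ (cong suc ∣lb∣) (cong suc ∣lc∣)))))

    ab : ∀ {x} → x ∈ A → x ∉ v ∷ B
    ab = arms-disjoint A B girth wa wb a≢b
      (subst₂ (λ i j → suc i + suc (suc j) ≤ g) (sym ∣la∣) (sym ∣lb∣) hk≤g)

    ac : ∀ {x} → x ∈ A → x ∉ v ∷ C
    ac = arms-disjoint A C girth wa wc a≢c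
      (subst₂ (λ i j → suc i + suc (suc j) ≤ g) (sym ∣la∣) (sym ∣lc∣) hk≤g)

    bc : ∀ {x} → x ∈ B → x ∉ v ∷ C
    bc = arms-disjoint B C girth wb wc b≢c
      (subst₂ (λ i j → suc i + suc (suc j) ≤ g) (sym ∣lb∣) (sym ∣lc∣) kk≤g)

    bv : ∀ {x} → x ∈ C → x ∉ v ∷ B
    bv = arms-disjoint C B girth wc wb (b≢c ∘ sym)
      (subst₂ (λ i j → suc i + suc (suc j) ≤ g) (sym ∣lc∣) (sym ∣lb∣) kk≤g)

    arm-unique : ∀ l → NonBacktracking (v ∷ l) → suc (length l) ≤ g → Unique (v ∷ l)
    arm-unique l w = nb-unique (v ∷ l) girth w

    short : ∀ {i j} → i ≡ j → suc j + suc (suc k) ≤ g → suc (suc i) ≤ g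
    short {i} refl ≤g = ≤-trans (≤-trans (m≤m+n (suc (suc i)) (suc k))
      (≤-reflexive (sym (+-suc (suc i) (suc k))))) ≤g

    uA = arm-unique A wa (short ∣la∣ hk≤g)
    uB = arm-unique B wb (short ∣lb∣ kk≤g)
    uC = arm-unique C wc (short ∣lc∣ kk≤g)

    tail-unique : ∀ {l : List (Vertex G)} {x} → Unique (x ∷ l) → Unique l
    tail-unique (_ ∷ u) = u

    unique : Unique (v ∷ A ++ B ++ C)
    unique = All.¬Any⇒All¬ _ v∉ ∷ Unique.++⁺ (tail-unique uA)
      (Unique.++⁺ (tail-unique uB) (tail-unique uC) (λ (x∈B , x∈C) → bc x∈B (there x∈C)))
      (λ (x∈A , x∈) → [ ab x∈A ∘ there , ac x∈A ∘ there ]′ (∈-++⁻ B x∈))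
      where
      v∉ : v ∉ A ++ B ++ C
      v∉ v∈ with ∈-++⁻ A v∈
      ... | inj₁ v∈A = ab v∈A (here refl)
      ... | inj₂ v∈′ with ∈-++⁻ B v∈′
      ...   | inj₁ v∈B = bc v∈B (here refl)
      ...   | inj₂ v∈C = bv v∈C (here refl)

  core-induction : (Q : VertexSet → Set) →
    (∀ S {x} → T (S x) → deg S x ≤ 1 → Q (S ∖ x) → Q S) → (∀ S → Core S → Q S) → ∀ S → Q S
  core-induction Q remove done S = go (count S) S ≤-refl
    where
    go : ∀ b S → count S ≤ b → Q S
    go b S ≤b with Fin.any? (λ x → T? (S x) ×-dec deg S x ≤? 1)
    ... | no none = done S (λ {x} Sx → ≰⇒> (λ few → none (x , Sx , few)))
    ... | yes (x , Sx , few) with b | subst (_≤ b) (count-∖ S Sx) ≤b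
    ...   | suc b′ | s≤s ≤b′ = remove S Sx few (go b′ (S ∖ x) ≤b′)

  -- Deleting `x` lowers `2 * count S` by 2 and `inner S` by twice the degree; the `+ 2` avoids a
  -- subtraction. For `d = 1` the constant `e` is preserved, for `d = 2` it grows by 2.
  inner-remove : ∀ S {x} → T (S x) → ∀ {d e} → deg S x ≤ d → inner (S ∖ x) ≤ 2 * count (S ∖ x) + e →
                 inner S + 2 ≤ 2 * count S + (e + 2 * d)
  inner-remove S {x} Sx {d} {e} deg≤d bound = begin
    inner S + 2                                    ≡⟨ cong (_+ 2) (inner-∖ S Sx) ⟩
    inner (S ∖ x) + 2 * deg S x + 2                ≤⟨ +-monoˡ-≤ 2 (+-mono-≤ bound (*-monoʳ-≤ 2 deg≤d)) ⟩
    2 * count (S ∖ x) + e + 2 * d + 2              ≡⟨ rearrange (count (S ∖ x)) e d ⟩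
    2 * suc (count (S ∖ x)) + (e + 2 * d)          ≡⟨ cong (λ n → 2 * n + (e + 2 * d)) (count-∖ S Sx) ⟨
    2 * count S + (e + 2 * d)                      ∎
    where
    open ≤-Reasoning
    rearrange : ∀ n e d → 2 * n + e + 2 * d + 2 ≡ 2 * suc n + (e + 2 * d)
    rearrange = solve-∀

  sparse-by-cores : ∀ {c m} → (∀ S → Core S → count S ≤ m → inner S ≤ 2 * count S + c) → Sparse c m
  sparse-by-cores {c} {m} on-cores = core-induction _ remove on-cores
    where
    remove : ∀ S {x} → T (S x) → deg S x ≤ 1 →
             (count (S ∖ x) ≤ m → inner (S ∖ x) ≤ 2 * count (S ∖ x) + c) →
             count S ≤ m → inner S ≤ 2 * count S + c
    remove S {x} Sx few ih ≤m = +-cancelʳ-≤ 2 _ _ (begin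
      inner S + 2              ≤⟨ inner-remove S Sx few (ih (≤-trans (n≤1+n _) (subst (_≤ m) (count-∖ S Sx) ≤m))) ⟩
      2 * count S + (c + 2)    ≡⟨ +-assoc (2 * count S) c 2 ⟨
      2 * count S + c + 2      ∎)
      where open ≤-Reasoning

  -- The best choice of `h` and `k` reaches one vertex less than the smallest theta graph of girth
  -- `g`, that is, two vertices joined by three paths of total length at least `3 g / 2`.
  sparse-girth : ∀ {g} → Girth≥ g G → ∀ h k → suc h + suc (suc k) ≤ g → suc k + suc (suc k) ≤ g →
                 Sparse 0 (suc h + (suc k + suc k))
  sparse-girth girth h k hk≤g kk≤g = sparse-by-cores λ S core ≤m → ≮⇒≥ λ dense →
    let v , Sv , full = full-vertex S (subst (_< inner S) (+-identityʳ _) dense)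
    in <⇒≱ (three-arms girth core Sv full h k hk≤g kk≤g) ≤m

  -- A non-empty core contains a walk on `2 + g` distinct vertices, so a smaller set is dismantled
  -- completely.
  forest : ∀ {g} → Girth≥ (2 + g) G → ∀ S → 0 < count S → count S < 2 + g → inner S < 2 * count S
  forest {g} girth = core-induction _ remove on-core
    where
    on-core : ∀ S → Core S → 0 < count S → count S < 2 + g → inner S < 2 * count S
    on-core S core 0<m m<g =
      let v , Sv = count>0⇒∃ 0<m
          x , vx , Sx , _ = another-neighbour core Sv v
          l , len , w , Sl = arm core g vx Sx
      in contradiction (length≤count (nb-unique (v ∷ x ∷ l) girth w (≤-reflexive (cong (2 +_) len))) (Sv ∷ Sl))
           (<⇒≱ (subst (λ i → count S < 2 + i) (sym len) m<g))

    remove : ∀ S {x} → T (S x) → deg S x ≤ 1 →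
             (0 < count (S ∖ x) → count (S ∖ x) < 2 + g → inner (S ∖ x) < 2 * count (S ∖ x)) →
             0 < count S → count S < 2 + g → inner S < 2 * count S
    remove S {x} Sx few ih 0<m m<g with count (S ∖ x) in eq
    -- The last vertex has no inner edges; here the inequality becomes strict.
    ... | zero = begin-strict
      inner S                          ≡⟨ inner-∖ S Sx ⟩
      inner (S ∖ x) + 2 * deg S x      ≤⟨ +-mono-≤ (sum-mono-≤ (λ u → *-monoʳ-≤ (𝟙 ((S ∖ x) u)) (deg≤3 (S ∖ x) u)))
                                           (*-monoʳ-≤ 2 (≤-trans (≤-reflexive (sym (deg-∖-self S x))) deg≤count)) ⟩
      sum (λ u → 𝟙 ((S ∖ x) u) * 3) + 2 * count (S ∖ x)
                                       ≡⟨ cong (_+ 2 * count (S ∖ x)) (trans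
                                            (sum-cong-≗ (λ u → *-comm (𝟙 ((S ∖ x) u)) 3))
                                            (sum-*ˡ 3 (𝟙 ∘ (S ∖ x)))) ⟩
      3 * count (S ∖ x) + 2 * count (S ∖ x) ≡⟨ cong (λ n → 3 * n + 2 * n) eq ⟩
      0                                <⟨ s≤s z≤n ⟩
      2                                ≡⟨ cong (λ n → 2 * suc n) eq ⟨
      2 * suc (count (S ∖ x))          ≡⟨ cong (2 *_) (count-∖ S Sx) ⟨
      2 * count S                      ∎
      where
      open ≤-Reasoning
      deg≤count : deg (S ∖ x) x ≤ count (S ∖ x)
      deg≤count = count-mono {p = λ v → adj x v ∧ (S ∖ x) v} {q = S ∖ x} (λ v t → proj₂ (T∧⁻ {adj x v} t))
    ... | suc n = begin-strict
      inner S                       ≡⟨ inner-∖ S Sx ⟩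
      inner (S ∖ x) + 2 * deg S x   ≤⟨ +-monoʳ-≤ (inner (S ∖ x)) (*-monoʳ-≤ 2 few) ⟩
      inner (S ∖ x) + 2             <⟨ +-monoˡ-< 2 (ih (s≤s z≤n) (<-trans (≤-reflexive (cong suc (sym eq)))
                                         (subst (_< 2 + g) (count-∖ S Sx) m<g))) ⟩
      2 * suc n + 2                 ≡⟨ rearrange (suc n) ⟩
      2 * suc (suc n)               ≡⟨ cong (λ n → 2 * suc n) eq ⟨
      2 * suc (count (S ∖ x))       ≡⟨ cong (2 *_) (count-∖ S Sx) ⟨
      2 * count S                   ∎
      where
      open ≤-Reasoning
      rearrange : ∀ n → 2 * n + 2 ≡ 2 * suc n
      rearrange = solve-∀

  -- Deleting a vertex of degree at most 2 costs 2 in `c`. If there is none, `S` induces a cubic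
  -- graph on `suc m` vertices, and deleting any vertex from it leaves `3 * m ≤ 2 * m + c + 3`,
  -- against `c + 4 ≤ m`.
  sparse-suc : ∀ {c m} → c + 4 ≤ m → Sparse c m → Sparse (c + 2) (suc m)
  sparse-suc {c} {m} c+4≤m sparse S ≤1+m with count S ≤? m
  ... | yes ≤m = ≤-trans (sparse S ≤m) (+-monoʳ-≤ (2 * count S) (m≤m+n c 2))
  ... | no  ≰m with Fin.any? (λ x → T? (S x) ×-dec deg S x ≤? 2)
  ...   | yes (x , Sx , deg≤2) = +-cancelʳ-≤ 2 _ _ (begin
    inner S + 2                  ≤⟨ inner-remove S Sx deg≤2
                                      (sparse (S ∖ x) (s≤s⁻¹ (subst (_≤ suc m) (count-∖ S Sx) ≤1+m))) ⟩
    2 * count S + (c + 4)        ≡⟨ rearrange (2 * count S) c ⟩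
    2 * count S + (c + 2) + 2    ∎)
    where
    open ≤-Reasoning
    rearrange : ∀ s c → s + (c + 4) ≡ s + (c + 2) + 2
    rearrange = solve-∀
  ...   | no none = contradiction c+4≤m (<⇒≱ (≤-trans (s≤s m≤c+3) (≤-reflexive (sym (+-suc c 3)))))
    where
    open ≤-Reasoning
    some : ∃[ x ] T (S x)
    some = count>0⇒∃ (≤-trans (s≤s z≤n) (≰⇒> ≰m))

    x  = proj₁ some
    Sx = proj₂ some

    small : count (S ∖ x) ≤ m
    small = s≤s⁻¹ (subst (_≤ suc m) (count-∖ S Sx) ≤1+m)

    cubic-inside : ∀ u → 3 * 𝟙 (S u) ≤ 𝟙 (S u) * deg S u
    cubic-inside u with S u in Su
    ... | false = z≤n
    ... | true  = ≤-trans (≰⇒> (λ few → none (u , ≡⇒T Su , few))) (≤-reflexive (sym (+-identityʳ (deg S u))))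

    three : ∀ m → 2 * m + m ≡ 3 * m
    three = solve-∀

    m≤c+3 : m ≤ c + 3
    m≤c+3 = +-cancelˡ-≤ (2 * m) _ _ (begin
      2 * m + m                      ≡⟨ three m ⟩
      3 * m                          ≤⟨ *-monoʳ-≤ 3 (s≤s⁻¹ (≤-trans (≰⇒> ≰m) (≤-reflexive (count-∖ S Sx)))) ⟩
      3 * count (S ∖ x)              ≤⟨ +-cancelʳ-≤ 3 _ _ (begin
        3 * count (S ∖ x) + 3          ≡⟨ trans (+-comm _ 3) (sym (*-suc 3 (count (S ∖ x)))) ⟩
        3 * suc (count (S ∖ x))        ≡⟨ cong (3 *_) (count-∖ S Sx) ⟨
        3 * count S                    ≡⟨ sum-*ˡ 3 (𝟙 ∘ S) ⟨
        sum (λ u → 3 * 𝟙 (S u))        ≤⟨ sum-mono-≤ cubic-inside ⟩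
        inner S                        ≡⟨ inner-∖ S Sx ⟩
        inner (S ∖ x) + 2 * deg S x    ≤⟨ +-monoʳ-≤ (inner (S ∖ x)) (*-monoʳ-≤ 2 (deg≤3 S x)) ⟩
        inner (S ∖ x) + 6              ≡⟨ +-assoc (inner (S ∖ x)) 3 3 ⟨
        inner (S ∖ x) + 3 + 3          ∎) ⟩
      inner (S ∖ x) + 3              ≤⟨ +-monoˡ-≤ 3 (sparse (S ∖ x) small) ⟩
      2 * count (S ∖ x) + c + 3      ≤⟨ +-monoˡ-≤ 3 (+-monoˡ-≤ c (*-monoʳ-≤ 2 small)) ⟩
      2 * m + c + 3                  ≡⟨ +-assoc (2 * m) c 3 ⟩
      2 * m + (c + 3)                ∎)

  NoPair : VertexSet → Set
  NoPair S = ∀ {x y} → T (S x) → T (S y) → Adj x y → deg S x ≤ 2 → deg S y ≤ 2 → ⊥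

  deg-∖-adjacent : ∀ S {x y} → T (S x) → Adj x y → deg S y ≡ suc (deg (S ∖ x) y)
  deg-∖-adjacent S {x} {y} Sx xy = begin
    count (λ v → adj y v ∧ S v)                  ≡⟨ count-∖ (λ v → adj y v ∧ S v) (T∧⁺ (Adj-sym xy) Sx) ⟩
    suc (count ((λ v → adj y v ∧ S v) ∖ x))      ≡⟨ cong suc (sum-cong-≗ (λ v → cong 𝟙 (∧-assoc (adj y v) (S v) _))) ⟩
    suc (count (λ v → adj y v ∧ (S ∖ x) v))      ∎
    where open ≡-Reasoning

  -- Two adjacent vertices of degree at most 2 meet at most three edges, each of which `inner`
  -- counts twice.
  remove-pair : ∀ S {x y} → T (S x) → T (S y) → Adj x y → deg S x ≤ 2 → deg S y ≤ 2 →
                count S ≡ suc (suc (count ((S ∖ x) ∖ y))) × inner S ≤ inner ((S ∖ x) ∖ y) + 6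
  remove-pair S {x} {y} Sx Sy xy dx dy =
    trans (count-∖ S Sx) (cong suc (count-∖ (S ∖ x) S∖y)) , (begin
      inner S                                                      ≡⟨ inner-∖ S Sx ⟩
      inner (S ∖ x) + 2 * deg S x                                  ≡⟨ cong (_+ 2 * deg S x) (inner-∖ (S ∖ x) S∖y) ⟩
      inner ((S ∖ x) ∖ y) + 2 * deg (S ∖ x) y + 2 * deg S x        ≤⟨ +-mono-≤
        (+-monoʳ-≤ (inner ((S ∖ x) ∖ y)) (*-monoʳ-≤ 2 d′y)) (*-monoʳ-≤ 2 dx) ⟩
      inner ((S ∖ x) ∖ y) + 2 + 4                                  ≡⟨ +-assoc (inner ((S ∖ x) ∖ y)) 2 4 ⟩
      inner ((S ∖ x) ∖ y) + 6                                      ∎)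
    where
    open ≤-Reasoning
    S∖y : T ((S ∖ x) y)
    S∖y with x Fin.≟ y
    ... | yes refl = contradiction refl (Adj⇒≢ xy)
    ... | no _     = T∧⁺ Sy _

    d′y : deg (S ∖ x) y ≤ 1
    d′y = s≤s⁻¹ (≤-trans (≤-reflexive (sym (deg-∖-adjacent S Sx xy))) dy)

  -- Removing a pair lowers `2 * count S` by 4 and `inner S` by at most 6. So two vertices cost only
  -- 2 in `c`, not the 4 of two single deletions.
  sparse⇒noPair : ∀ {c m} → Sparse c m → ∀ S → count S ≡ 2 + m → 2 * count S + (c + 2) < inner S → NoPair S
  sparse⇒noPair {c} {m} sparse S size dense {x} {y} Sx Sy xy dx dy = <⇒≱ dense (begin
    inner S                              ≤⟨ proj₂ removed ⟩
    inner R + 6                          ≤⟨ +-monoˡ-≤ 6 (sparse R (≤-reflexive R-size)) ⟩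
    2 * count R + c + 6                  ≡⟨ rearrange (count R) c ⟩
    2 * suc (suc (count R)) + (c + 2)    ≡⟨ cong (λ n → 2 * n + (c + 2)) (proj₁ removed) ⟨
    2 * count S + (c + 2)                ∎)
    where
    open ≤-Reasoning
    R = (S ∖ x) ∖ y
    removed = remove-pair S Sx Sy xy dx dy

    R-size : count R ≡ m
    R-size = suc-injective (suc-injective (trans (sym (proj₁ removed)) size))

    rearrange : ∀ n c → 2 * n + c + 6 ≡ 2 * suc (suc n) + (c + 2)
    rearrange = solve-∀

  module Degrees (S : VertexSet) (core : Core S) where

    Two Three : VertexSet
    Two   u = S u ∧ (deg S u ≤ᵇ 2)
    Three u = S u ∧ not (deg S u ≤ᵇ 2)

    Two⁻ : ∀ {u} → T (Two u) → T (S u) × deg S u ≤ 2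
    Two⁻ {u} t = let Su , d = T∧⁻ {S u} t in Su , ≤ᵇ⇒≤ _ _ d

    Three⁻ : ∀ {u} → T (Three u) → T (S u) × 3 ≤ deg S u
    Three⁻ {u} t = let Su , d = T∧⁻ {S u} t in Su , ≰⇒> (Tnot⁻ d ∘ ≤⇒≤ᵇ)

    split : ∀ u → 𝟙 (S u) ≡ 𝟙 (Two u) + 𝟙 (Three u)
    split u with S u | deg S u ≤ᵇ 2
    ... | true  | true  = refl
    ... | true  | false = refl
    ... | false | _     = refl

    size : count S ≡ count Two + count Three
    size = trans (sum-cong-≗ split) (∑-distrib-+ (𝟙 ∘ Two) (𝟙 ∘ Three))

    -- Inside a core of a cubic graph all degrees are 2 or 3, so the number of vertices of degree 3
    -- measures the density exactly.
    excess : inner S ≡ 2 * count S + count Three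
    excess = begin
      inner S                                       ≡⟨ sum-cong-≗ degree ⟩
      sum (λ u → 2 * 𝟙 (S u) + 𝟙 (Three u))         ≡⟨ ∑-distrib-+ (λ u → 2 * 𝟙 (S u)) (𝟙 ∘ Three) ⟩
      sum (λ u → 2 * 𝟙 (S u)) + count Three         ≡⟨ cong (_+ count Three) (sum-*ˡ 2 (𝟙 ∘ S)) ⟩
      2 * count S + count Three                     ∎
      where
      open ≡-Reasoning
      degree : ∀ u → 𝟙 (S u) * deg S u ≡ 2 * 𝟙 (S u) + 𝟙 (Three u)
      degree u with S u in Su | deg S u ≤ᵇ 2 in few
      ... | false | _     = refl
      ... | true  | true  = trans (+-identityʳ _) (≤-antisym (≤ᵇ⇒≤ _ _ (≡⇒T few)) (core (≡⇒T Su)))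
      ... | true  | false = trans (+-identityʳ _) (≤-antisym (deg≤3 S u) (≰⇒> (subst T few ∘ ≤⇒≤ᵇ)))

    module _ (noPair : NoPair S) where

      deg-Three : ∀ {u} → T (Two u) → deg Three u ≡ deg S u
      deg-Three {u} u∈ = ≤-antisym (deg-mono (λ v → proj₁ ∘ Three⁻ {v}) u)
        (count-mono {p = λ v → adj u v ∧ S v} {q = λ v → adj u v ∧ Three v} λ v t →
          let uv , Sv = T∧⁻ {adj u v} t ; Su , du = Two⁻ u∈ in
          T∧⁺ uv (T∧⁺ Sv (Tnot (λ dv → noPair Su Sv uv du (≤ᵇ⇒≤ _ _ dv)))))

      double-count : 2 * count Two ≤ between Three Two
      double-count = begin
        2 * count Two                 ≡⟨ sum-*ˡ 2 (𝟙 ∘ Two) ⟨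
        sum (λ u → 2 * 𝟙 (Two u))     ≤⟨ sum-mono-≤ pointwise ⟩
        between Two Three               ≡⟨ between-sym Two Three ⟩
        between Three Two               ∎
        where
        open ≤-Reasoning
        pointwise : ∀ u → 2 * 𝟙 (Two u) ≤ 𝟙 (Two u) * deg Three u
        pointwise u with Two u in u∈
        ... | false = z≤n
        ... | true  = ≤-trans (core (proj₁ (Two⁻ (≡⇒T u∈))))
          (≤-reflexive (sym (trans (+-identityʳ _) (deg-Three (≡⇒T u∈)))))

      three-pointwise : ∀ u → 𝟙 (Three u) * deg Two u ≤ 3 * 𝟙 (Three u)
      three-pointwise u = ≤-trans (*-monoʳ-≤ (𝟙 (Three u)) (deg≤3 Two u)) (≤-reflexive (*-comm (𝟙 (Three u)) 3))

      -- Without pairs both edges at a vertex of degree 2 end in vertices of degree 3, and each of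
      -- these receives at most three.
      2Two≤3Three : 2 * count Two ≤ 3 * count Three
      2Two≤3Three = ≤-trans double-count (≤-trans (sum-mono-≤ three-pointwise) (≤-reflexive (sum-*ˡ 3 (𝟙 ∘ Three))))

      2count≤5Three : 2 * count S ≤ 5 * count Three
      2count≤5Three = begin
        2 * count S                           ≡⟨ cong (2 *_) size ⟩
        2 * (count Two + count Three)         ≡⟨ *-distribˡ-+ 2 (count Two) (count Three) ⟩
        2 * count Two + 2 * count Three       ≤⟨ +-monoˡ-≤ _ 2Two≤3Three ⟩
        3 * count Three + 2 * count Three     ≡⟨ *-distribʳ-+ (count Three) 3 2 ⟨
        5 * count Three                       ∎
        where open ≤-Reasoning

      -- In the case of equality the vertices of degree 2 subdivide a cubic multigraph.
      tight-neighbours : 5 * count Three ≤ 2 * count S → ∀ {u} → T (Three u) → 3 ≤ deg Two u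
      tight-neighbours tight {u} u∈ = begin
        3                           ≡⟨ cong (λ b → 3 * 𝟙 b) (T⇒≡ u∈) ⟨
        3 * 𝟙 (Three u)             ≤⟨ sum-rigid three-pointwise total u ⟩
        𝟙 (Three u) * deg Two u     ≡⟨ cong (λ b → 𝟙 b * deg Two u) (T⇒≡ u∈) ⟩
        1 * deg Two u               ≡⟨ *-identityˡ (deg Two u) ⟩
        deg Two u                   ∎
        where
        open ≤-Reasoning
        total : sum (λ u → 3 * 𝟙 (Three u)) ≤ between Three Two
        total = ≤-trans (≤-reflexive (sum-*ˡ 3 (𝟙 ∘ Three))) (≤-trans (+-cancelʳ-≤ (2 * count Three) _ _ (begin
          3 * count Three + 2 * count Three    ≡⟨ *-distribʳ-+ (count Three) 3 2 ⟨
          5 * count Three                      ≤⟨ tight ⟩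
          2 * count S                          ≡⟨ cong (2 *_) size ⟩
          2 * (count Two + count Three)        ≡⟨ *-distribˡ-+ 2 (count Two) (count Three) ⟩
          2 * count Two + 2 * count Three      ∎)) double-count)

  sparse-excess : ∀ {c m} → c + 5 ≤ m → Sparse c m → ∀ S (core : Core S) → count S ≤ 2 + m →
                  count (Degrees.Three S core) ≤ c + 4
  sparse-excess {c} {m} c+5≤m sparse S core ≤2+m = +-cancelˡ-≤ (2 * count S) _ _ (begin
    2 * count S + count Three    ≡⟨ excess ⟨
    inner S                      ≤⟨ sparse-suc (≤-trans (≤-reflexive (suc+ c)) (s≤s c+5≤m))
                                      (sparse-suc (≤-trans (+-monoʳ-≤ c (n≤1+n 4)) c+5≤m) sparse) S ≤2+m ⟩
    2 * count S + (c + 2 + 2)    ≡⟨ cong (2 * count S +_) (+-assoc c 2 2) ⟩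
    2 * count S + (c + 4)        ∎)
    where
    open ≤-Reasoning
    open Degrees S core
    suc+ : ∀ c → c + 2 + 4 ≡ suc (c + 5)
    suc+ = solve-∀

  -- This saves 2 in `c` over two uses of `sparse-suc`. A violating core on `2 + m` vertices has no
  -- pair, hence `2 * (2 + m) ≤ 5 * count Three ≤ 5 * (c + 4)`, and the first hypothesis is the
  -- negation of this.
  sparse-2+ : ∀ {c m} → 5 * c + 17 ≤ 2 * m → c + 5 ≤ m → Sparse c m → Sparse (c + 2) (2 + m)
  sparse-2+ {c} {m} large c+5≤m sparse = sparse-by-cores bound
    where
    bound : ∀ S → Core S → count S ≤ 2 + m → inner S ≤ 2 * count S + (c + 2)
    bound S core ≤2+m with count S ≤? suc m
    ... | yes ≤1+m = sparse-suc (≤-trans (+-monoʳ-≤ c (n≤1+n 4)) c+5≤m) sparse S ≤1+m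
    ... | no  ≰1+m = ≮⇒≥ λ dense → contradiction large (<⇒≱ (+-cancelʳ-< 4 _ _ (begin-strict
      2 * m + 4         ≡⟨ double m ⟩
      2 * (2 + m)       ≡⟨ cong (2 *_) count≡ ⟨
      2 * count S       ≤⟨ 2count≤5Three (sparse⇒noPair sparse S count≡ dense) ⟩
      5 * count Three   ≤⟨ *-monoʳ-≤ 5 (sparse-excess c+5≤m sparse S core ≤2+m) ⟩
      5 * (c + 4)       <⟨ ≤-reflexive (five c) ⟩
      5 * c + 17 + 4    ∎)))
      where
      open ≤-Reasoning
      open Degrees S core
      count≡ : count S ≡ 2 + m
      count≡ = ≤-antisym ≤2+m (≰⇒> ≰1+m)

      double : ∀ m → 2 * m + 4 ≡ 2 * (2 + m)
      double = solve-∀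

      five : ∀ c → suc (5 * (c + 4)) ≡ 5 * c + 17 + 4
      five = solve-∀

  -- What a set violating the conclusion of sparse-tight looks like around one of its
  -- vertices of degree 3.
  record TightAt (m : ℕ) (S : VertexSet) (v : Vertex G) : Set where
    field
      core    : Core S
      size    : count S ≤ m
      centre  : T (S v)
      around  : ∀ {a} → Adj v a → T (S a)
      beyond  : ∀ {a} → Adj v a → ∃[ b ] Adj a b × v ≢ b × T (S b) × (∀ {z} → Adj b z → T (S z))

  full⇒inside : ∀ S {v} → 3 ≤ deg S v → ∀ {a} → Adj v a → T (S a)
  full⇒inside S {v} full {a} va with S a in Sa
  ... | true  = _
  ... | false = contradiction full (<⇒≱ (≤-trans (s≤s (count-mono {p = λ x → adj v x ∧ S x} {q = adj v ∖ a} sub))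
      (≤-reflexive (trans (sym (count-∖ (adj v) va)) (degree3 v)))))
    where
    sub : ∀ x → T (adj v x ∧ S x) → T ((adj v ∖ a) x)
    sub x t with a Fin.≟ x
    ... | yes refl = contradiction (proj₂ (T∧⁻ {adj v a} t)) (subst T Sa)
    ... | no _     = T∧⁺ (proj₁ (T∧⁻ {adj v x} t)) _

  -- In the borderline case of `sparse-2+` counting does not exclude a violating core but fixes its
  -- shape: a vertex of degree 3 has only neighbours of degree 2, and each of them leads on to
  -- another vertex of degree 3. Whether this shape occurs depends on the graph.
  sparse-tight : ∀ {c m} → c + 5 ≤ m → 2 * (2 + m) ≡ 5 * (c + 4) → Sparse c m →
                 (∀ S v → ¬ TightAt (2 + m) S v) → Sparse (c + 3) (2 + m)
  sparse-tight {c} {m} c+5≤m tight sparse excluded = sparse-by-cores bound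
    where
    bound : ∀ S → Core S → count S ≤ 2 + m → inner S ≤ 2 * count S + (c + 3)
    bound S core ≤2+m with count S ≤? suc m
    ... | yes ≤1+m = ≤-trans (sparse-suc (≤-trans (+-monoʳ-≤ c (n≤1+n 4)) c+5≤m) sparse S ≤1+m)
                             (+-monoʳ-≤ (2 * count S) (+-monoʳ-≤ c (n≤1+n 2)))
    ... | no  ≰1+m = ≮⇒≥ λ dense → excluded S _ (at dense)
      where
      open Degrees S core
      module _ (dense : 2 * count S + (c + 3) < inner S) where
        count≡ : count S ≡ 2 + m
        count≡ = ≤-antisym ≤2+m (≰⇒> ≰1+m)

        noPair : NoPair S
        noPair = sparse⇒noPair sparse S count≡ (≤-trans (s≤s (+-monoʳ-≤ (2 * count S) (+-monoʳ-≤ c (n≤1+n 2)))) dense)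

        five : 5 * count Three ≤ 2 * count S
        five = ≤-trans (*-monoʳ-≤ 5 (sparse-excess c+5≤m sparse S core ≤2+m))
          (≤-reflexive (trans (sym tight) (cong (2 *_) (sym count≡))))

        some : ∃[ v ] T (Three v)
        some = count>0⇒∃ (≤-trans (s≤s z≤n) (+-cancelˡ-< (2 * count S) _ _ (≤-trans dense (≤-reflexive excess))))

        at : TightAt (2 + m) S (proj₁ some)
        at = record
          { core   = core
          ; size   = ≤2+m
          ; centre = proj₁ (Three⁻ (proj₂ some))
          ; around = λ va → proj₁ (Two⁻ (is-two va))
          ; beyond = λ {a} va →
              let Sa , da = Two⁻ (is-two va)
                  b , ab , Sb , v≢b = another-neighbour core Sa (proj₁ some)
              in b , ab , v≢b , Sb ,
                 full⇒inside S (≰⇒> (noPair Sa Sb ab da)) }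
          where
          is-two : ∀ {a} → Adj (proj₁ some) a → T (Two a)
          is-two = full⇒inside Two (tight-neighbours noPair five (proj₂ some))

  pathWidth> : ∀ a w → 0 < a → a ≤ order G →
    (∀ S → a ≤ count S → count S ≤ a + 3 → inner S + w < 3 * count S) →
    ∀ D → w < width {G} D
  pathWidth> a w 0<a a≤n blocked D = ≰⇒> λ width≤w →
    let S , a≤ , ≤a+3 , cut = sparse-cut D width≤w a 0<a a≤n
    in <⇒≱ (blocked S a≤ ≤a+3) cut

  sparse-blocks : ∀ {c m w} → Sparse c m → ∀ S → count S ≤ m → c + w < count S → inner S + w < 3 * count S
  sparse-blocks {c} {m} {w} sparse S ≤m c+w< = begin-strict
    inner S + w              ≤⟨ +-monoˡ-≤ w (sparse S ≤m) ⟩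
    2 * count S + c + w      ≡⟨ +-assoc (2 * count S) c w ⟩
    2 * count S + (c + w)    <⟨ +-monoʳ-< (2 * count S) c+w< ⟩
    2 * count S + count S    ≡⟨ three (count S) ⟩
    3 * count S              ∎
    where
    open ≤-Reasoning
    three : ∀ m → 2 * m + m ≡ 3 * m
    three = solve-∀

  forest-blocks : ∀ {w} S → inner S < 2 * count S → w ≤ count S → inner S + w < 3 * count S
  forest-blocks {w} S acyclic w≤ = begin-strict
    inner S + w              <⟨ +-monoˡ-< w acyclic ⟩
    2 * count S + w          ≤⟨ +-monoʳ-≤ (2 * count S) w≤ ⟩
    2 * count S + count S    ≡⟨ three (count S) ⟩
    3 * count S              ∎
    where
    open ≤-Reasoning
    three : ∀ m → 2 * m + m ≡ 3 * m
    three = solve-∀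


-- Search for cores in a given graph.

-- Evaluates faster than does (x ≟ y).
_==_ : ∀ {n} → Fin n → Fin n → Bool
zero  == zero  = true
zero  == suc _ = false
suc _ == zero  = false
suc x == suc y = x == y

==⇒≡ : ∀ {n} (x y : Fin n) → T (x == y) → x ≡ y
==⇒≡ zero    zero    _ = refl
==⇒≡ (suc x) (suc y) t = cong suc (==⇒≡ x y t)

==-refl : ∀ {n} (x : Fin n) → T (x == x)
==-refl zero    = _
==-refl (suc x) = ==-refl x

contains : ∀ {n} → List (Fin n) → Fin n → Bool
contains xs x = any (x ==_) xs

contains⁻ : ∀ {n} (xs : List (Fin n)) {x} → T (contains xs x) → x ∈ xs
contains⁻ xs {x} t = Any.map (λ {y} → ==⇒≡ x y) (Any.any⁻ _ xs t)

contains⁺ : ∀ {n} {xs : List (Fin n)} {x} → x ∈ xs → T (contains xs x)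
contains⁺ {x = x} x∈ = Any.any⁺ _ (Any.map (λ { refl → ==-refl x }) x∈)

insert : ∀ {n} → Fin n → List (Fin n) → List (Fin n)
insert x xs = if contains xs x then xs else x ∷ xs

insert-all : ∀ {n} {P : Fin n → Set} {x xs} → P x → All P xs → All P (insert x xs)
insert-all {x = x} {xs} px pxs with contains xs x
... | true  = pxs
... | false = px ∷ pxs

insert-unique : ∀ {n} (x : Fin n) {xs} → Unique xs → Unique (insert x xs)
insert-unique x {xs} u with contains xs x in eq
... | true  = u
... | false = All.¬Any⇒All¬ xs (λ x∈ → subst T eq (contains⁺ x∈)) ∷ u

-- The table lists the neighbours of every vertex. It is a parameter so that evaluation
-- computes it only once.
module CoreSearch {n} (table : Vec (List (Fin n)) n) where

  ns : Fin n → List (Fin n)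
  ns = Vec.lookup table

  deficient : List (Fin n) → List (Fin n) → Maybe (Fin n)
  deficient C []       = nothing
  deficient C (x ∷ xs) =
    if length (filterᵇ (contains C) (ns x)) <ᵇ 2 then just x else deficient C xs

  -- Do all cores with at most m vertices that are obtained by enlarging C pass the test?
  cores : (fuel m : ℕ) → (List (Fin n) → Bool) → List (Fin n) → Bool
  grow  : (fuel m : ℕ) → (List (Fin n) → Bool) → List (Fin n) → Maybe (Fin n) → Bool
  -- Running out of fuel counts as failure, which is the safe answer.
  cores zero    m test C = false
  cores (suc f) m test C = (m <ᵇ length C) ∨ grow f m test C (deficient C C)
  grow f m test C nothing  = test C
  grow f m test C (just x) =
    -- A core around `C` needs a further neighbour of the deficient vertex `x`; with `m` vertices
    -- already chosen there is no room for it.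
    (m ≤ᵇ length C) ∨ all (λ y → contains C y ∨ cores f m test (y ∷ C)) (ns x)

  noCores : ℕ → List (Fin n) → Bool
  noCores m = cores (suc m) m (λ _ → false)

  -- If this holds, no core arises from `C` by adding two adjacent vertices, as each of them would
  -- need a neighbour in `C`.
  noBridge : List (Fin n) → Bool
  noBridge C = all (λ c → all (λ x → contains C x ∨
    all (λ y → contains C y ∨ all (not ∘ contains C) (ns y)) (ns x)) (ns c)) C

  -- It is applied to cores inside a set of `suc m` vertices: the bound on the length makes such a
  -- core the whole set and rejects all smaller ones.
  bridgeless : ℕ → List (Fin n) → Bool
  bridgeless m C = (m <ᵇ length C) ∧ noBridge C

  -- Puts into `C` what `TightAt` forces: beyond every neighbour `a` of `v` some `b` with all its
  -- neighbours. These sets may overlap, whence `insert`.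
  noTight : ℕ → Fin n → List (Fin n) → List (Fin n) → Bool
  noTight m v []       C = noCores m C
  noTight m v (a ∷ as) C =
    all (λ b → (v == b) ∨ noTight m v as (insert b (foldr insert C (ns b)))) (ns a)

∖-self : ∀ {n} (p : Fin n → Bool) x → ¬ T ((p ∖ x) x)
∖-self p x t with x Fin.≟ x | proj₂ (T∧⁻ {p x} t)
... | no x≢x | _ = x≢x refl

∖⁺ : ∀ {n} (p : Fin n → Bool) {x z} → T (p z) → x ≢ z → T ((p ∖ x) z)
∖⁺ p {x} {z} pz x≢z with x Fin.≟ z
... | yes x≡z = contradiction x≡z x≢z
... | no _    = T∧⁺ pz _

module Concrete (G : Graph) (cubic : Cubic G)
  (table : Vec (List (Vertex G)) (order G))
  (table-correct : ∀ v → Vec.lookup table v ≡ members (Graph.adj G v)) where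

  open Graph G using (adj; Adj; adj-sym)
  open Walks G
  open Density G cubic
  open Sparsity G cubic
  open CoreSearch table

  ns⁺ : ∀ {x y} → Adj x y → y ∈ ns x
  ns⁺ {x} {y} xy = subst (y ∈_) (sym (table-correct x)) (∈-members⁺ (adj x) xy)

  ns⁻ : ∀ {x y} → y ∈ ns x → Adj x y
  ns⁻ {x} {y} y∈ = ∈-members⁻ (adj x) (subst (y ∈_) (table-correct x) y∈)

  ns-unique : ∀ x → Unique (x ∷ ns x)
  ns-unique x = All.¬Any⇒All¬ _ (λ x∈ → Adj⇒≢ (ns⁻ x∈) refl) ∷
    subst Unique (sym (table-correct x)) (members-unique (adj x))

  all-ns : ∀ (p : Vertex G → Bool) {x} → T (all p (ns x)) → ∀ {y} → Adj x y → T (p y)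
  all-ns p {x} t xy = All.lookup (All.all⁺ p (ns x) t) (ns⁺ xy)

  missing-neighbour : ∀ {S} → Core S → ∀ C {x} → T (S x) →
    length (filterᵇ (contains C) (ns x)) < 2 → ∃[ y ] Adj x y × T (S y) × ¬ T (contains C y)
  missing-neighbour {S} core C {x} Sx few
    with Fin.any? (λ y → T? (adj x y ∧ (S y ∧ not (contains C y))))
  ... | yes (y , t) = let xy , t′ = T∧⁻ {adj x y} t ; Sy , y∉ = T∧⁻ {S y} t′ in y , xy , Sy , Tnot⁻ y∉
  ... | no none = contradiction (core Sx) (<⇒≱ (≤-trans (s≤s (count≤length {p = λ y → adj x y ∧ S y} inside-C)) few))
    where
    inside-C : ∀ y → T (adj x y ∧ S y) → y ∈ filterᵇ (contains C) (ns x)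
    inside-C y t with xy , Sy ← T∧⁻ {adj x y} t with contains C y in y∈
    ... | true  = ∈-filter⁺ (T? ∘ contains C) (ns⁺ xy) (≡⇒T y∈)
    ... | false = contradiction (T∧⁺ xy (T∧⁺ Sy (subst (T ∘ not) (sym y∈) _))) (none ∘ (y ,_))

  deficient⁻ : ∀ C xs {x} → deficient C xs ≡ just x →
               x ∈ xs × length (filterᵇ (contains C) (ns x)) < 2
  deficient⁻ C (z ∷ xs) eq with length (filterᵇ (contains C) (ns z)) <ᵇ 2 in few | eq
  ... | true  | refl = here refl , <ᵇ⇒< _ 2 (≡⇒T few)
  ... | false | eq′  = let x∈ , few′ = deficient⁻ C xs eq′ in there x∈ , few′

  module _ {S : VertexSet} (core : Core S) {m : ℕ} (size : count S ≤ m) where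

    -- Follows the branch of the search that stays inside `S`: at a deficient vertex of `C` the core
    -- `S` has a neighbour that is not yet in `C`.
    cores-sound : ∀ f test C → Unique C → All (T ∘ S) C → T (cores f m test C) →
                  ∃[ K ] Unique K × All (T ∘ S) K × T (test K)
    cores-sound (suc f) test C uC SC t with T∨⁻ {m <ᵇ length C} t
    ... | inj₁ large = contradiction (≤-trans (length≤count uC SC) size) (<⇒≱ (<ᵇ⇒< _ _ large))
    ... | inj₂ t′ with deficient C C in eq
    ...   | nothing = C , uC , SC , t′
    ...   | just x
            with x∈ , few ← deficient⁻ C C eq
            with y , xy , Sy , y∉ ← missing-neighbour core C (All.lookup SC x∈) few
            with u′ ← All.¬Any⇒All¬ C (y∉ ∘ contains⁺) ∷ uC
            with T∨⁻ {m ≤ᵇ length C} t′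
    ...     | inj₁ full = contradiction (≤-trans (length≤count u′ (Sy ∷ SC)) size) (≤⇒≯ (≤ᵇ⇒≤ _ _ full))
    ...     | inj₂ t″ with T∨⁻ {contains C y} (all-ns _ t″ xy)
    ...       | inj₁ y∈ = contradiction y∈ y∉
    ...       | inj₂ t‴ = cores-sound f test (y ∷ C) u′ (Sy ∷ SC) t‴

    noCores-sound : ∀ C → Unique C → All (T ∘ S) C → ¬ T (noCores m C)
    noCores-sound C uC SC t = proj₂ (proj₂ (proj₂ (cores-sound (suc m) (λ _ → false) C uC SC t)))

  star-inside : ∀ {S v} → T (S v) → 3 ≤ deg S v → All (T ∘ S) (v ∷ ns v)
  star-inside {S} Sv full = Sv ∷ All.tabulate (full⇒inside S full ∘ ns⁻)

  -- A core that is too dense has a vertex of inner degree 3 and so contains a whole star; hence the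
  -- search starts from the stars.
  sparse-by-search : ∀ m → (∀ v → T (noCores m (v ∷ ns v))) → Sparse 0 m
  sparse-by-search m ok = sparse-by-cores λ S core ≤m → ≮⇒≥ λ dense →
    let v , Sv , full = full-vertex S (subst (_< inner S) (+-identityʳ _) dense)
    in noCores-sound core ≤m (v ∷ ns v) (ns-unique v) (star-inside Sv full) (ok v)

  noTight-sound : ∀ m → (∀ v → T (noTight m v (ns v) (v ∷ ns v))) → ∀ S v → ¬ TightAt m S v
  noTight-sound m ok S v at =
    go (ns v) (v ∷ ns v) ns⁻ (ns-unique v) (centre ∷ All.tabulate (around ∘ ns⁻)) (ok v)
    where
    open TightAt at
    insert-all-unique : ∀ xs {C} → Unique C → Unique (foldr insert C xs)
    insert-all-unique []       u = u
    insert-all-unique (x ∷ xs) u = insert-unique x (insert-all-unique xs u)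

    insert-all-inside : ∀ {xs C} → All (T ∘ S) xs → All (T ∘ S) C → All (T ∘ S) (foldr insert C xs)
    insert-all-inside []         SC = SC
    insert-all-inside (Sx ∷ Sxs) SC = insert-all Sx (insert-all-inside Sxs SC)

    go : ∀ as C → (∀ {a} → a ∈ as → Adj v a) → Unique C → All (T ∘ S) C → ¬ T (noTight m v as C)
    go []       C _   uC SC t = noCores-sound core size C uC SC t
    go (a ∷ as) C adj uC SC t
      with b , ab , v≢b , Sb , Sbs ← beyond (adj (here refl))
      with T∨⁻ {v == b} (all-ns _ t ab)
    ... | inj₂ t′ = go as _ (adj ∘ there) (insert-unique b (insert-all-unique (ns b) uC))
                       (insert-all Sb (insert-all-inside (All.tabulate (Sbs ∘ ns⁻)) SC)) t′
    ... | inj₁ v≡b = v≢b (==⇒≡ v b v≡b)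

  noBridge-sound : ∀ C → T (noBridge C) → ∀ {c x y q} → c ∈ C → Adj c x → x ∉ C → Adj x y → y ∉ C →
                   Adj y q → q ∉ C
  noBridge-sound C t c∈ cx x∉ xy y∉ yq q∈
    with T∨⁻ (all-ns _ (All.lookup (All.all⁺ _ C t) c∈) cx)
  ... | inj₁ x∈ = x∉ (contains⁻ C x∈)
  ... | inj₂ t′ with T∨⁻ (all-ns _ t′ xy)
  ...   | inj₁ y∈ = y∉ (contains⁻ C y∈)
  ...   | inj₂ t″ = Tnot⁻ (all-ns _ t″ yq) (contains⁺ q∈)

  bridgeless-core : ∀ m → (∀ v → T (cores (2 + m) (suc m) (bridgeless m) (v ∷ ns v))) →
    ∀ R → Core R → count R ≡ suc m → 2 * count R < inner R →
    ∃[ C ] Unique C × All (T ∘ R) C × T (bridgeless m C)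
  bridgeless-core m ok R core size dense
    with v , Rv , full ← full-vertex R dense =
    cores-sound core (≤-reflexive size) (2 + m) (bridgeless m) (v ∷ ns v) (ns-unique v)
      (star-inside Rv full) (ok v)

  -- `C` has more than `m` vertices in a set of `suc m` and therefore exhausts it. The core `S`
  -- gives `x` and `y` further neighbours `p` and `q`, and the walk `p, x, y, q` is a bridge between
  -- vertices of `C`.
  no-bridge : ∀ {m S x y} → Core S → T (S x) → T (S y) → Adj x y → count ((S ∖ x) ∖ y) ≡ suc m →
              ∀ C → Unique C → All (T ∘ ((S ∖ x) ∖ y)) C → ¬ T (bridgeless m C)
  no-bridge {m} {S} {x} {y} core Sx Sy xy size C uC RC test
    with m<C , t ← T∧⁻ {m <ᵇ length C} test
    with p , xp , Sp , y≢p ← another-neighbour core Sx y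
    with q , yq , Sq , x≢q ← another-neighbour core Sy x =
    noBridge-sound C t (R⊆C (in-R Sp (Adj⇒≢ xp) y≢p)) (Adj-sym xp) x∉C xy y∉C yq
      (R⊆C (in-R Sq x≢q (Adj⇒≢ yq)))
    where
    R⊆C : ∀ {z} → T (((S ∖ x) ∖ y) z) → z ∈ C
    R⊆C {z} Rz with Any.any? (z Fin.≟_) C
    ... | yes z∈ = z∈
    ... | no  z∉ = contradiction (length≤count (All.¬Any⇒All¬ C z∉ ∷ uC) (Rz ∷ RC))
      (<⇒≱ (s≤s (≤-trans (≤-reflexive size) (<ᵇ⇒< m _ m<C))))

    x∉C : x ∉ C
    x∉C x∈ = ∖-self S x (proj₁ (T∧⁻ {(S ∖ x) x} (All.lookup RC x∈)))

    y∉C : y ∉ C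
    y∉C y∈ = ∖-self (S ∖ x) y (All.lookup RC y∈)

    in-R : ∀ {z} → T (S z) → x ≢ z → y ≢ z → T (((S ∖ x) ∖ y) z)
    in-R Sz x≢z y≢z = ∖⁺ (S ∖ x) (∖⁺ S Sz x≢z) y≢z

  -- The inequality for `R` is the loss of at most 6. `R` is a core because deleting a vertex of
  -- degree at most 1 would leave `m` vertices that are still too dense.
  pair-removed : ∀ {m} → Sparse 0 m → ∀ S → count S ≡ 3 + m → 2 * count S + 2 < inner S →
    ∀ {x y} → T (S x) → T (S y) → Adj x y → deg S x ≤ 2 → deg S y ≤ 2 →
    let R = (S ∖ x) ∖ y in count R ≡ suc m × 2 * count R < inner R × Core R
  pair-removed {m} sparse S size dense {x} {y} Sx Sy xy dx dy = R-size , R-dense , R-core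
    where
    R : VertexSet
    R = (S ∖ x) ∖ y

    removed : count S ≡ suc (suc (count R)) × inner S ≤ inner R + 6
    removed = remove-pair S Sx Sy xy dx dy

    R-size : count R ≡ suc m
    R-size = suc-injective (suc-injective (trans (sym (proj₁ removed)) size))

    R-dense : 2 * count R < inner R
    R-dense = +-cancelʳ-< 6 _ _ (begin-strict
      2 * count R + 6                ≡⟨ rearrange (count R) ⟩
      2 * suc (suc (count R)) + 2    ≡⟨ cong (λ n → 2 * n + 2) (proj₁ removed) ⟨
      2 * count S + 2                <⟨ dense ⟩
      inner S                        ≤⟨ proj₂ removed ⟩
      inner R + 6                    ∎)
      where
      open ≤-Reasoning
      rearrange : ∀ n → 2 * n + 6 ≡ 2 * suc (suc n) + 2
      rearrange = solve-∀

    R-core : Core R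
    R-core {z} Rz = ≰⇒> λ few → <⇒≱ R-dense (+-cancelʳ-≤ 2 _ _
      (inner-remove R Rz few (sparse (R ∖ z)
        (≤-reflexive (suc-injective (trans (sym (count-∖ R Rz)) R-size))))))

  bridgeless⇒noPair : ∀ m → Sparse 0 m →
    (∀ v → T (cores (2 + m) (suc m) (bridgeless m) (v ∷ ns v))) →
    ∀ S → Core S → count S ≡ 3 + m → 2 * count S + 2 < inner S → NoPair S
  bridgeless⇒noPair m sparse ok S core size dense {x} {y} Sx Sy xy dx dy
    with R-size , R-dense , R-core ← pair-removed sparse S size dense Sx Sy xy dx dy
    with C , uC , RC , test ← bridgeless-core m ok ((S ∖ x) ∖ y) R-core R-size R-dense =
    no-bridge core Sx Sy xy R-size C uC RC test

  -- If two adjacent vertices of degree 2 are removed from a core on 3 + m vertices that is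
  -- too dense, then a core on 1 + m vertices remains, and they form a bridge between two of
  -- its vertices.
  sparse-bridge : ∀ m → 17 ≤ 2 * m → 5 ≤ m → 7 < m → Sparse 0 m →
    (∀ v → T (cores (2 + m) (suc m) (bridgeless m) (v ∷ ns v))) → Sparse 2 (3 + m)
  sparse-bridge m 17≤2m 5≤m 7<m sparse ok = sparse-by-cores bound
    where
    sparse₂ : Sparse 2 (2 + m)
    sparse₂ = sparse-2+ 17≤2m 5≤m sparse

    bound : ∀ S → Core S → count S ≤ 3 + m → inner S ≤ 2 * count S + 2
    bound S core ≤3+m with count S ≤? 2 + m
    ... | yes ≤2+m = sparse₂ S ≤2+m
    -- Without pairs, `2 * count S ≤ 5 * count Three` with at most 4 vertices of degree 3, whereas
    -- `7 < m` gives `S` more than 10 vertices.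
    ... | no  ≰2+m = ≮⇒≥ λ dense → <-irrefl refl (begin-strict
      20                 ≡⟨⟩
      2 * 10             <⟨ *-monoʳ-< 2 {10} {count S} (≤-trans (+-monoʳ-≤ 3 7<m) (≤-reflexive (sym count≡))) ⟩
      2 * count S        ≤⟨ 2count≤5Three (bridgeless⇒noPair m sparse ok S core count≡ dense) ⟩
      5 * count Three    ≤⟨ *-monoʳ-≤ 5 three≤4 ⟩
      20                 ∎)
      where
      open ≤-Reasoning
      open Degrees S core
      count≡ : count S ≡ 3 + m
      count≡ = ≤-antisym ≤3+m (≰⇒> ≰2+m)

      three≤4 : count Three ≤ 4
      three≤4 = +-cancelˡ-≤ (2 * count S) _ _ (≤-trans (≤-reflexive (sym excess))
        (sparse-suc (≤-trans (m≤m+n 6 2) (≤-trans 7<m (m≤n+m m 2))) sparse₂ S ≤3+m))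


-- Certificates are written in prefix notation, in base 62 with the digits 0–9, A–Z, a–z. An
-- image starts with 0 if σ is a transposition and with 1 if σ is listed, a leaf with 2, and a
-- branch at v with 3 + v.
digit : Char → ℕ
digit c = if 97 ≤ᵇ n then n ∸ 61 else if 65 ≤ᵇ n then n ∸ 55 else n ∸ 48
  where n = Char.toℕ c

swap : ℕ → ℕ → ℕ → ℕ
swap a b x = if x ≡ᵇ a then b else if x ≡ᵇ b then a else x

images : List ℕ → ℕ → ℕ
images xs i = fromMaybe 0 (lookupᵐ xs i)

-- Malformed input yields some arbitrary certificate; whether a certificate is accepted rests with
-- `check` alone. The index of an image takes two digits.
parse  : (fuel : ℕ) → List ℕ → Certificate × List ℕ
parses : (fuel count : ℕ) → List ℕ → List Certificate × List ℕ
parse (suc f) (0 ∷ i ∷ j ∷ a ∷ b ∷ ds) = image (i * 62 + j) (swap a b) , ds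
parse (suc f) (1 ∷ i ∷ j ∷ k ∷ ds)     = image (i * 62 + j) (images (take k ds)) , drop k ds
parse (suc f) (2 ∷ t ∷ k ∷ ds)         =
  let cs , rest = parses f (fromMaybe 0 (lookupᵐ ds k)) (drop (suc k) ds)
  in leaf t (images (take k ds)) cs , rest
parse (suc f) (suc (suc (suc v)) ∷ k ∷ ds) =
  let cs , rest = parses f k ds in branch v cs , rest
parse _ ds = branch 0 [] , ds
parses (suc f) (suc k) ds =
  let c , rest = parse f ds ; cs , rest′ = parses f k rest in c ∷ cs , rest′
parses _ _ ds = [] , ds

decode : List String → Certificate
decode lines = let ds = concatMap (λ l → map digit (String.toList l)) lines
               in proj₁ (parse (length ds) ds)

cubicᵇ : Graph → Bool
cubicᵇ G = all (λ v → Graph.degree G v ≡ᵇ 3) (allFin _)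

cubicᵇ⇒Cubic : ∀ G → cubicᵇ G ≡ true → Cubic G
cubicᵇ⇒Cubic G ok v =
  ≡ᵇ⇒≡ _ 3 (All.lookup (All.all⁺ _ (allFin (order G)) (≡⇒T ok)) (∈-allFin v))

-- Together with the Heawood and the Pappus graph, this graph and the next four exhaust the cubic
-- graphs of girth at least 6 on at most 18 vertices. They compete with the Pappus graph for `k = 7`
-- and lose by having path-width at most 6.
möbiusKantor : Graph
möbiusKantor = hamiltonian 16
  ( (1 , 6) ∷ (2 , 13) ∷ (3 , 8) ∷ (4 , 15) ∷ (5 , 10) ∷ (7 , 12) ∷ (9 , 14) ∷ (11 , 16) ∷ [])

girthSix₁ : Graph
girthSix₁ = hamiltonian 18
  ( (1 , 10) ∷ (2 , 7) ∷ (3 , 15) ∷ (4 , 9) ∷ (5 , 17) ∷ (6 , 12) ∷ (8 , 14) ∷ (11 , 16) ∷ (13 , 18) ∷ [])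

girthSix₂ : Graph
girthSix₂ = hamiltonian 18
  ( (1 , 8) ∷ (2 , 12) ∷ (3 , 15) ∷ (4 , 10) ∷ (5 , 18) ∷ (6 , 13) ∷ (7 , 16) ∷ (9 , 14) ∷ (11 , 17) ∷ [])

girthSix₃ : Graph
girthSix₃ = hamiltonian 18
  ( (1 , 10) ∷ (2 , 7) ∷ (3 , 14) ∷ (4 , 9) ∷ (5 , 12) ∷ (6 , 17) ∷ (8 , 15) ∷ (11 , 16) ∷ (13 , 18) ∷ [])

girthSix₄ : Graph
girthSix₄ = hamiltonian 18
  ( (1 , 10) ∷ (2 , 7) ∷ (3 , 14) ∷ (4 , 9) ∷ (5 , 12) ∷ (6 , 15) ∷ (8 , 17) ∷ (11 , 16) ∷ (13 , 18) ∷ [])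

certificate₄ : Certificate
certificate₄ = decode (
  "3131314141535373729162A081228037514620000677291103801234567921058021367451068140567230006772" ∷
  "63628191218015742630819122801562473010080213465762819122801562473091812280265147306382819081" ∷
  "9082919091A010070213465000455210270123456721047104523662107701324562060451231919000045" ∷
  [])

certificate₅ : Certificate
certificate₅ = decode (
  "313131414151516161747291B1A18120A0146235897000089000677291B1A18120A014623589700006700089" ∷
  [])

certificate₆ : Certificate
certificate₆ = decode (
  "313131414151516161717181819595A5A5D6D4H2B3F3C3E3J1I0I1I0000GHJ1K1I1I0000GHG2I1J2K1C0C1C0K1J1" ∷
  "C1E123I014AEC5D839G7HBF620000GHJ1G1F2I1C2K0E124I014A8G726EC5DFBH930I2101I0213765489GHFEDCAB1" ∷
  "02I1504CD23ABEHFG6789000GH000CD000EFJ2103I0123457689ABCDGHEF000CD000GH00089D4H2109I012345678" ∷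
  "9ABCDEFGH000CD00089H410DI0213674589EFGHABCD00089F3B210UI0123546789CDABEFGHK1E110LI0123546789" ∷
  "CDABEFHG00089J3B2G1I1C2C124I015D8G726FB4AECH930C124I015D8G726FB4AECH930G2G0G000089G3B2C2I0C1" ∷
  "E0I1C1C000089I3112I1504CD23ABEHFG678900089B2C1B0C1B0000CD000GH000EF101I0123457689ABCDGHEF000" ∷
  "GHD3E4E2H2B2F3C2J0J1I1I0J1C1G1I123IC514AHD8BE6F93027G0K1J1I1I0J1G1F2C1I124I2038GDF6EB415C9HA" ∷
  "70I1C124I1038BEC5DG726F9HA40000CD000EF00089E2H2105I0123456789ABCDEFGH000CD00089000EFB5E3E2C3" ∷
  "F2J1J0J0000CDJ2F2I1G1G0G2G0G0000CD000EFE1102I0123456789ABCDEFGH000EFF3E4E3C2H1I1I0H2G0I1I000" ∷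
  "0EFK3H0000EFJ0E2106I0123456789ABCDEFGHK1J1H1I1G0000EFE3109I0123456789ABCDEFGHK1J1H1I1G0000EF" ∷
  "H2E3E2I1G1C1J123I2014B938A7GHEC5DF60K1J1C1G123I51039B4A8CEHG726FD0E1I1G1C1J123I2014B938A7GHE" ∷
  "C5DF60E1K1J1C1G123I51039B4A8CEHG726FD0E2I2I1C2G1J0G1J0I1101I0123456789ABCDEFGHI2I113JI206731" ∷
  "EFAG8954CBDHI113LI206731EFAG8954CBDH000EF000CD101H0213765489AGEFCDB000EF00089000AB101H012354" ∷
  "6789CDABEFG000CDA3104H0123456789ABCDEFGD3F3E5E3B2H1K1C1G1I124I26FGA41039HEB8D5C70H1K1I1G1C12" ∷
  "4I038B4A726ED9GFHC510000EFK2B2G2I1H1C0C2C0C0H2C2G1I125I014AGD5C726F8BHE930I1G123ID514BHC7AG9" ∷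
  "E62038F0I1C1C0000EF00089E310OI0123456789ABCDEFGH00089K2B2H2C2G1I123IB415DGA7CH8F62039E0I1G12" ∷
  "3I014AGD5C726F8HBE930I1C1C0H2C1G0C2C0C000089000EFE4K210SI0123456789ABCDEFGH000EF00089K2108I0" ∷
  "123456789ABCDEFGH00089000EFB4E4E2C1H1K1I1I0000EFE2C1H1K1I1I0K0000EFE2K0000EFE3K3K2G2H1I1I0H1" ∷
  "C0000EFK1102I0123456789ABCDEFGH000EFH2I3C2I1J0I1G0G2I1J0I1C0105I7C2A85604G3B1DEF9HG3I2I1C1J0" ∷
  "I1C1J0C2I2I1J0I1J0I2K1I0I1K0100H7C2A85604G3B1DEF9000EFH3E3C2E2I0K0E1K1G1I126I014AGD5C726F9BH" ∷
  "E830E1C1I0E1K1C1G1I126I014AGD5C726F9BHE830E112qI104523BACD7689EHGFJ2E2E1I1C1G0E1I1C1G0G2C3C2" ∷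
  "E1I0E1I0C2E1I0I1E0C2E1I0I1E0C3E2E1I0E1I0E2I1I0I1K0100H0312984576DFCEABG000EF00089F2102H01235" ∷
  "46789CDABEFGB4C4E3E1K0000EFE2K0000EFE3G4G2I1H0I1H0000EFG3I1H0000EFJ2H0000EFG3I1H0000EFJ2H000" ∷
  "0EFH3I2K1I0K1I0G2I1I0I1I0100H0321986754CBAGEFD000EFH2E2E0E0E1123I104532BACD8976EHGF000EFG3C4" ∷
  "10MI0123546798CDABEFHGE4H2I1H0I1H0H2I1I0I1I0000EFH2I1H0I1H0H3I2K1I0K1I0E2I1I0I1I0I2K1I0E1I00" ∷
  "00EFH2I3I2J1J0J1E010rH5CD179E840A23F6GBE2I1J1J0J1I0E2I2I1J1J0J1J0I1J1I0000EFH2C3115I01235467" ∷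
  "98CDABEFHGE310eI0123546798CDABEFHG10aH3980BCEA124F756GD10WH0123546798CDABEFGG2G1J1E0G1J1E0G1" ∷
  "15XH8AE374D6092C1B5GF000EF00089000CD000AB101G0123546789CDABEF000CDD3A4A417DI0123457689ABCDGH" ∷
  "EF12HH0213675489AEBGCDFE4E3B4H3C2H1G1I1J125I2015D938C7GFA4BHE60H2I1I0J1I1G126I014BHD5C839E6A" ∷
  "FG720G2H1K1C1I123I93014B8C5DEHG726AF0H1I1I0H2C2G1I1J125I2015D938C7GFA4BHE60J1I1G126I014BHD5C" ∷
  "839E6AFG720G1K1C1I123I93014B8C5DEHG726AF0G2H0I1108I1405AB23DC6F8H7E9GH1G0J1I1F2C1G1H125I1027" ∷
  "G839C5DFA6EHB40G1C1H121I039E627G8BHC5DFA41000089J218MI104523BACD6789GHFE00089E2105I012345678" ∷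
  "9ABCDEFGHJ1B2F2C2G1H1I0G1H1I0G1H1I1C124I026A4B839FC7GHED510H1G118hI41BA05G86F32CD7HE900089E3" ∷
  "J218lI104523BACD6789GHFE00089J1106I0123456789ABCDEFGH00089000CDA313mH0213675489AEBGCDFE313pH" ∷
  "1405AB32CD6F7G89EB3F3C4C2G1H1I1J125I3014A627B8GFD5CHE90G1H1I1J123I62015C7B4AFHG839DE0100I021" ∷
  "3765489CBAEDHGFC2G1H1I1J123I62015C7B4AFHG839DE0I1G1J1H123I3014A627B8GEHC5DF90100I0213765489C" ∷
  "BAEDHGFC313TI0321986754CHBGAEDFH1I2I1G1J0I1G1J0I115fI309812FCBG5476AHDE100H41BA05876F32CDG9E" ∷
  "F3102H104523ABCD6789FEGC312YH0321896745BDCGAEFH1I2I1J1J0J1J0I112sH309821FCBD7654AGEG212cHB84" ∷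
  "73DA12C095G6FEH115mH51DC04E87F32BA6G9H2J3J210NI2670EACB31G84F5H9D16RI62EA07G84F31BCDH95J110Q" ∷
  "I2670EACB31G84F5H9DJ116VI62EA07G84F31BCDH95G115wH62EA07D84F31BC5G900089000CDA211EH0123456789" ∷
  "ABCDEFG103G0123456789ABCDEF000CDB3E3E317AI104523BACD6789GHEF156H4A1B86507G3F2ECD9157H4A1B685" ∷
  "09G2E3FCD7E2159H4A1B86507G3F2ECD9131G4A1B6850792E3FCD100G0132458967ABCDFEF2A4A419JI012345768" ∷
  "9ABCDGHEFE315xI0213765489BGAECDHF13CH0213675489AEBGCDF15KH0213765489BGAECDFG212NI0123547689D" ∷
  "CABGHEFC315rI5D1C79408F2G3HAB6EE210yI1504DC23BA798F6GHE10lH1504DC23BA798F6GE15SH5D1C79408F2G" ∷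
  "3EAB618sH0123457689ABCDFGEA310AH0123456789ABCDEFGG2104H105432CDAB8967FEGC215ZH8A3C64905F2E1B" ∷
  "DG7E215bHA846C3B12E5F097GDH215eHA468B1E23C7F059GD22G014A627BFE9D5C831J1J0I1197H8AC346F5091B2" ∷
  "E7GDA210HH0123456789ABCDEFG104G0123456789ABCDEFA219CH0123457689ABCDFGEI119EH8AC346F5091B2E7G" ∷
  "DA2E3E317QI104523BACD6789GHEF10zH1405AB23CD689G7EF16vH104523BACD6789FGEE2112H1405AB23CD689G7" ∷
  "EFI116zH207613FCAE5489BGDE2171H104523BACD6789FGEI1173H207613FCAE5489BGDE2C4C415YI0132459867A" ∷
  "BCDGHEF14fH0231679845AECBDGF14gH0132549876CDABEGF15PH0132459867ABCDFGEC314jH0231679845AECBDG" ∷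
  "FG214lH1450BADC237F869GEH1J1J0G214vH1450BADC237F869GEH1J1J0100G0213765489CBAEDFC315eH0132459" ∷
  "867ABCDFGE103G0123456789ABCDEF104G0213765489CBAEDFC3G3G315TI105432DCAB8976GHEF15PH105423DCBA" ∷
  "7689EGF15QH105432DCAB8976FGEG215SH105423DCBA7689EGFH1J1I0100G0132459876BACDFEG2H2H2J1I0J1I0H" ∷
  "1J1I0H1I1J1I0100F0312895476CABED000CD00089000AB101F0123546789CDABE000CD93104F0123456789ABCDE" ∷
  "D3107F104523ABCD6789EB210AF0132458967ABCDEF210CF105423CDAB6789EC210EF0132549867CDABEE210GF10" ∷
  "4532BACD9867EA210JF0123457698BACDE20E014B7D5C938A621H1H1I1H000089000CD000AB101E0123546789CDA" ∷
  "B000CD" ∷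
  [])

certificate₇ : Certificate
certificate₇ = decode (
  "313131414151516161717181819191A1A1B1B1C1C1D9D9E8E4H2L2J2F1N0000CD000GH000KL000IJH2L2F2N1K000" ∷
  "0GH000CD000IJ000KL000EF101O0123457689ABCDGHEFIJKLMN000GH103O0132458967ABCDIJKLEFGHMN000IJ105" ∷
  "O0132459867ABCDKLIJEFGHMN000KLH5E6E4L1I2F2J1N1O1P1K1M1G120O3027HMA415DJ8IBGLNE6FCK90000KL000" ∷
  "CD000IJN1I2F2J1L1M1P1K1O1G120O3027HMA415DL9KBGJNE6FCI80000IJ000CD000KL000GHE2L1I2F2J1N1O1P1K" ∷
  "1M1G120O3027HMA415DJ8IBGLNE6FCK90000KL000CD000GH000IJE2N1I2F2J1L1M1P1K1O1G120O3027HMA415DL9K" ∷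
  "BGJNE6FCI80000IJ000CD000GH000KLL3I4I2F1N1E2J1M1K1P1O1G120O2038IND514AE6FCJHML9KBG70000GH000K" ∷
  "L000CDI2F1N1E2J1M1K1P1O1G120O2038IND514AE6FCJHML9KBG70000GH000CD000KLF3I3G2I0000KLI1G0000KLJ" ∷
  "3M2M1E0M1E0N3G2G1I0G1I0E1G2G1I1O1P1K1M120O1039LMH726FD5CGKBNJ8IEA40G1I1O1P1K1M120O1039LMH726" ∷
  "FD5CGKBNJ8IEA40P1I2I1G1O1E1K1M120O015CGKMA4BH726EI8JNDFL930I1G1O1E1K1M120O015CGKMA4BH726EI8J" ∷
  "NDFL930000KL000GH000CD000IJ101N0123456798ABCDEFGHKLIJM000KL000EF101N0123457689ABCDGHEFIJKLM0" ∷
  "00GH103N0132458967ABCDIJKLEFGHM000IJ105N0132459867ABCDKLIJEFGHM000KLD5108N0123456789ABCDEFGH" ∷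
  "IJKLMH310DN0213674589EFGHABCDIJKLML310GN0312894567IJKLABCDEFGHMJ310JN0231768945GHEFIJKLABCDM" ∷
  "F210MN0123547689CDABGHEFIJKLMN1O110fO0312985476LKIJCDABGHEFNM000CD000GH000KL000IJ101M0123456" ∷
  "798ABCDEFGHKLIJ000KL000EF101M0123457689ABCDGHEFIJKL000GH103M0132458967ABCDIJKLEFGH000IJ105M0" ∷
  "132459867ABCDKLIJEFGH000KL" ∷
  [])

certificate₈ : Certificate
certificate₈ = decode (
  "313131414171719191B1B1D1D1E1E1C1C1J1J1K1K1A1A1P1P1Q1Q18181T9T9U9U9R8F4R4L2S4S2H2N1W5G4X1M1V3" ∷
  "I3Y1Z1O0Y1Y0000WXZ1I0000WX000UVZ1M1103Y0123456789ABCDEFGHIJKLMNOPRQSTWXUV000WXX1G0000UVZ1G00" ∷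
  "00WXN164X0000UVZ0000WX000KL000EFS2103Y0123456789ABCDEFGHIJKLMNOPQRSTUVWX000EF000KL000ST000IJ" ∷
  "N2103Y0123456789ABCDEFHGKLIJMNOPQRSTUVWX000ST000KL00023101Y51ST406789ABCDEFGHIJKLMNOPQR23UVW" ∷
  "X000ST000CD101Y0123456789BAEFCDGHIJKLMNOPQRSTUVWX000EF103Y0123456798GHIJKLABCDEFMNOPQRSTUVWX" ∷
  "000IJ105Y0123456798HGKLIJABCDEFMNOPQRSTUVWX000KLF5G6G2R4L254N2X2H2Y1Y0W0000EF000UV000KLX2N00" ∷
  "00KL000UV000ST000IJN2103Y0123456789ABCDEFHGKLIJMNOPQRSTUVWX000ST000KL000OP00023G4103Y0123456" ∷
  "789ABCDEFGHIJKLMNOPQRSTUVWX00023105Y51ST406789ABCDEFGHIJKLMNOPQR23UVWX000ST000OPG2109Y51ST40" ∷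
  "6789ABCDEFGHIJKLMNOPQR23UVWX000OP000ST55G4G2R4L164H2X2N2Y1Y0I1I0000KL000UV000EFX2H0000EF000U" ∷
  "V000IJN1102Y0123456789ABCDEFHGKLIJMNOPQRSTUVWX000KL000ST000OPG2103Y0123456789ABCDEFGHIJKLMNO" ∷
  "PQRSTUVWX000OP000STL3Z4N2Z0000ST000KLZ2N0000KL000STR3Z4N2Z0000ST000KLZ2N0000KL000STH3S3G2S2N" ∷
  "163I2X1M2Y1Y0V0000UVX2I0I1I0000UV000KL000STS1G2N1105Y0123456789ABCDEFGHIJKLMNOPQRSTUVWX000ST" ∷
  "000KLS4S3G1Z3Z1N1a1O2O0000UV000KLZ2N1a1O2O0000UV000KLN263I2X1M1Y1Y0000UVX1I0000UVM2M0000UV00" ∷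
  "0KLG2S2N263I2X1M2W1Y1Y0a1W0000UVX1I0000UVW3X0000UVZ0000KLS310bY0123456789ABCDEFGHIJKLMNOPQRS" ∷
  "TUVWXN2W3M2X1I262O0Y1Y0a160000UVX1M0000UV64W3M2X2I1Y1Y0a1I0000UVX1M0000UVI3W3M3X1Y1Y0000UVa3" ∷
  "X0000UVZ0X2M1Y1O0a1M0000UVX2V2Z1Z0Z1O0M2a1Y1Y0Y2Y1Z1O0Y1Z1O0000UVX2W2M2a1I0a1I0I1I0I1a1Y1M00" ∷
  "00UV000KLS211gY0123456789ABCDEFGHIJKLMNOPQRSTUVWXG211NY0123456789ABCDEFGHIJKLMNOPQRSTUVWX105" ∷
  "X0123456789ABCDEFGHIJKLMNOPQRSTUVW000KL000ST000EF000OP000IJ101X0123456789ABCDEFHGKLIJMNOPQRS" ∷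
  "TUVW000KL00023101X51ST406789ABCDEFGHIJKLMNOPQR23UVW000ST000CD101X0123456789BAEFCDGHIJKLMNOPQ" ∷
  "RSTUVW000EF103X0123456798GHIJKLABCDEFMNOPQRSTUVW000IJ105X0123456798HGKLIJABCDEFMNOPQRSTUVW00" ∷
  "0KLF5U513nY0123456789ABCDEFGHIJKLMNOPQRSTUVXWL5a652a0000EF00023a45000023V0000ST000EFV2a0000E" ∷
  "F000ST53M4M2R3G1V4H2X2Y1N0000KL000UV000EFX2H1I1I0000EF000UVH1a1a0000EF000ST000OPM2103Y012345" ∷
  "6789ABCDEFGHIJKLMNOPQRSTUVWX000OP000STH3M4M2R2G1V3I2X2Y1N0000KL000UVX2I0a2Y1Y0000KL000UVI000" ∷
  "0ST000OPM2103Y0123456789ABCDEFGHIJKLMNOPQRSTUVWX000OP000STR3M3M2S1G1V3I2X2Y1N0000KL000UVX1I0" ∷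
  "000UV000STM1S1G1104Y0123456789ABCDEFGHIJKLMNOPQRSTUVWX000STN4S2S1M2G1V3I2X1Y1O0000UVX2I0a000" ∷
  "0UV000STM2S1G1104Y0123456789ABCDEFGHIJKLMNOPQRSTUVWX000STS3S2G2V3X0000UVZ0Z1Z0M1I3I2X1Y1O000" ∷
  "0UVI1X1Y1O0000UVS210DY0123456789ABCDEFGHIJKLMNOPQRSTUVWXM2G2V3X1a1I0000UVZ0Z1Z0G2V3Z1Z0000UV" ∷
  "Z0V4W3I2X1Z1Y1O0000UVa1Z0000UVX1Z1O0000UVZ1a0M2S110PY0123456789ABCDEFGHIJKLMNOPQRSTUVWXS210d" ∷
  "Y0123456789ABCDEFGHIJKLMNOPQRSTUVWX105X0123456789ABCDEFGHIJKLMNOPQRSTUVW000STZ3a3a0a0000STV1" ∷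
  "S2G1S1M2W3I2a1Y0000UVa1X0000UVa3I2W1W0000UVW1W0000UVS1G1102Y0123456789ABCDEFGHIJKLMNOPQRSTUV" ∷
  "WX000ST000KL000OP000EF00023101X51ST406789ABCDEFGHIJKLMNOPQR23UVW000ST000IJ101X0123456789ABCD" ∷
  "EFHGKLIJMNOPQRSTUVW000KLU513hX0123456789ABCDEFGHIJKLMNOPQRSTUVWL3109X0123456798GHIJKLABCDEFM" ∷
  "NOPQRSTUVWV353Z4Z2H2I1I0000UV000OP000EFZ2H2I1I0000UV000EF000OPN3M3M2R3G164H2X1Y1O0000UV000EF" ∷
  "X2H1Z2I1I0I1I0000EF000UV62X0000UV000EF000OPM1102Y0123456789ABCDEFGHIJKLMNOPQRSTUVWX000OPR4O3" ∷
  "O2X2Y1H0000EF000UVO1X2Y1H0000EF000UVH3O3O2X1Y1I0000UVO1X1Y1I0000UVW3G1G0X1I1I0000UVZ1a2a0000" ∷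
  "UV000EFZ3O3O2X2W1G1S1M1H2I1I0I1I0000EF000UVO1X2W1G1S1M1108Y0123456789ABCDEFGHIJKLMNOPQRSTUVW" ∷
  "X000EF000UVH3S2G1S1M1W3O2X2Y1I0I1I0000UVX1O0000UVM1S1G1103Y0123456789ABCDEFGHIJKLMNOPQRSTUVW" ∷
  "XX2I1I0I1I0000UV000EF000OP000KLH35311VY51ST406798GHIJKLABCDEFMNOPQR23UVXWN4M3M2R2G163I2X1Y1O" ∷
  "0000UVX2I0Z1O1I1I0000UVI1a2X1W1G1S1O1Z1Y121Y3VWLPMOFBESIRC2015TDA8647NQUXKH9GJ0000UV000OPM11" ∷
  "02Y0123456789ABCDEFGHIJKLMNOPQRSTUVWX000OPR3M2M1S2G163a1a0X2I1Z1Z0I1I0000UVG1G0M1101Y0123456" ∷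
  "789ABCDEFGHIJKLMNOPQRSTUVWXI1S2G1S1M162X2a1a0a0000UVM1S1G162105Y0123456789ABCDEFGHIJKLMNOPQR" ∷
  "STUVWX000UVZ1a2a0000UV000OPZ5a4a0000OPX0000UVR1a2S1S0S1S0000OPX1a2a1G3M1Y1Y0000OPY1Y0a1101Y0" ∷
  "123456789ABCDEFGHIJKLMNOPQRSTUVWX000UV000KLR35412xY51ST406798GHIJKLABCDEFMNOPQR23UVXWN310rY5" ∷
  "1ST406798GHIJKLABCDEFMNOPQR23UVXWS1G1G0Z1a2a0000UV000KL11vX51ST406798GHIJKLABCDEFMNOPQR23UVW" ∷
  "N35312zY51ST406798GHIJKLABCDEFMNOPQR23UVXWO110oY51ST406798GHIJLKABCDEFMNOPQR23UVXWZ1a2a0000U" ∷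
  "VS3S3O3O2X1Y1I0000UVO1X1Y1I0000UVG2I3I2X1O2Y1Y0Y1Y0000UVI1X1103Y0123456789ABCDEFGHIJKLMNOPQR" ∷
  "STUVWX000UVW4a3O2a0000UVa1O0000UVO3Z2Z1M0M1Z0X2a2Y1I0Y1I0I2Y1Y0Y1Y0000UVX2Z2Z1M0M1Z0O1a1Y1I0" ∷
  "000UV100X51ST406798GHIJKLABCDEFMNOPQR23UVWG2S210eY0123456789ABCDEFGHIJKLMNOPQRSTUVXWM2a463a2" ∷
  "I0000UVX1I0000UVI3a260000UVa160000UVa261I0I160000UV64I3I1a0000UVI2a0000UVI3a3a2O2Y1W0Y1W0000" ∷
  "UVa1102Y0123456789ABCDEFGHIJKLMNOPQRSTUVWX000UVX2a3O2Y1W0Y1W0W2Y1O0Y1O0100Y8A6BCD2R0K1345JFO" ∷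
  "HME9LINGSQ7PWUVTXO3Y2a1W0a1W0W2Y1Y0Y1Y0100X8A6BCD2R0K1345JFOHME9LINGSQ7PWUVT000UVX2a2I0a1I0I" ∷
  "1a1a0000UVS211KX0123456789ABCDEFGHIJKLMNOPQRSTUVWM2103X51ST406798GHIJKLABCDEFMNOPQR23UVW64W4" ∷
  "a3O2a0000UVa1O0000UVO3X3I2Y1X0Y1X0100Y86AB49170523CKJWSTIEDLMNPOQRGHUVFXX2Y1I0Y1I0X3a2Y1I0Y1" ∷
  "I0I2Y1Y0Y1Y0100X86AB49170523CKJWSTIEDLMNPOQRGHUVF000UVX2O2O0O0O110yYA8CD6B49170523STMNOPRQGH" ∷
  "IJLKEFUXWV000UVI3W410MY51ST406798GHIJKLABCDEFMNOPQR23UVXWO4X2Y1X0Y1X0X2Y1Y0Y1Y0000UVZ3X1X0Y1" ∷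
  "X0000UVX3a2Y1O0Y1O0O2Y1Y0Y1Y0Z2Y1O0Y1O0000UVX2Z3Z2Y1O0Y1O0O2Y1Y0Y1Y010xX96GH481750STIEDW23CK" ∷
  "JFMNPOQRABUVLO2Y2Z1Y0Z1Y0Y1Z1Y0000UVX2W3114Y51ST406798GHIJKLABCDEFMNOPQR23UVXWO310cYSI5EGR9J" ∷
  "6H4817ABKL2OTXP3DMU0CNQWFV10YXSI5EGR9J6H4817ABKL2OTVP3DMU0CNQWF10UX51ST406798GHIJKLABCDEFMNO" ∷
  "PQR23UVWY2a2I0O0O1Z1I0I11ClX41760523CKRANID8OHME9LJUPGFQTSBWV000UV100W51ST406798GHIJKLABCDEF" ∷
  "MNOPQR23UV5117MX51ST406798GHIJKLABCDEFMNOPQR23UVW000KL000OP000EF000ST000IJ101W0123456789ABCD" ∷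
  "EFHGKLIJMNOPQRSTUV000KL00023101W51ST406789ABCDEFGHIJKLMNOPQR23UV000ST000CD101W0123456789BAEF" ∷
  "CDGHIJKLMNOPQRSTUV000EF103W0123456798GHIJKLABCDEFMNOPQRSTUV000IJ105W0123456798HGKLIJABCDEFMN" ∷
  "OPQRSTUV000KLF5U7U71GJY0123456789ABCDEFGHIJKLMNOPRQSTWXUVH5I6I2R4L353N2X0Y0000KLX2N0000KL000" ∷
  "STY2V1a2W0000KL000ST000IJ101Y0123456789ABCDEFHGKLIJMNOPQRSTUVWX000KL000OP00023I4103Y01234567" ∷
  "89ABCDEFGHIJKLMNOPQRSTUVWX00023105Y51ST406789ABCDEFGHIJKLMNOPQR23UVWX000ST000OPI2109Y51ST406" ∷
  "789ABCDEFGHIJKLMNOPQR23UVWX000OP000ST55I4I2R4L2V3N2X0Y1a1O1O0000KLX2N1a1O1O0000KLY260a0000IJ" ∷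
  "101Y0123456789ABCDEFHGKLIJMNOPQRSTUVWX000KL000ST000OPI2103Y0123456789ABCDEFGHIJKLMNOPQRSTUVW" ∷
  "X000OP000STL4Z4N2Z0000ST000KLZ2N0000KL000STR2Z4N2Z0000ST000KLZ2N0000KL000STG3S3I2S2N262X0Y0Y" ∷
  "160000KL000STS1I2104Y0123456789ABCDEFGHIJKLMNOPQRSTUVWX000ST000KLV4a3a1N0000KLZ2N0000KLN2S2S" ∷
  "1I1Z1Z0S1I1Z1Z0Z1a0000KLZ3a3a0a0000KLN1I2I1S21AYY8BA6EFR2WNSKD5HX7QM4CU0I13GOPT9JLV1GBY01234" ∷
  "576MNOPIDFXRQEWCU89BAHGTSKLJVI1101Y0123456789ABCDEFGHIJKLMNOPQRSTUVWX000KL000ST000OPY1a4a2R3" ∷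
  "I0N1V2I0Z0000KL000ST000OPa2103Y0123456789ABCDEFGHIJKLMNOPQRSTUVWX000OP000ST000IJ101X01234567" ∷
  "89ABCDEFHGKLIJMNOPQRSTUVW000KL00023101X51ST406789ABCDEFGHIJKLMNOPQR23UVW000ST000EFL5Z6Z2H000" ∷
  "0EF00023H4Z000023Z0000ST000EFZ2H0000EF000ST54Z4H2Z0000ST000EFZ2H0000EF000STG3Z4H2Z0000ST000E" ∷
  "FZ2H0000EF000STR3Z4H2Z0000ST000EFZ2H0000EF000STN3S3S1H3M3V2Y1Y0Y0000STY2V1a2W1I0W1I0000STM1Y" ∷
  "0000ST000EFS2102Y0123456789ABCDEFGHIJKLMNOPQRSTUVWX000EFS4S3H262O2X0Y0X1O0V2X0I1I0000EFM21EN" ∷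
  "Y01234576NMQRCUIWOPDKJX98GHBATSEFVLY1W0S2106Y0123456789ABCDEFGHIJKLMNOPQRSTUVWXH3M2W2X0Y0Y1W" ∷
  "0M362O2X0Y0X1O0W3621HPYDO2AMKP7JEGTI95X3B0L8F4N16QRSHCUWVa1a0X1Y1Y0Y1a1X1O0Y262O1X0O1O0W1V2a" ∷
  "1I0a1I0M2V2X1Y1Y0I1I0Y1W2O1O0I1I0000EFS310tY0123456789ABCDEFGHIJKLMNOPQRSTUVWX103X0123456789" ∷
  "ABCDEFGHIJKLMNOPQRSTUVW000EF000ST000KL000OPH3Z2Z0000STR3Z2Z0000STZ3Z2S2S1M1G261X1X0a1O1Y1Y0S" ∷
  "1M1102Y0123456789ABCDEFGHIJKLMNOPQRSTUVWX000STZ1102Y0123456789ABCDEFGHIJKLMNOPQRSTUVWX000ST0" ∷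
  "00KL000OP000EF00023101X51ST406789ABCDEFGHIJKLMNOPQR23UVW000ST000IJ101X0123456789ABCDEFHGKLIJ" ∷
  "MNOPQRSTUVW000KLH5U5157Y0123456789ABCDEFGHIJKLMNOPQRSTUVXWL5X6X2N0000KL00023N4X000023X0000ST" ∷
  "000KLX2N0000KL000ST52Z4Z2V1W1W0000ST000KLZ2V1W1W0000KL000STG312pYG9IJ6H4871NMQROP0523STBAEFC" ∷
  "DKLVUXWR3X5X261N1I1S11FaYG9IJ6H84BAFE3PRWDC2OQV71NM50KLSTUX000KLX361N1I1S11FhYG9IJ6H84BAFE3P" ∷
  "RWDC2OQV71NM50KLSTUXY1Y0000ST000KLX2Y1Y0000KL000STN4S2S1I3M3V2Y1Y0Y0000STY2V2Z2O0W1W0W1W0000" ∷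
  "STM1Y0000STS1101Y0123456789ABCDEFGHIJKLMNOPQRSTUVWXS3S2I2V2X0Z0Z1Z0M2V3I0X0Z0Y1W1V0S2109Y012" ∷
  "3456789ABCDEFGHIJKLMNOPQRSTUVWXI3M2V2W0Z0Y1W1V0M3V2X1W1W0Z0V3W2X0Y0X1W0Z1a1Y0Y262O1X0X1O0W2a" ∷
  "1V0Z1V0M2Z1Z0Y1W1X0S210hY0123456789ABCDEFGHIJKLMNOPQRSTUVWX102X0123456789ABCDEFGHIJKLMNOPQRS" ∷
  "TUVW000STZ3S2S1I3M362O2X0Y0X1O0000STY3V1W1W0000STa2V0000STM1Y1a260W0000STS1101Y0123456789ABC" ∷
  "DEFGHIJKLMNOPQRSTUVWXV2S2I1S162O2X0Y0X1O0S1I1102Y0123456789ABCDEFGHIJKLMNOPQRSTUVWXY2W1W0W1W" ∷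
  "0000ST000KL000OP00023101X51ST406789ABCDEFGHIJKLMNOPQR23UVW000ST000IJ101X0123456789ABCDEFHGKL" ∷
  "IJMNOPQRSTUVW000KLU516KX0123456789ABCDEFGHIJKLMNOPQRSTUVWL353Z3Z2V0000STZ1V0000STN4Z3Z2V0000" ∷
  "STZ1V0000STR2I3I2S1M2V2O2X0Y0X1O0Y160000STI1S1103Y0123456789ABCDEFGHIJKLMNOPQRSTUVWX000STG41" ∷
  "7hYH9KL6G4871NMQROP0523STBAEFCDIJVUXWV3a2M0Z0Z1M0Z1a0000ST17QXH9KL6G4871NMQROP0523STBAEFCDIJ" ∷
  "VUW000OPY1X3X0X0000ST000KLV253I3I1R3M2W3N2X0X1X0000KLX2N1O1O0000KLY260a0W1X0000KL000OPI2102Y" ∷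
  "0123456789ABCDEFGHIJKLMNOPQRSTUVWX000OPN4I3I1R2M2W210zY0213EKBR8FA6CD49OTMJ5LINSGQ7HXUVPWX2O" ∷
  "0a0Y160O1Y1Z0000OPI2102Y0123456789ABCDEFGHIJKLMNOPQRSTUVWX000OPR3I2I1S1M2W2O2X0X1X0X1O0Y160I" ∷
  "1S1102Y0123456789ABCDEFGHIJKLMNOPQRSTUVWXG318rYH9KL6G4871NMQROP0523STBAEFCDIJVUXWW1I1I0Z1a0Z" ∷
  "3S3S1M1G1I1I0I1S1M2W2O2X0Y0X1O0Y160M2S2G1I1I0I1108Y0123456789ABCDEFGHIJKLMNOPQRSTUVWXS1I1Y16" ∷
  "0G1a1a0Y1a1a0000OPY2X2X0X0Z3a3I2a0000OPR1I0000OPR2X2X0X0I1X361X1a1O1W1G1S121Y2KVCA8BFOWSIGJ3" ∷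
  "015TDPM7469HLXUQNRE0W1X1a1M1O1S1G121Y5TUQCVWOFXJG964103DA8BE2KHLPM7NRIS0X261a1O1W1G1S121Y2KV" ∷
  "CA8BFOWSIGJ3015TDPM7469HLXUQNRE0W1a1M1O1S1G121Y5TUQCVWOFXJG964103DA8BE2KHLPM7NRIS0000OP000KL" ∷
  "G317JXG9IJ6H4871NMQROP50ST23BAEFCDKLVUWR313cXG9IJ6H4871NMQROP50ST23BAEFCDKLVUWN353S3I1S1M262" ∷
  "X1Z0Y0Y261Z0a1Z0M2S1I1108Y0123456789ABCDEFGHIJKLMNOPQRSTUVWXS2I1106Y0123456789ABCDEFGHIJKLMN" ∷
  "OPQRSTUVWXY0S1M1Y0O2S2Z1Z0S1Z1Z0Y1a2a1W1S1I1M1Z1X121Y03UWKHLVCQNRIS5147MODA869GJPXTFBE20W1a1" ∷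
  "S1I1M1Z1X121Y03UWKHLVCQNRIS5147MODA869GJPXTFBE20Z1a2a0a0S3S31HaY51ST406789ABDCEFHGKLIJNMRQPO" ∷
  "23WXUVI2X4X161M0O2X1W0X1W0X2O1W0W1O0X361M0O1W0W1O0W3a3O2X0X1X0X1O0a1O0O31GIY7M4NOPKDH29L6GTX" ∷
  "E0BR13SA5IC8FWQVJUX1a1a0Y1X1X0X2a2O1O0O0O1a0M3O3O2X0Y1Z160O1X0O1Y1Z160631I4Y5S1TIDGR9J6H48KL" ∷
  "P3MW0XEN2BQ7OACUFVX1a2I1a1O0Y1Y0Y1a1X1O0Y2a260a061a0I210XXH9KL6G4871NMQROP50ST23BAEFCDIJVUWS" ∷
  "210ZX0123456789ABCDEFGHIJKLMNOPQRSTUVWM3W3a3O2X0Y0X1O0Y1O0O31GWY14506798GHIJSRPWKLO2TXBAFECD" ∷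
  "MNQV3UX11HVYIGSR9J6H481750MNBAFEDCKLO2UTPWQX3VY1a2X160X160X2a1O0O1a0631FVX8B6AEF2R0K1345JWOH" ∷
  "MD9LINGSQ7PTCUVX1W2109YT5FX1S4076NMQRPO98GHBA23EKUJIDWCLVZ2Y1Y0Y1Y0Y11SPXEBR28F6A4971NM50GHI" ∷
  "JKLDCSOVQTP3WUY2Z2Z16061Z061Z1Z0S210pX0123456789ABCDEFGHIJKLMNOPQRSTUVW102WH9KL6G4871NMQROP5" ∷
  "0ST23BAEFCDIJVU5112GXH9KL6G4871NMQROP50ST23BAEFCDIJVUW000KL000OP000ST000IJ101W0123456789ABCD" ∷
  "EFHGKLIJMNOPQRSTUV000KL00023101W51ST406789ABCDEFGHIJKLMNOPQR23UV000ST000EFU31A3X0123456789AB" ∷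
  "CDEFGHIJKLMNOPQRSTUVWH516rX0123456789ABCDEFGHIJKLMNOPQRSTUVW10BW0123456789ABCDEFGHIJKLMNOPQR" ∷
  "STUV0002310DW51ST406789ABCDEFGHIJKLMNOPQR23UV000ST000EF000IJ101W0123456789ABCDEFHGKLIJMNOPQR" ∷
  "STUV000KL55G5G51S8YG9IJ6H48170523STNMQROPBAEFDCKLWXVUR519xYG9IJ6H4871MNOPQR0523STBAEFDCKLWXU" ∷
  "VL4Z4Z2V0000ST000KLV2Z0000KL000ST63Z4Z2V0000ST000KLV2Z0000KL000STH2Z4Z2V0000ST000KLV2Z0000KL" ∷
  "000STU3M3M1X0000STM2X0000STN4X3M2X0000STX1M0000STV2a2a0Z0Z1a0000STZ3a2a0000STV1O2O1Y0O1Y0000" ∷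
  "ST000KL000EFZ3Z2V3H1I2I1S1Y1M0I1S1Y1M0000EFX0000KLZ1102Y0123456789ABCDEFGHIJKLMNOPQRSTUVWX00" ∷
  "0KL000ST000IJ101X0123456789ABCDEFHGKLIJMNOPQRSTUVW000KL000OP101XN7QR4M6189ABCDEFGHIJKL50ST23" ∷
  "OPVUW000STG3104X0123456789ABCDEFGHIJKLMNOPQRSTUVWR5V5a5a1L1U2H1Y1S1I11Z9Y01324576NMRQEXCUPOF" ∷
  "VDW89BAGHTSIJKL000EF000IJa1N1U2H1Y1S1I11ZJY01324576NMRQEXCUPOFVDW89BAHGTSKLIJ000EF000KLa4L1U" ∷
  "2H1Y1S1I11ZTY01324576NMRQEXCUPOFVDW89BAGHTSIJKL000EF000IJN1U2H1Y1S1I11ZcY01324576NMRQEXCUPOF" ∷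
  "VDW89BAHGTSKLIJ000EF000KLL2Z3Z262N1X1O1O0000EF000KLZ162N1X1O1O0000EF000KLU3a3a2H0000EFH1a000" ∷
  "0EFH2X3X1N1W1I11WeYEBRX8FA6DCSOI5MWQ2NU0V4971HGPTKLJ3000KLX2N1W1I11WkYEBRX8FA6DCSOI5MWQ2NU0V" ∷
  "4971HGPTKLJ3000KL64X3X1W1I11WeYEBR38FA6DCSOI5MWQ2NU0V4971HGPTKLJX000KLX2W1I11WjYEBR38FA6DCSO" ∷
  "I5MWQ2NU0V4971HGPTKLJX000KLN3Z2Z0Z0Z1S0Z1a1O1O0000KLZ3I2I11WdYEBR38FA6DCSOI5MWQ2NU0V4971HGPT" ∷
  "KLJXI11WfYEBR38FA6DCSOI5MWQ2NU0V4971HGPTKLJXN2a2a1O1M1M0X1O1M1M0X2a2a1O1M1M0O1M1M0W2O1M1M0I2" ∷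
  "O1O01WpXN7RQ4M1650STIDFU32EWCV89BAHGPOKLJ000KL000EF000IJ101X0123456789ABCDEFHGKLIJMNOPQRSTUV" ∷
  "W000KLL2V311NYN7QR4M6189ABCDEFGHIJKL50ST23OPVUXWN2S4S2H2O0O260Y0100YKSHXD5AO8C6B94EFQ2NU0VMI" ∷
  "7PGW1TJLR3000EFO2S260000EFY0100YKSHXD5AO8C6B94EFQ2NU0VMI7PGW1TJLR3U3a4a3H160000EF62Z0000EFH2" ∷
  "a160a160000EF106YIOGWDMAS8C6B94EF2Q0VNU5K1THR7PLJ3XH3X3M1X0W2I2X2M0Z0X0X0X1W1Z063O2O1Y0O1Y0M" ∷
  "1a1a0Z1a1a0100XIOGWDMAS8C6B94EF2Q0VNU5K1THR7PLJ3000EF000KL63V312HYN7QR4M6189ABCDEFGHIJKL50ST" ∷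
  "23OPVUXWN210XYN7QR4M6189ABCDEFHGKLIJ50ST23OPVUXWU4a3H1Z0000EFZ2H0000EFH2X2M1X0X1M0Z1a0000EFZ" ∷
  "3a2a0000EFH1X2M1X0X1M0000EF000KLV311fXN7QR4M6189ABCDEFGHIJKL50ST23OPVUWN210dXN7QR4M6189ABCDE" ∷
  "FHGKLIJ50ST23OPVUWH2U310LYN7QR4M6189ABCDEFHGKLIJ50ST23OPVUXWI1S2S1O1Y1a1M1Z1X121Y03EWLPVXFB8" ∷
  "ADS51469HKRN7MOIGJTUQC20S1O1Y1a1M1Z1X121Y03EWLPVXFB8ADS51469HKRN7MOIGJTUQC20Z1a0X3X3M3M2Z1W0" ∷
  "000WXM1Z1W0000WXM2Z2a1W0a1W0W2Z1Z0Z1Z0W31PuYM7OP4N6189ABDCEFHGKLIJ0532TSRQUXVWI2188Y20CV1354" ∷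
  "STKDHRAOFUBXQW76NM98EIGLPJ16qXUTQW5F1S406798NM32EICVDKAOHRBPLGJM117nYN7RQ4M6198GHJIKLABDCEF0" ∷
  "532TSOPUXVWM2108XKSHRD5AO8C6B94EFQ2NU0VMI7PG31TJLWX110AX0123456789ABCDEFGHIJKLMNOPQRSTUVWX21" ∷
  "05X0123456789ABCDEFGHIJKLMNOPQRSTUVWM110EXKSHRD5AO8C6B94EFQ2NU0VMI7PG31TJLW000KL000EF000IJ10" ∷
  "1W0123456789ABCDEFHGKLIJMNOPQRSTUV000KL000ST000OP101WN7QR4M6189ABCDEFGHIJKL50ST23OPVU000STL3" ∷
  "X5X5Y4Y2R0000OP000EFR2Y0000EF000OPN3Z4Z2V1U1U0000ST000EFZ2V1U1U0000EF000STV3Z2Z0000EFZ1Z0000" ∷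
  "EF000ST000KLY5Y4G3G16362W3M1U1H3S1R0a2a0a0V1Z0O1U2V2M1R1a1Z1S121Y15TDOM7NRLH9GI203KWXVEBFPJS" ∷
  "UQCA8640a1S1R1M1Z121Y69GIVEBFWJODT5147MPXSUQNRLHK302CA80a0a1101Y8A6BCD2Q0I1345KFGV9JEXUNSW7R" ∷
  "OTMHPL000KL61102Y0123456789ABCDEFGHIJKLMNOPQRSTUVWX000KL000OPG2102Y0123456789ABCDEFGHIJKLMNO" ∷
  "PQRSTUVWX000OP000EFR2S3G1S2W1M1U1I1N2H2O1O0a0O1O0000KLS1G1W1M1U1I1107Y0123456789ABCDEFGHIJKL" ∷
  "MNOPQRSTUVWX000KL000EF000OPY310SY0123456789ABCDEFGHIJKLMNOPQRSTUVWXR1S3G1S2W1M1U1I1H2a0a0000" ∷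
  "KLS1G1W1M1U1I1107Y0123456789ABCDEFGHIJKLMNOPQRSTUVWX000KL000OP000EFR3Y2104Y0123456789ABCDEFG" ∷
  "HIJKLMNOPQRSTUVWX000EFY110VY0123456789ABCDEFGHIJKLMNOPQRSTUVWX000EF000OP000STN3X311qY0123456" ∷
  "789ABCDEFGHIJKLMNOPQRSTUVXWV3U3U1M1H1W1G2R2O1Z1Z0O1O0000OP000EFM1U2H1W1G2107Y0123456789ABCDE" ∷
  "FGHIJKLMNOPQRSTUVWX000OP000EFH4U2U1I1M1W1G2R2Z1O0O1O0000OPU1I1M1W1G2106Y0123456789ABCDEFGHIJ" ∷
  "KLMNOPQRSTUVWX000OPR3U2U1I1M1W1G1Y1Y0M1U1I1W1G1Y1Y0M1U1U0Y1a1Z0000OPY3a3a0000OPU0R1U2I1U1M1W" ∷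
  "1G2S2a1a0a1a0100Y0213ICGVJ9TR5DNF6H48KLOEMXSBQAU7WPM1U1I1W1104Y0123456789ABCDEFGHIJKLMNOPQRS" ∷
  "TUVWX000OP000EF000STX113FX0123456789ABCDEFGHIJKLMNOPQRSTUVW000ST000KLX311dX0123456789ABCDEFG" ∷
  "HIJKLMNOPQRSTUVWN1108X0123456789ABCDEFGHIJKLMNOPQRSTUVW000KL000STR3X5X5G3G2S2V1M3U2H1N31TYYP" ∷
  "MDK7O4N6189ABGH0523STRQJEUCIVWXFLZ1I1O1O0000WX000EFZ2H1N21CLY41670532EKWBUJ8FPHDM9LICGOQASTN" ∷
  "XVRa0000EF000WX000KL000STG1S2V1105Y0123456789ABCDEFGHIJKLMNOPQRSTUVWX000KL000STN3U3U1M2H1V1G" ∷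
  "1S2O11TqYGIJ92O0C31ELRBPH4576STAQD8UNMVKWFXa1O1O0000ST000EFM2U2H1V1G1107Y0123456789ABCDEFGHI" ∷
  "JKLMNOPQRSTUVWX000EF000STV4Z3Z1Y0000EFY2Z0000EFZ2Z1Y1H0Z1Y1H0000EFY3Z2Z0000EFH1Z1Z0000EF000S" ∷
  "T000KLG3G2S2a2a1W0W1a0000KL6462W3M1U2V3I2S1O1Y1Y0Y0O1S1I0Y1I0I0O2S1I1Z1M1Y1Y0U1I0Y0000KL000E" ∷
  "F62103Y0123456789ABCDEFGHIJKLMNOPQRSTUVWX000EF000KLG2S210bY0123456789ABCDEFGHIJKLMNOPQRSTUVW" ∷
  "X000KLS3W3M1U2H163N2O1O0a1O0000KLa3N1O0000KLZ2N0000KL000EFN1U2H1O1M1M0000EF000KLW2N262H21OPY" ∷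
  "NQ7RCUA28D6B94EFPTMK5X0I13GOSWJHVL1O7YNQ7RCUA28D6B94EFPTMK5X0I13GOSWJHVL000EFZ2H160000EFM2N2" ∷
  "62V3I1Y0O0Y1I0000EFZ2V1Y0000EFU3N263H2O1O0a0000EFa2H115XYDTAPJ5GRI92OC0VM6H84KLXNE3Q7S1UBWF0" ∷
  "00EFO1O0H211RYDTAPJ5GRI92OC0MV6H84KLENBXQ7S1UFW3N362O1a1a0a1O0O3O21EnYOIMV2G0C1354ST76EKRBPH" ∷
  "AQD8UNJ9WLFX1WnYA8DC6B4971MNPORQ0532TSGHJILKEFWXVUO11EqYOIMV2G0C1354ST76EKRBPHAQD8UNJ9WLFXO1" ∷
  "1WrYA8DC6B4971MNPORQ0532TSGHJILKEFWXVUZ2O1O0I1O1O0000EF000KLG211ZY0123456789ABCDEFGHIJKLMNOP" ∷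
  "QRSTUVWX102X0123456789ABCDEFGHIJKLMNOPQRSTUVW000STN3X312lY0123456789ABCDEFGHIJKLMNOPQRSTUVXW" ∷
  "V4U3U1M1H1W1G1S2O11WtYA8DC6B4971MNPORQ0532TSGHJIKLEFUWVXO1O0000EFM1U2H1W1G1106Y0123456789ABC" ∷
  "DEFGHIJKLMNOPQRSTUVWX000EFH3U2I1U1M1W1G1a1Y0U1I1M1W1G1a1Y0S1G1G0Y1a1a0000EFY3a3G0a0000EFH1M2" ∷
  "M1W1G1U2I1a1O0a1I1I0M1W1G1103Y0123456789ABCDEFGHIJKLMNOPQRSTUVWX000EF000STX113TX0123456789AB" ∷
  "CDEFGHIJKLMNOPQRSTUVW000ST000KLX311DX0123456789ABCDEFGHIJKLMNOPQRSTUVWN1108X0123456789ABCDEF" ∷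
  "GHIJKLMNOPQRSTUVW000KL000STH3S4S41gPY0123456789BAEFCDGHIJKLNMQRPOSTWXVUG31OoY0123456789ABDCE" ∷
  "FGHIJKLNMQRPOSTWXVUV41CgY51ST406789ABDCEFGHIJKLNMQRPO23WXUVM2Z3Z261N11QpY3W0FPKMDO7IEG2BV4N1" ∷
  "6QRASC8J5UHX9TL000KLZ161N11QuY3W0FPKMDO7IEG2BV4N16QRASC8J5UHX9TL000KLU21ZxY01234576MNOPIEDWR" ∷
  "QJXCU89ABHGSTKLFV1Y4X01234576MNOPIEDWRQJFCU89ABHGSTKLVZ2Z162I1N21HMYRNFK7QM4OPIEG2BVDWAS3X16" ∷
  "0598CUHJTLY1W1W0N2U1I1a1M1W1X1Y121Y02CA8647NQUTJXW3LVEBFRKH9GIOMPDS510Y1X1a1M1W1I1U121Y03LHK" ∷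
  "S5TFRN7MOI2CQUVEB8ADPWXJG96410Z1101Y0123456789ABCDEFGHIJKLMNOPQRSTUVWX000KL000STN41MjY012345" ∷
  "6798HGKLIJBAEFCDNMQRPOSTWXVU62Z3G2Z0000STZ1G0000STI2Z3G2Z0000STZ1G0000STU2a3M2a0000STa1M0000" ∷
  "STM31ZtYAC8D2QI0GO9J6HRXME7PBV31FK54NUSTLWV31IpYEBOVF83R0K1254ICHP9LMWNJ7QSG6AXTUD1IbXEBOVF8" ∷
  "3R0K1254ICHP9LMWNJ7QSG6ADTU1IcXEOBVIM2G0C1354FKQANU8D9J6HSR7PWTL000STZ3Z261I1U2M1W1G1a0O0G0Z" ∷
  "161I1104Y0123456789ABCDEFGHIJKLMNOPQRSTUVWXG1Z0000ST000KLG310rXG9IJ6H4871MNOPQR0523STABCDEFK" ∷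
  "LVUWS310uX0123456789ABCDEFGHIJKLMNOPQRSTUVWN2V2a3M1a0a2M0Y1U1M0a1Y1U1M0M2U3U21SRYQNCU7RM4POD" ∷
  "KSAHWIE2GBV618950FLTJ3Xa0U11SUYQNCU7RM4PODKSAHWIE2GBV618950FLTJ3XU1a0U21JoY01234576MNPOKDIER" ∷
  "QJXCU89ABHGSTLWFV1JQXQNCU7R4M6198HGAB50ST23OPIEKDJFWLV62V2105YG9IJ6H4871MNOPQR0523STABCDEFKL" ∷
  "VUXW103X3K0WPHMD7O4N16QRIE2GBVASC85J9LTUFV2105XG9IJ6H4871MNOPQR0523STABCDEFKLVUWM21JYXHK9LP3" ∷
  "DMASC8Q26B5J1TGWO7IEN40FRUVU21JaX51ST4076MNOPEIDKQRCUJW98GHBA23FVLX4X41ZfYOMIE7P4N160523ST89" ∷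
  "ABGHRQJFUCDKWXVL1ZUXOMIE7P4N160523ST89ABGHRQJFUCDKLWV1YmXPDMKAS8C6B4971GHFER3OV2QI0UNJ5TWL1Y" ∷
  "nXPMDK7O4N6189ABGH0523STRQJFUCIEVWLO31ZYXB8FE6A49170532STMNPORQGHJILKDCUWVX21ZbXB8FEA6DCSPJ5" ∷
  "RG1TMK7O3H2Q0IUN49LWVY1Z1W0100W8BA6FE3R0K21CI54PHDM9LJNSGQ7OVUTW31YxXM7PO4N6189ABDCFEGHJIKL0" ∷
  "532TSRQUWVO21YzXAD8CPSMK7O4N61RQIEG2BV3HF0L9J5TWUX1Z1Y0108W7NM4RQJFGSI9O2H6D5PA1T3BK0E8CUVL1" ∷
  "00W8BA6FE3R0K21CI54PHDM9LJNSGQ7OVUT000KL000STS2115X0123456789ABCDEFGHIJKLMNOPQRSTUVW103WG9IJ" ∷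
  "6H4871MNOPQR0523STABCDEFKLVU000KLV4S4S41gCY0123456798GHIJKLBAEFCDNMQRPOSTWXVUG21REYG9IJ6H487" ∷
  "1MNPOQR0523STBAEFDCKLXWUVW41FIY51TS406789ABDCEFGHIJKLNMQRPO23WXUVM2Z3Z261N2O1O0Y2O1O0O1O0000" ∷
  "KLZ161103Y0123456789ABCDEFGHIJKLMNOPQRSTUVWX000KLU21ciY01234576MNOPIEDWRQJXCU89ABHGTSKLFVI21" ∷
  "bjY51TS4076NMRQJFCUOPIEDW89ABHG23KLXV1aFX51TS4076NMRQJFCUOPIEDW89ABHG23KLVN2M1M0M1M0000KLN31" ∷
  "NwY0123456798HGKLIJBAEFCDNMQRPOSTWXVU62Z2G1Z0Z1G0I2Z2G1Z0Z1G0U2Y2O1X0X1O0M21LEYJGRXI92O0C135" ∷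
  "4FKAQ8DNUME7PSB6HVTWLW3a2G1Z0Z1G0G2Z1Z0Z1a0100X01324576MNPOKWEIRQFJCU89BAHGSTLVDM2M1U2I1W2G1" ∷
  "Y1Y0O1O0Y0M1101Y0123456789ABCDEFGHIJKLMNOPQRSTUVWX000KLG2S31SXYG9IJ6H4871MNPOQR0523STBAEFDCK" ∷
  "LWXUVN31F1YH9KL6G4871MNPOQR50ST23BAEFDCIJWXVU6210eYM7OP4N6189BAEFCDGHIJKL0523STQRVUXWI21LLYH" ∷
  "9KL6G84ABCDQ2PWEFOS3X1705NMIJRUTVU21LpYDAPW8C6B491750MNGHIJKLFE3RSO2QVTXU1KcXH9KL6G84BAEFSO3" ∷
  "RCD2QPW71MN50IJTVUW2a2a0X0X1a2I1a1M1Z1Y1U1O121Y03LRVS5TKH968AC2IGJWDPMOEBFXUQN7410M1a1I1Z1Y1" ∷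
  "U1O121Y03LRVS5TKH968AC2IGJWDPMOEBFXUQN7410000KLS311MX0123456789ABCDEFGHIJKLMNOPQRSTUVWN210QX" ∷
  "DPATMKO7IE2GC09JBS8F5V4N61QRHWUL36210sXM7OP4N6189BAEFCDGHIJKL0523STQRVUWW210uX4716MNPODKTA5W" ∷
  "C83H0F9LIE2GSBQRVUJM21L9XSE5VOBIM2GC0QA139J6HTWP7DKN48FRULU210zXMOP7IE2G0C31KF54AQD8NUJ9TRH6" ∷
  "SBLVWY3Y31bmY30FK12456789BAGHMNOPRQTSJDVEICWXLU1biX20IC134576MNOPRQ89BAGHTSJDVEFKLWU1bjX30FK" ∷
  "12456789BAGHMNOPRQTSJDVEICUWLO21blXA8DC6B4971MNPORQ0532TSGHJILKFEVWUY1Z1X0100W01324576MNPOKD" ∷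
  "EIRQFJCU89BAHGSTLV000KLS210zX0123456789ABCDEFGHIJKLMNOPQRSTUVWG210SX0123456789ABCDEFGHIJKLMN" ∷
  "OPQRSTUVW105W0123456789ABCDEFGHIJKLMNOPQRSTUV000KLN3S3S31gTY0123456798GHIJKLBAEFCDNMQRPOSTWX" ∷
  "VUG3I2I1U2M2W2Z0a0a1W0O1M1M0I1101Y0123456789ABCDEFGHIJKLMNOPQRSTUVWXW21HqY51TS406789ABDCEFGH" ∷
  "IJKLNMQRPO23WXUVM2X3X0X1Y1Z1O1O0X1Y1Z1O1O0U21esY01234576MNOPIEDWRQJXCU89ABHGTSKLFVI21daY51TS" ∷
  "4076NMRQJFCUOPIEDW89ABHG23KLXV1baX51TS4076NMRQJFCUOPIEDW89ABHG23KLVY1a2Z1Z0a1O1O0O2M2M1U1I2W" ∷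
  "2Y1X0Z1G0X1X0M1U1102Y0123456789ABCDEFGHIJKLMNOPQRSTUVWX621KoYM7PO4N6198HGLKIJBAEFCD50ST32QRX" ∷
  "WVUI2Z2G1Z0Z1G0U21N7YKSHVE5OBIM2GC09J7P4NLWF83RA61TDQXUM21NfYJGRXI92O0C1354FLAQ8DNUME7PSB6HK" ∷
  "TWV1MNXKSHVE5OBIM2GC09J7P4NLWF83RA61TDQUS210TX0123456789ABCDEFGHIJKLMNOPQRSTUVWG2O21GiYH9LK6" ∷
  "G4871MNPOQR50ST23BAEFDCIJWXVU62X2X0X0I21ffYGI9JO2EMBS8F6A3X5K1THVP7LDN40CQRWU1FiXPMDLO7EIBS8" ∷
  "FA63RK5HV1TG29JC04NQWUO2101XDPATMLO7IE2GC09JBS8FK54N61QRHWUV362W2X1X0M21eUYA8DC6B94HGLKP3SVI" ∷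
  "JO2TX1750NMEFQRWUX2X1Y0X1Y0W2101XIO2GMEP7DLATC85W3H0FK94N16QRSBUVJM21ccXA8DC6B94HGLKP3SVIJO2" ∷
  "TW1750NMEFQRUU2I21ciY2I0COGEMSB5K1THV8F6A3XP7LDN49JQRUWZ1X1X0X2X2Z1Y0Z1Y0X1Z1Y0O2S210xY01234" ∷
  "56789ABCDEFGHIJKLMNOPQRSTUVXWG21HQYH9LK6G4871MNPOQR50ST23BAEFDCIJXWVU10bXDPATMLO7IE2GC09JBS8" ∷
  "FK54N61QRHWUV3S210pX0123456789ABCDEFGHIJKLMNOPQRSTUVWG210fX0123456789ABCDEFGHIJKLMNOPQRSTUVW" ∷
  "10AW0123456789ABCDEFGHIJKLMNOPQRSTUVU1Y2Y2X1X062O1O0I11PZYH9KL6G48170532STMNOPQRABCDFEIJXVUW" ∷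
  "Y1101X0123456789ABCDEFGHIJKLMNOPQRSTUVWX1Y1Y1U2I1U1M1W1G1S3Z1O0O1O0000WXM1U1I1W1G1105Y012345" ∷
  "6789ABCDEFGHIJKLMNOPQRSTUVWX000KLX3Y4Y4I2I1U3M1W1G1S4N3Z1O0O1O0000WX000KL101Y012354STEUOBIM8" ∷
  "FQVCNWXDJAPGR679HKL000WXN1W1G1S2M1M0000WX000KLI1101Y0123456789ABCDEFGHIJKLMNOPQRSTUVWXM11imY" ∷
  "A8CD6B49170523STMNOPQRHGKLJIEFVXUWN3Z261Z1a1S0S1Z1a16062Z1Z0I2Z1Z0U2Z1O1M1M0M21PbY6849BAEFSO" ∷
  "U5VQ1TIM2G7PR3NJK0CDHWXLW2O1O01OsXS5EU1T406798HGBANMRQOP23ICKFJDVLW100XM7OP4N6189BAEFCDGHIJK" ∷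
  "L0523STQRUVW000KLM1Y11jIYA8CD6B49170523STMNOPQRHGKLJIEFVWUXY1105X0123456789ABCDEFGHIJKLMNOPQ" ∷
  "RSTUVW000KLN1U3U3Y2Y1S1G1O2O0000WXS1G1Y1O2O0000WXI21cIY0123456789BAFECDGHIJKLMNOPRQSTWXUV631" ∷
  "L9YN7RQ4M6189BAFECDGHIJKL50ST32OPXWUVO2Y1Y0Y1Y01KyXN7RQ4M6189BAFECDGHIJKL50ST32OPVWUM2Y2O1O0" ∷
  "O1O0W21JTY51TS406798GHJIKLBAEFCDMNOPRQ23WXUVG2Z2Z1I0I1Z0S31irY01234576MNOPIEDXRQJWCU89ABHGTS" ∷
  "KLFV1inX012354TSDJAPC8MLRGNWI9EUOBKQ76HVF1ioX01234576MNOPIEDVRQJWCU89ABHGTSKLFI2U21clY012345" ∷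
  "6789BAFECDGHIJKLMNOPRQSTXWUVM21O4YG9JI6H4871NMRQOP0523STABCDFEKLWXUVW210AYM7OP4N6189BAEFCDGH" ∷
  "IJKL0523STQRUVXWG2S3S1a0S1a0S2a0a0S31hxY51TS4076NMRQJFCUOPIEDX89ABHG23KLWV1hmXJRTGNF7Q4M1650" ∷
  "89OPEIDLCUA2KSBWHV31hnX51TS4076NMRQJFCUOPIEDV89ABHG23KLWU210dX0123456789ABCDEFGHIJKLMNOPQRST" ∷
  "UVWM2631JIY105423ICOGEMSB7P9J6HRWAQ8DUNFXKTVL1JEX105423ICOGEMSB7P9J6HRWAQ8DUNFLKTV1JFXRFJNB3" ∷
  "E8OSIMG27PU5QK1TA6CD940VHWLW210SXM7OP4N6189BAEFCDGHIJKL0523STQRUVWG210AXM7OP4N6189BAEFCDGHIJ" ∷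
  "KL0523STQRUVWS31gHX51TS4076NMRQJFCUOPIEDW89ABHG23KLV1g9WJRTGNF7Q4M165089OPEIDLCUA2KSB3HV1gAW" ∷
  "51TS4076NMRQJFCUOPIEDV89ABHG23KLM2U210nY0123456789ABCDEFGHIJKLMNOPQRSTUVXWI21OdYG9JI6H4871NM" ∷
  "RQOP0523STABCDFEKLXWUV10DX0123456789ABCDEFGHIJKLMNOPQRSTUVWU210gX0123456789ABCDEFGHIJKLMNOPQ" ∷
  "RSTUVWI210OX0123456789ABCDEFGHIJKLMNOPQRSTUVW10AW0123456789ABCDEFGHIJKLMNOPQRSTUV000KL000ST0" ∷
  "00EF000OP000IJ101V0123456789ABCDEFHGKLIJMNOPQRSTU000KL00023101V51ST406789ABCDEFGHIJKLMNOPQR2" ∷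
  "3U000ST000CD101V0123456789BAEFCDGHIJKLMNOPQRSTU000EF103V0123456798GHIJKLABCDEFMNOPQRSTU000IJ" ∷
  "105V0123456798HGKLIJABCDEFMNOPQRSTU000KLF5108VG9IJ6H4871NMQROP0523STBAEFCDKLUT510DV012345678" ∷
  "9ABCDEFGHIJKLMNOPQRSTUL310IVA8CD6B4971NMQROP0523STHGKLIJEFUV310LVN7QR4M6198GHIJKLABCDEF0523S" ∷
  "TOPUH310OVG9IJ6H481750ST23NMQROPABCDEFKLUR310RV51ST406789BAEFCDGHIJKLNMQROP23UN3131VB8EF6A49" ∷
  "71MNOPQR50ST23GHIJKLCDUU3U31gaW0123456789ABCDEFGHIJKLMNOPRQSTUVI21QoW0123456789BAFECDGHIJKLM" ∷
  "NOPRQSTUV621JvWN7RQ4M6189BAFECDGHIJKL50ST32OPVUM2X3X31kPYA8CDB6EFSOI5QG1TMK7P2H3R0JUN49WXVL1" ∷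
  "kFXA8CDB6EFSOI5QG1TMK7P2H3R0JUN49LWVW31iqYN7QR4M6198GHIJKLBAEFCD0523TSOPUXVW14HX30FJ124576NM" ∷
  "RQOP89BAHGSTEIUDKCWLVO1Z1Z0O21kNXA8CD6B49170523STMNOPQRGHIJLKEFUWVX11kPXA8CDB6EFSOI5QG1TMK7P" ∷
  "2H3R0JUN49LWVX2105X0123456789ABCDEFGHIJKLMNOPQRSTUVWO11kTXA8CD6B49170523STMNOPQRGHIJLKEFUWVS" ∷
  "2X3X31jbYOMEK7P4N6189BAGH0532STQRICUFJVWXDL1jDXOMEK7P4N6189BAGH0532STQRICUFJVLWD1CpX01324567" ∷
  "89BAFECDGHJIKLMNPORQTSUVWO21jGXB8EF6A4971MNOPQR0523STGHIJLKCDUWVX11jIXOMEK7P4N6189BAGH0532ST" ∷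
  "QRICUFJVLWDX21CvX0132456789BAFECDGHJIKLMNPORQTSUVWO11jMXB8EF6A4971MNOPQR0523STGHIJLKCDUWVG21" ∷
  "8oW01234576MNOPKEDJQRCIFU89ABHGSTLVW316SW0132456789BAFEDCGHJIKLMNPORQTSUVO214TW0132456789BAF" ∷
  "EDCGHJILKMNPORQTSUVX1Y1Z1Y0100V01324576MNPOJDEKQRICFU89BAGHSTL100V51ST406798GHIJKLABCDEFMNOP" ∷
  "QR23UI2102VH9KL6G4871MNOPQR50ST23ABCDEFIJUU2104V0123456789ABCDEFGHIJKLMNOPQRSTUO2106VB8EF6A4" ∷
  "971MNOPQR0523STGHIJKLCDUW2108V4761NMQRICGS9JE52AK08DFLB3HTOPUG210AV6948HGKL2O0C13QAEMSB7PRTN" ∷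
  "F5DIJUS210CV416750STEIBO8FKMQGCN9JLDHRAP23UM210FVA8CD6B4971NMQROP50ST23HGKLIJEFU20U0147NQIGJ" ∷
  "3FRLT5SEB869HKOMPDAC21X1X1Y1X0100U51ST406798GHIJKLABCDEFMNOPQR23615114ZWM7OP4N6198HGKLIJBAEF" ∷
  "CD50ST32QRUV000KL000OP000EF000ST000IJ101U0123456789ABCDEFHGKLIJMNOPQRST000KL00023101U51ST406" ∷
  "789ABCDEFGHIJKLMNOPQR23000ST000CD101U0123456789BAEFCDGHIJKLMNOPQRST000EF103U0123456798GHIJKL" ∷
  "ABCDEFMNOPQRST000IJ105U0123456798HGKLIJABCDEFMNOPQRST000KL" ∷
  [])

-- One list for each girth: girth 4 serves `k = 3` and `k = 4`, girth 6 serves 6 and 7, girth 8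
-- serves 9 and 10. The order bound of a search is the largest order wanted for its girth.
targets₄ targets₅ targets₆ targets₇ targets₈ : List Graph
targets₄ = K₃,₃ ∷ cube ∷ twistedCube ∷ []
targets₅ = petersen ∷ []
targets₆ = heawood ∷ pappus ∷ möbiusKantor ∷ girthSix₁ ∷ girthSix₂ ∷ girthSix₃ ∷ girthSix₄ ∷ []
targets₇ = mcGee ∷ []
targets₈ = tutteCoxeter ∷ G10 ∷ []

cubic₄ : All Cubic targets₄
cubic₄ = cubicᵇ⇒Cubic K₃,₃ refl ∷ cubicᵇ⇒Cubic cube refl ∷ cubicᵇ⇒Cubic twistedCube refl ∷ []

searched₄ : is-just (Search.check 8 1 (map labelled targets₄) certificate₄ (partialGraph 1 []) []) ≡ true
searched₄ = refl

cubic₅ : All Cubic targets₅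
cubic₅ = cubicᵇ⇒Cubic petersen refl ∷ []

searched₅ : is-just (Search.check 10 2 (map labelled targets₅) certificate₅ (partialGraph 1 []) []) ≡ true
searched₅ = refl

cubic₆ : All Cubic targets₆
cubic₆ = cubicᵇ⇒Cubic heawood refl ∷ cubicᵇ⇒Cubic pappus refl ∷ cubicᵇ⇒Cubic möbiusKantor refl ∷
  cubicᵇ⇒Cubic girthSix₁ refl ∷ cubicᵇ⇒Cubic girthSix₂ refl ∷ cubicᵇ⇒Cubic girthSix₃ refl ∷ cubicᵇ⇒Cubic girthSix₄ refl ∷ []

searched₆ : is-just (Search.check 18 3 (map labelled targets₆) certificate₆ (partialGraph 1 []) []) ≡ true
searched₆ = refl

cubic₇ : All Cubic targets₇
cubic₇ = cubicᵇ⇒Cubic mcGee refl ∷ []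

searched₇ : is-just (Search.check 24 4 (map labelled targets₇) certificate₇ (partialGraph 1 []) []) ≡ true
searched₇ = refl

cubic₈ : All Cubic targets₈
cubic₈ = cubicᵇ⇒Cubic tutteCoxeter refl ∷ cubicᵇ⇒Cubic G10 refl ∷ []

searched₈ : is-just (Search.check 34 5 (map labelled targets₈) certificate₈ (partialGraph 1 []) []) ≡ true
searched₈ = refl


-- Lower bounds on the path-width

range : ∀ a {P : ℕ → Set} → P a → P (1 + a) → P (2 + a) → P (3 + a) → ∀ m → a ≤ m → m ≤ a + 3 → P m
range a {P} p₀ p₁ p₂ p₃ m a≤m m≤a+3 = subst P (m∸n+n≡m a≤m) (go (m ∸ a) (m≤n+o⇒m∸n≤o m a m≤a+3))
  where
  go : ∀ d → d ≤ 3 → P (d + a)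
  go 0 _ = p₀
  go 1 _ = p₁
  go 2 _ = p₂
  go 3 _ = p₃
  go (suc (suc (suc (suc _)))) (s≤s (s≤s (s≤s ())))

module PathWidth (G : Graph) (cubic : Cubic G) where
  open Density G cubic
  open Sparsity G cubic

  Blocked : (w m : ℕ) → Set
  Blocked w m = ∀ S → count S ≡ m → inner S + w < 3 * count S

  by-sparse : ∀ {c m w n} → Sparse c m → {T (n ≤ᵇ m)} → {T (c + w <ᵇ n)} → Blocked w n
  by-sparse {n = n} sparse {n≤m} {c+w<n} S refl =
    sparse-blocks sparse S (≤ᵇ⇒≤ n _ n≤m) (<ᵇ⇒< _ n c+w<n)

  by-forest : ∀ {g w n} → Girth≥ (2 + g) G → {T (0 <ᵇ n)} → {T (n <ᵇ 2 + g)} → {T (w ≤ᵇ n)} → Blocked w n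
  by-forest {n = n} girth {0<n} {n<g} {w≤n} S refl =
    forest-blocks S (forest girth S (<ᵇ⇒< 0 n 0<n) (<ᵇ⇒< n _ n<g)) (≤ᵇ⇒≤ _ n w≤n)

  -- The whole vertex set has three times its size as `inner` and violates sparsity, so it has more
  -- than `m` elements. This supplies the condition that `G` is large enough for a cut of size `a`.
  sparse⇒order : ∀ {m} → Sparse 0 m → m < order G
  sparse⇒order {m} sparse = ≰⇒> λ n≤m → <⇒≱ (order>0 G) (+-cancelˡ-≤ (2 * order G) _ _ (begin
    2 * order G + order G       ≡⟨ +-comm (2 * order G) (order G) ⟩
    3 * order G                 ≡⟨ cong (3 *_) (count-true (order G)) ⟨
    3 * count full              ≡⟨ sum-*ˡ 3 (𝟙 ∘ full) ⟨
    sum (λ u → 3 * 𝟙 (full u))  ≡⟨ sum-cong-≗ (λ u → trans (sym (all-inside u)) (sym (+-identityʳ (deg full u)))) ⟩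
    inner full                  ≤⟨ sparse full (≤-trans (≤-reflexive (count-true (order G))) n≤m) ⟩
    2 * count full + 0          ≡⟨ cong (λ n → 2 * n + 0) (count-true (order G)) ⟩
    2 * order G + 0             ∎))
    where
    open ≤-Reasoning
    full : VertexSet
    full _ = true

    all-inside : ∀ u → deg full u ≡ 3
    all-inside u = trans (sum-cong-≗ (λ v → cong 𝟙 (∧-identityʳ (adj u v)))) (degree3 u)
      where open Graph G using (adj)

  width> : ∀ a w → a ≤ order G → {T (0 <ᵇ a)} →
           Blocked w a → Blocked w (1 + a) → Blocked w (2 + a) → Blocked w (3 + a) →
           ∀ D → w < width {G} D
  width> a w a≤n {0<a} b₀ b₁ b₂ b₃ = pathWidth> a w (<ᵇ⇒< 0 a 0<a) a≤n
    (λ S a≤S S≤ → range a {Blocked w} b₀ b₁ b₂ b₃ (count S) a≤S S≤ S refl)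

  ≤-order : ∀ {a m} → Sparse 0 m → {T (a ≤ᵇ suc m)} → a ≤ order G
  ≤-order {a} sparse {a≤} = ≤-trans (≤ᵇ⇒≤ a _ a≤) (sparse⇒order sparse)

  private
    ≤! : ∀ {m n} → {T (m ≤ᵇ n)} → m ≤ n
    ≤! {m} {n} {t} = ≤ᵇ⇒≤ m n t

  -- A forest has fewer edges than vertices, which blocks the size `n = w` too, where `c = 0` would
  -- require `w < n`. This opens the window for girth 4, 5 and 6.
  girth4⇒width>2 : Girth≥ 4 G → ∀ D → 2 < width {G} D
  girth4⇒width>2 girth = width> 2 2 (≤-order sparse) (by-forest girth) (by-forest girth) (by-sparse sparse)
    (by-sparse (sparse-suc ≤! sparse))
    where
    sparse : Sparse 0 4
    sparse = sparse-girth girth 1 0 ≤! ≤!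

  girth5⇒width>4 : Girth≥ 5 G → ∀ D → 4 < width {G} D
  girth5⇒width>4 girth = width> 4 4 (≤-order sparse) (by-forest girth) (by-sparse sparse) (by-sparse sparse)
    (by-sparse (sparse-suc ≤! sparse))
    where
    sparse : Sparse 0 6
    sparse = sparse-girth girth 1 1 ≤! ≤!

  girth6⇒width>5 : Girth≥ 6 G → ∀ D → 5 < width {G} D
  girth6⇒width>5 girth = width> 5 5 (≤-order sparse) (by-forest girth) (by-sparse sparse) (by-sparse sparse)
    (by-sparse (sparse-suc ≤! sparse))
    where
    sparse : Sparse 0 7
    sparse = sparse-girth girth 2 1 ≤! ≤!

  -- Sizes 8 and 9 have `c = 0`, size 10 has `c = 2`. At size 11 two uses of `sparse-suc` would give
  -- `c = 4`, and `4 + 7` is not below 11; `sparse-2+` keeps `c = 2`. The last size is critical in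
  -- the same way for girth 8 and 9.
  girth7⇒width>7 : Girth≥ 7 G → ∀ D → 7 < width {G} D
  girth7⇒width>7 girth = width> 8 7 (≤-order sparse) (by-sparse sparse) (by-sparse sparse)
    (by-sparse (sparse-suc ≤! sparse)) (by-sparse (sparse-2+ ≤! ≤! sparse))
    where
    sparse : Sparse 0 9
    sparse = sparse-girth girth 2 2 ≤! ≤!

  girth8⇒width>8 : Girth≥ 8 G → ∀ D → 8 < width {G} D
  girth8⇒width>8 girth = width> 9 8 (≤-order sparse) (by-sparse sparse) (by-sparse sparse)
    (by-sparse (sparse-suc ≤! sparse)) (by-sparse (sparse-2+ ≤! ≤! sparse))
    where
    sparse : Sparse 0 10
    sparse = sparse-girth girth 3 2 ≤! ≤!

  girth9⇒width>10 : Girth≥ 9 G → ∀ D → 10 < width {G} D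
  girth9⇒width>10 girth = width> 11 10 (≤-order sparse) (by-sparse sparse) (by-sparse sparse)
    (by-sparse (sparse-suc ≤! sparse)) (by-sparse (sparse-2+ ≤! ≤! sparse))
    where
    sparse : Sparse 0 12
    sparse = sparse-girth girth 3 3 ≤! ≤!

neighbourTable : ∀ G → Vec (List (Vertex G)) (order G)
neighbourTable G = Vec.tabulate (λ v → members (Graph.adj G v))

neighbourTable-correct : ∀ G v → Vec.lookup (neighbourTable G) v ≡ members (Graph.adj G v)
neighbourTable-correct G = Vec.lookup∘tabulate (λ v → members (Graph.adj G v))

module Checks {n} (table : Vec (List (Fin n)) n) where
  open CoreSearch table

  everywhere : (Fin n → Bool) → Bool
  everywhere p = all p (allFin n)

  -- No walk of at most ℓ steps from c that never backtracks, the first step not back to p,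
  -- ends in s.
  noReturn : ℕ → (s p c : Fin n) → Bool
  noReturn zero    s p c = true
  noReturn (suc ℓ) s p c =
    all (λ x → (x == p) ∨ (not (x == s) ∧ noReturn ℓ s c x)) (ns c)

  noCycles noCores′ noTight′ noBridge′ : ℕ → Bool
  noCycles  g = everywhere (λ s → noReturn g s s s)
  noCores′  m = everywhere (λ v → noCores m (v ∷ ns v))
  noTight′  m = everywhere (λ v → noTight m v (ns v) (v ∷ ns v))
  noBridge′ m = everywhere (λ v → cores (2 + m) (suc m) (bridgeless m) (v ∷ ns v))

module Checked (G : Graph) (cubic : Cubic G) where
  open Graph G using (adj; Adj)
  open Walks G
  open Density G cubic
  open Sparsity G cubic
  open PathWidth G cubic
  open CoreSearch (neighbourTable G)
  open Concrete G cubic (neighbourTable G) (neighbourTable-correct G)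
  open Checks (neighbourTable G)

  everywhere⁻ : ∀ {p} → everywhere p ≡ true → ∀ v → T (p v)
  everywhere⁻ ok v = All.lookup (All.all⁺ _ (allFin (order G)) (≡⇒T ok)) (∈-allFin v)

  private
    return-step : ∀ ℓ s p c {x} → T (noReturn (suc ℓ) s p c) → Adj c x → x ≢ p →
                  x ≢ s × T (noReturn ℓ s c x)
    return-step ℓ s p c {x} t cx x≢p
      with T∨⁻ {x == p} (all-ns (λ x → (x == p) ∨ (not (x == s) ∧ noReturn ℓ s c x)) t cx)
    ... | inj₁ x≡p = contradiction (==⇒≡ x p x≡p) x≢p
    ... | inj₂ t′  = let x≢s , t″ = T∧⁻ {not (x == s)} t′
                     in (λ { refl → Tnot⁻ x≢s (==-refl x) }) , t″

    no-return : ∀ ℓ {s p c} l → T (noReturn ℓ s p c) → Linked Adj (c ∷ l ∷ʳ s) → p ∉ l → p ≢ s →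
                Unique (c ∷ l) → s ∉ c ∷ l → ¬ (suc (length l) ≤ ℓ)
    no-return (suc ℓ) {s} {p} {c} [] t (cs ∷ _) _ p≢s _ _ _ =
      proj₁ (return-step ℓ s p c t cs (p≢s ∘ sym)) refl
    no-return (suc ℓ) {s} {p} {c} (x ∷ l) t (cx ∷ linked) p∉ p≢s (c∉ ∷ u) s∉ (s≤s len) =
      no-return ℓ l (proj₂ (return-step ℓ s p c t cx (λ { refl → p∉ (here refl) }))) linked
        (λ c∈ → All.lookup c∉ (there c∈) refl) (λ { refl → s∉ (here refl) }) u (s∉ ∘ there) len

  girth-by-search : ∀ g → noCycles g ≡ true → Girth≥ (suc g) G
  girth-by-search g ok cycle@record { size = refl } = let open Cycle cycle in
    ≰⇒> (go g start rest (everywhere⁻ {λ s → noReturn g s s s} ok start) (Cycle.distinct cycle) closed 3≤ℓ)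
    where
    go : ∀ g s rest → T (noReturn g s s s) → Unique (s ∷ rest) → Linked Adj (s ∷ rest ∷ʳ s) →
         3 ≤ length (s ∷ rest) → ¬ (length (s ∷ rest) ≤ g)
    go g s (_ ∷ []) _ _ _ (s≤s (s≤s ()))
    -- The first two steps are split off: there the vertex not to be stepped back to is `s` itself,
    -- contrary to the assumption `p ≢ s` of `no-return`.
    go (suc (suc g)) s (x ∷ y ∷ l) t (s∉ ∷ x∉ ∷ u) (sx ∷ xy ∷ linked) _ (s≤s (s≤s len)) =
      no-return g l
        (proj₂ (return-step g s s x (proj₂ (return-step (suc g) s s s t sx (All.lookup s∉ (here refl) ∘ sym))) xy
          (All.lookup s∉ (there (here refl)) ∘ sym)))
        linked (λ x∈ → All.lookup x∉ (there x∈) refl) (All.lookup s∉ (here refl) ∘ sym) u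
        (λ s∈ → All.lookup s∉ (there s∈) refl) len

  -- Girth 4 gives `c = 0` up to 4 vertices. Size 5 amounts to the absence of a complete bipartite
  -- subgraph with parts of 2 and 3 vertices; `K₃,₃` contains one, the two cubes do not.
  sparse⇒width>3 : Girth≥ 4 G → noCores′ 5 ≡ true → ∀ D → 3 < width {G} D
  sparse⇒width>3 girth ok = width> 3 3 (≤-order sparse) (by-forest girth) (by-sparse sparse) (by-sparse sparse)
    (by-sparse (sparse-suc (≤ᵇ⇒≤ 4 5 _) sparse))
    where
    sparse : Sparse 0 5
    sparse = sparse-by-search 5 (everywhere⁻ ok)

  -- At size 10 the bound `c = 4` fails, since `4 + 6` is not below 10. The shape to be excluded
  -- there has 4 vertices of degree 3 and 6 of degree 2, a cubic multigraph on 4 vertices with every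
  -- edge subdivided once.
  sparse⇒width>6 : noCores′ 8 ≡ true → noTight′ 10 ≡ true → ∀ D → 6 < width {G} D
  sparse⇒width>6 ok ok′ = width> 7 6 (≤-order sparse) (by-sparse sparse) (by-sparse sparse)
    (by-sparse (sparse-suc (≤ᵇ⇒≤ 4 8 _) sparse))
    (by-sparse (sparse-tight (≤ᵇ⇒≤ 5 8 _) refl sparse (noTight-sound 10 (everywhere⁻ ok′))))
    where
    sparse : Sparse 0 8
    sparse = sparse-by-search 8 (everywhere⁻ ok)

  -- Size 13 is where `sparse-bridge` is needed: `sparse-2+` keeps `c = 2` only up to 12 vertices,
  -- and `c = 4` would fail because `4 + 9` is not below 13. At size 15 the tight shape is a cubic
  -- multigraph on 6 vertices with every edge subdivided once.
  sparse⇒width>9 : 12 ≤ order G → Girth≥ 8 G → noBridge′ 10 ≡ true → noTight′ 15 ≡ true → ∀ D → 9 < width {G} D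
  sparse⇒width>9 large girth ok ok′ = width> 12 9 large (by-sparse sparse₁₃) (by-sparse sparse₁₃)
    (by-sparse (sparse-suc (≤ᵇ⇒≤ 6 13 _) sparse₁₃))
    (by-sparse (sparse-tight (≤ᵇ⇒≤ 7 13 _) refl sparse₁₃ (noTight-sound 15 (everywhere⁻ ok′))))
    where
    sparse₁₃ : Sparse 2 13
    sparse₁₃ = sparse-bridge 10 (≤ᵇ⇒≤ 17 20 _) (≤ᵇ⇒≤ 5 10 _) (≤ᵇ⇒≤ 8 10 _)
      (sparse-girth girth 3 2 (≤ᵇ⇒≤ 8 8 _) (≤ᵇ⇒≤ 7 8 _)) (everywhere⁻ ok)

cycle : ∀ G (s : Vertex G) (rest : List (Vertex G)) →
  {True (DecUnique.unique? Fin._≟_ (s ∷ rest))} →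
  {True (linked? (λ u v → T? (Graph.adj G u v)) (s ∷ rest ∷ʳ s))} →
  {True (3 ≤? length (s ∷ rest))} → Cycle G (length (s ∷ rest))
cycle G s rest {u} {l} {3≤} = record
  { start = s ; rest = rest ; distinct = toWitness u ; closed = toWitness l ; size = refl ; 3≤ℓ = toWitness 3≤ }


-- The theorem

cubicOf : ∀ {k g} H (cubic : Cubic H) → Cycle H (suc g) → Checks.noCycles (neighbourTable H) g ≡ true →
  (Σ (PathDecomposition H) λ D → width D ≤ k) → (Girth≥ (suc g) H → ∀ D → k ≤ width {H} D) →
  CubicOf k (suc g) H
cubicOf {g = g} H cubic cyc ok upper lower =
  cubic , (cyc , λ _ → girth) , hasPathWidth upper (lower girth)
  where
  girth : Girth≥ (suc g) H
  girth = Checked.girth-by-search H cubic g ok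

girth≥ : ∀ {k g G} → CubicOf k g G → Girth≥ g G
girth≥ (_ , (_ , minimal) , _) = minimal _

isξ : ∀ k g H → CubicOf k g H →
      (∀ G → Cubic G → Girth≥ (suc g) G → ∀ D → k < width {G} D) → Isξ k g
isξ k g H witness wide = (H , witness) , λ { g′ (G , c@(cubic , _ , (D , refl) , _)) →
  ≮⇒≥ λ g<g′ → <-irrefl refl (wide G cubic (λ cyc → ≤-trans g<g′ (girth≥ c cyc)) D) }

smallest : ∀ k g H → CubicOf k g H → (∀ G → CubicOf k g G → order G ≤ order H → order G ≡ order H) →
           Smallest (CubicOf k g) H
smallest k g H PH same = PH , least
  where
  least : ∀ G → CubicOf k g G → order H ≤ order G
  least G PG with order G ≤? order H
  ... | yes G≤H = ≤-reflexive (sym (same G PG G≤H))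
  ... | no  G≰H = <⇒≤ (≰⇒> G≰H)

uniqueSmallest : ∀ k g H → CubicOf k g H → (∀ G → CubicOf k g G → order G ≤ order H → G ≅ H) →
                 UniqueSmallest (CubicOf k g) H
uniqueSmallest k g H PH iso =
  smallest k g H PH (λ G PG G≤H → ≅⇒order≡ (iso G PG G≤H)) ,
  λ G (PG , G-least) → iso G PG (G-least H PH)

too-big : ∀ {G H} {A : Set} → G ≅ H → order G < order H → A
too-big iso G<H = contradiction (≅⇒order≡ iso) (<⇒≢ G<H)

too-thin : ∀ {k g w G H} {A : Set} → CubicOf k g G → G ≅ H → (Σ (PathDecomposition H) λ D → width D ≤ w) →
           {T (w <ᵇ k)} → A
too-thin {w = w} (_ , _ , hasWidth) iso (D , D≤w) {w<k} =
  contradiction (pathWidth≤ hasWidth (proj₁ moved , ≤-trans (≤-reflexive (proj₂ moved)) D≤w))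
    (<⇒≱ (<ᵇ⇒< w _ w<k))
  where moved = transport iso D

-- The parity of the labels is a proper 2-colouring of the cube, whereas the chord between 1 and 5
-- closes the odd cycle 1, 2, 3, 4, 5 in the twisted cube. The colouring pulled back along `from`
-- would alternate on it.
cube≇twistedCube : ¬ (cube ≅ twistedCube)
cube≇twistedCube iso = not-¬ refl (begin
  c′ (# 0)                          ≡⟨ alternates (# 4) (# 0) _ ⟩
  not (c′ (# 4))                    ≡⟨ cong not (alternates (# 3) (# 4) _) ⟩
  not (not (c′ (# 3)))              ≡⟨ not-involutive (c′ (# 3)) ⟩
  c′ (# 3)                          ≡⟨ alternates (# 2) (# 3) _ ⟩
  not (c′ (# 2))                    ≡⟨ cong not (alternates (# 1) (# 2) _) ⟩
  not (not (c′ (# 1)))              ≡⟨ not-involutive (c′ (# 1)) ⟩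
  c′ (# 1)                          ≡⟨ alternates (# 0) (# 1) _ ⟩
  not (c′ (# 0))                    ∎)
  where
  open ≡-Reasoning
  open _≅_ iso
  open Inverse bijection using (to; from; strictlyInverseˡ)

  even : ℕ → Bool
  even zero    = true
  even (suc n) = not (even n)

  c : Vertex cube → Bool
  c v = even (toℕ v)

  bipartite : ∀ u v → Graph.Adj cube u v → c v ≡ not (c u)
  bipartite = toWitness
    {a? = Fin.all? λ u → Fin.all? λ v → T? (Graph.adj cube u v) →-dec (c v Bool.≟ not (c u))} _

  c′ : Vertex twistedCube → Bool
  c′ = c ∘ from

  alternates : ∀ u v → Graph.Adj twistedCube u v → c′ v ≡ not (c′ u)
  alternates u v uv = bipartite (from u) (from v) (subst T (sym (begin
    Graph.adj cube (from u) (from v)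
      ≡⟨ preserves-adj (from u) (from v) ⟩
    Graph.adj twistedCube (to (from u)) (to (from v))
      ≡⟨ cong₂ (Graph.adj twistedCube) (strictlyInverseˡ u) (strictlyInverseˡ v) ⟩
    Graph.adj twistedCube u v ∎)) uv)


-- Explicit path-decompositions, girth and path-width of the extremal graphs

K₃,₃-width : Σ (PathDecomposition K₃,₃) λ D → width D ≤ 3
K₃,₃-width = Intervals.decomposition K₃,₃ (
  (0 , 3) ∷ (4 , 4) ∷ (5 , 5) ∷ (2 , 5) ∷ (1 , 5) ∷ (3 , 5) ∷ []) 3 refl

cube-width : Σ (PathDecomposition cube) λ D → width D ≤ 4
cube-width = Intervals.decomposition cube (
  (5 , 7) ∷ (3 , 6) ∷ (1 , 3) ∷ (0 , 6) ∷ (6 , 7) ∷ (7 , 7) ∷ (4 , 7) ∷ (2 , 5) ∷ []) 4 refl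

twistedCube-width : Σ (PathDecomposition twistedCube) λ D → width D ≤ 4
twistedCube-width = Intervals.decomposition twistedCube (
  (7 , 7) ∷ (5 , 7) ∷ (6 , 6) ∷ (0 , 6) ∷ (4 , 7) ∷ (2 , 5) ∷ (1 , 3) ∷ (3 , 7) ∷ []) 4 refl

petersen-width : Σ (PathDecomposition petersen) λ D → width D ≤ 5
petersen-width = Intervals.decomposition petersen (
  (3 , 5) ∷ (4 , 9) ∷ (9 , 9) ∷ (0 , 9) ∷ (1 , 3) ∷ (5 , 8) ∷ (7 , 7) ∷ (8 , 9) ∷ (6 , 7) ∷
  (2 , 8) ∷ []) 5 refl

heawood-width : Σ (PathDecomposition heawood) λ D → width D ≤ 6
heawood-width = Intervals.decomposition heawood (
  (6 , 10) ∷ (4 , 7) ∷ (7 , 13) ∷ (8 , 11) ∷ (1 , 9) ∷ (0 , 3) ∷ (2 , 5) ∷ (5 , 12) ∷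
  (11 , 11) ∷ (10 , 11) ∷ (3 , 13) ∷ (13 , 13) ∷ (12 , 13) ∷ (9 , 12) ∷ []) 6 refl

pappus-width : Σ (PathDecomposition pappus) λ D → width D ≤ 7
pappus-width = Intervals.decomposition pappus (
  (15 , 17) ∷ (17 , 17) ∷ (10 , 17) ∷ (8 , 11) ∷ (11 , 12) ∷ (4 , 15) ∷ (1 , 5) ∷ (5 , 16) ∷
  (16 , 17) ∷ (9 , 16) ∷ (2 , 9) ∷ (0 , 3) ∷ (3 , 7) ∷ (6 , 13) ∷ (13 , 13) ∷ (12 , 14) ∷
  (14 , 14) ∷ (7 , 15) ∷ []) 7 refl

mcGee-width : Σ (PathDecomposition mcGee) λ D → width D ≤ 8
mcGee-width = Intervals.decomposition mcGee (
  (14 , 15) ∷ (13 , 18) ∷ (18 , 22) ∷ (22 , 23) ∷ (5 , 22) ∷ (3 , 5) ∷ (1 , 3) ∷ (0 , 9) ∷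
  (8 , 13) ∷ (11 , 12) ∷ (12 , 20) ∷ (16 , 16) ∷ (15 , 17) ∷ (17 , 17) ∷ (9 , 23) ∷ (23 , 23) ∷
  (21 , 23) ∷ (20 , 21) ∷ (2 , 20) ∷ (19 , 19) ∷ (10 , 19) ∷ (6 , 11) ∷ (4 , 7) ∷ (7 , 21) ∷ []) 8 refl

tutteCoxeter-width : Σ (PathDecomposition tutteCoxeter) λ D → width D ≤ 9
tutteCoxeter-width = Intervals.decomposition tutteCoxeter (
  (25 , 25) ∷ (22 , 25) ∷ (14 , 22) ∷ (19 , 19) ∷ (17 , 28) ∷ (28 , 29) ∷ (27 , 28) ∷
  (13 , 27) ∷ (26 , 26) ∷ (20 , 26) ∷ (16 , 20) ∷ (8 , 17) ∷ (6 , 9) ∷ (9 , 24) ∷ (23 , 23) ∷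
  (10 , 27) ∷ (5 , 11) ∷ (11 , 16) ∷ (15 , 18) ∷ (12 , 15) ∷ (7 , 13) ∷ (2 , 7) ∷ (1 , 3) ∷
  (3 , 5) ∷ (4 , 21) ∷ (21 , 26) ∷ (24 , 24) ∷ (18 , 29) ∷ (29 , 29) ∷ (0 , 29) ∷ []) 9 refl

G10-width : Σ (PathDecomposition G10) λ D → width D ≤ 10
G10-width = Intervals.decomposition G10 (
  (17 , 29) ∷ (27 , 27) ∷ (26 , 27) ∷ (24 , 26) ∷ (18 , 24) ∷ (14 , 19) ∷ (13 , 15) ∷
  (8 , 13) ∷ (4 , 9) ∷ (9 , 26) ∷ (25 , 32) ∷ (16 , 25) ∷ (21 , 21) ∷ (10 , 28) ∷ (28 , 30) ∷
  (29 , 29) ∷ (22 , 32) ∷ (32 , 33) ∷ (33 , 33) ∷ (11 , 33) ∷ (5 , 11) ∷ (2 , 5) ∷ (0 , 3) ∷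
  (3 , 22) ∷ (19 , 20) ∷ (20 , 23) ∷ (23 , 31) ∷ (31 , 33) ∷ (12 , 31) ∷ (30 , 30) ∷ (6 , 30) ∷
  (1 , 7) ∷ (7 , 16) ∷ (15 , 17) ∷ []) 10 refl

möbiusKantor-width : Σ (PathDecomposition möbiusKantor) λ D → width D ≤ 6
möbiusKantor-width = Intervals.decomposition möbiusKantor (
  (7 , 12) ∷ (11 , 15) ∷ (4 , 11) ∷ (3 , 5) ∷ (0 , 3) ∷ (1 , 7) ∷ (6 , 14) ∷ (8 , 9) ∷
  (9 , 13) ∷ (2 , 10) ∷ (10 , 14) ∷ (14 , 15) ∷ (15 , 15) ∷ (13 , 15) ∷ (5 , 13) ∷ (12 , 12) ∷ []) 6 refl

girthSix₁-width : Σ (PathDecomposition girthSix₁) λ D → width D ≤ 6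
girthSix₁-width = Intervals.decomposition girthSix₁ (
  (6 , 10) ∷ (10 , 17) ∷ (17 , 17) ∷ (16 , 17) ∷ (12 , 16) ∷ (5 , 15) ∷ (15 , 15) ∷ (14 , 15) ∷
  (7 , 16) ∷ (1 , 7) ∷ (0 , 3) ∷ (3 , 5) ∷ (4 , 9) ∷ (8 , 14) ∷ (13 , 17) ∷ (2 , 13) ∷
  (11 , 12) ∷ (9 , 11) ∷ []) 6 refl

girthSix₂-width : Σ (PathDecomposition girthSix₂) λ D → width D ≤ 6
girthSix₂-width = Intervals.decomposition girthSix₂ (
  (7 , 13) ∷ (13 , 16) ∷ (14 , 14) ∷ (8 , 15) ∷ (6 , 9) ∷ (9 , 11) ∷ (4 , 10) ∷ (10 , 12) ∷
  (12 , 17) ∷ (15 , 15) ∷ (3 , 16) ∷ (16 , 16) ∷ (11 , 17) ∷ (17 , 17) ∷ (5 , 17) ∷ (1 , 5) ∷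
  (0 , 3) ∷ (2 , 7) ∷ []) 6 refl

girthSix₃-width : Σ (PathDecomposition girthSix₃) λ D → width D ≤ 6
girthSix₃-width = Intervals.decomposition girthSix₃ (
  (7 , 12) ∷ (10 , 10) ∷ (4 , 14) ∷ (3 , 5) ∷ (5 , 13) ∷ (11 , 16) ∷ (9 , 11) ∷ (0 , 9) ∷
  (1 , 3) ∷ (2 , 7) ∷ (6 , 17) ∷ (13 , 15) ∷ (15 , 15) ∷ (14 , 15) ∷ (8 , 17) ∷ (17 , 17) ∷
  (16 , 17) ∷ (12 , 16) ∷ []) 6 refl

girthSix₄-width : Σ (PathDecomposition girthSix₄) λ D → width D ≤ 6
girthSix₄-width = Intervals.decomposition girthSix₄ (
  (5 , 9) ∷ (8 , 16) ∷ (16 , 17) ∷ (12 , 16) ∷ (6 , 15) ∷ (15 , 15) ∷ (14 , 15) ∷ (11 , 14) ∷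
  (4 , 12) ∷ (0 , 5) ∷ (1 , 3) ∷ (3 , 7) ∷ (7 , 17) ∷ (17 , 17) ∷ (13 , 17) ∷ (2 , 13) ∷
  (10 , 11) ∷ (9 , 10) ∷ []) 6 refl

K₃,₃-cubicOf : CubicOf 3 4 K₃,₃
K₃,₃-cubicOf = cubicOf K₃,₃ (cubicᵇ⇒Cubic K₃,₃ refl)
  (cycle K₃,₃ (# 0) (# 3 ∷ # 1 ∷ # 4 ∷ [])) refl
  K₃,₃-width (PathWidth.girth4⇒width>2 K₃,₃ (cubicᵇ⇒Cubic K₃,₃ refl))

cube-cubicOf : CubicOf 4 4 cube
cube-cubicOf = cubicOf cube (cubicᵇ⇒Cubic cube refl)
  (cycle cube (# 0) (# 1 ∷ # 2 ∷ # 7 ∷ [])) refl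
  cube-width (λ girth → Checked.sparse⇒width>3 cube (cubicᵇ⇒Cubic cube refl) girth refl)

twistedCube-cubicOf : CubicOf 4 4 twistedCube
twistedCube-cubicOf = cubicOf twistedCube (cubicᵇ⇒Cubic twistedCube refl)
  (cycle twistedCube (# 0) (# 1 ∷ # 2 ∷ # 7 ∷ [])) refl
  twistedCube-width (λ girth → Checked.sparse⇒width>3 twistedCube (cubicᵇ⇒Cubic twistedCube refl) girth refl)

petersen-cubicOf : CubicOf 5 5 petersen
petersen-cubicOf = cubicOf petersen (cubicᵇ⇒Cubic petersen refl)
  (cycle petersen (# 0) (# 1 ∷ # 2 ∷ # 3 ∷ # 4 ∷ [])) refl
  petersen-width (PathWidth.girth5⇒width>4 petersen (cubicᵇ⇒Cubic petersen refl))

heawood-cubicOf : CubicOf 6 6 heawood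
heawood-cubicOf = cubicOf heawood (cubicᵇ⇒Cubic heawood refl)
  (cycle heawood (# 0) (# 1 ∷ # 2 ∷ # 3 ∷ # 4 ∷ # 13 ∷ [])) refl
  heawood-width (PathWidth.girth6⇒width>5 heawood (cubicᵇ⇒Cubic heawood refl))

pappus-cubicOf : CubicOf 7 6 pappus
pappus-cubicOf = cubicOf pappus (cubicᵇ⇒Cubic pappus refl)
  (cycle pappus (# 0) (# 1 ∷ # 2 ∷ # 3 ∷ # 4 ∷ # 5 ∷ [])) refl
  pappus-width (λ _ → Checked.sparse⇒width>6 pappus (cubicᵇ⇒Cubic pappus refl) refl refl)

mcGee-cubicOf : CubicOf 8 7 mcGee
mcGee-cubicOf = cubicOf mcGee (cubicᵇ⇒Cubic mcGee refl)
  (cycle mcGee (# 0) (# 1 ∷ # 2 ∷ # 3 ∷ # 4 ∷ # 11 ∷ # 12 ∷ [])) refl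
  mcGee-width (PathWidth.girth7⇒width>7 mcGee (cubicᵇ⇒Cubic mcGee refl))

tutteCoxeter-cubicOf : CubicOf 9 8 tutteCoxeter
tutteCoxeter-cubicOf = cubicOf tutteCoxeter (cubicᵇ⇒Cubic tutteCoxeter refl)
  (cycle tutteCoxeter (# 0) (# 1 ∷ # 2 ∷ # 3 ∷ # 4 ∷ # 5 ∷ # 28 ∷ # 29 ∷ [])) refl
  tutteCoxeter-width (PathWidth.girth8⇒width>8 tutteCoxeter (cubicᵇ⇒Cubic tutteCoxeter refl))

G10-cubicOf : CubicOf 10 8 G10
G10-cubicOf = cubicOf G10 (cubicᵇ⇒Cubic G10 refl)
  (cycle G10 (# 0) (# 1 ∷ # 2 ∷ # 3 ∷ # 4 ∷ # 5 ∷ # 6 ∷ # 33 ∷ [])) refl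
  G10-width (λ girth → Checked.sparse⇒width>9 G10 (cubicᵇ⇒Cubic G10 refl) (≤ᵇ⇒≤ 12 34 _) girth refl refl)


-- Uniqueness of the smallest graphs

classified₄ : ∀ G → Cubic G → Girth≥ 4 G → order G ≤ 8 → Any (G ≅_) targets₄
classified₄ = classify 8 1 targets₄ certificate₄ searched₄ cubic₄

classified₅ : ∀ G → Cubic G → Girth≥ 5 G → order G ≤ 10 → Any (G ≅_) targets₅
classified₅ = classify 10 2 targets₅ certificate₅ searched₅ cubic₅

classified₆ : ∀ G → Cubic G → Girth≥ 6 G → order G ≤ 18 → Any (G ≅_) targets₆
classified₆ = classify 18 3 targets₆ certificate₆ searched₆ cubic₆

classified₇ : ∀ G → Cubic G → Girth≥ 7 G → order G ≤ 24 → Any (G ≅_) targets₇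
classified₇ = classify 24 4 targets₇ certificate₇ searched₇ cubic₇

classified₈ : ∀ G → Cubic G → Girth≥ 8 G → order G ≤ 34 → Any (G ≅_) targets₈
classified₈ = classify 34 5 targets₈ certificate₈ searched₈ cubic₈

≤-literal : ∀ {m n} → {T (m ≤ᵇ n)} → m ≤ n
≤-literal {m} {n} {t} = ≤ᵇ⇒≤ m n t

unique₃ : ∀ G → CubicOf 3 4 G → order G ≤ 6 → G ≅ K₃,₃
unique₃ G c G≤6 = among (classified₄ G (proj₁ c) (girth≥ c) (≤-trans G≤6 ≤-literal))
  where
  among : Any (G ≅_) targets₄ → G ≅ K₃,₃
  among (here iso)                 = iso
  among (there (here iso))         = too-big iso (s≤s (≤-trans G≤6 ≤-literal))
  among (there (there (here iso))) = too-big iso (s≤s (≤-trans G≤6 ≤-literal))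

unique₄ : ∀ G → CubicOf 4 4 G → order G ≤ 8 → (G ≅ cube) ⊎ (G ≅ twistedCube)
unique₄ G c G≤8 = among (classified₄ G (proj₁ c) (girth≥ c) G≤8)
  where
  among : Any (G ≅_) targets₄ → (G ≅ cube) ⊎ (G ≅ twistedCube)
  -- `K₃,₃` is smaller and has the same girth, but its path-width is only 3.
  among (here iso)                 = too-thin c iso K₃,₃-width
  among (there (here iso))         = inj₁ iso
  among (there (there (here iso))) = inj₂ iso

order₄ : ∀ G → CubicOf 4 4 G → order G ≤ 8 → order G ≡ 8
order₄ G c G≤8 = [ ≅⇒order≡ , ≅⇒order≡ ]′ (unique₄ G c G≤8)

unique₅ : ∀ G → CubicOf 5 5 G → order G ≤ 10 → G ≅ petersen
unique₅ G c G≤10 = among (classified₅ G (proj₁ c) (girth≥ c) G≤10)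
  where
  among : Any (G ≅_) targets₅ → G ≅ petersen
  among (here iso) = iso

unique₆ : ∀ G → CubicOf 6 6 G → order G ≤ 14 → G ≅ heawood
unique₆ G c G≤14 = among (classified₆ G (proj₁ c) (girth≥ c) (≤-trans G≤14 ≤-literal))
  where
  among : Any (G ≅_) targets₆ → G ≅ heawood
  among (here iso)                                                 = iso
  among (there (here iso))                                         = too-big iso (s≤s (≤-trans G≤14 ≤-literal))
  among (there (there (here iso)))                                 = too-big iso (s≤s (≤-trans G≤14 ≤-literal))
  among (there (there (there (here iso))))                         = too-big iso (s≤s (≤-trans G≤14 ≤-literal))
  among (there (there (there (there (here iso)))))                 = too-big iso (s≤s (≤-trans G≤14 ≤-literal))
  among (there (there (there (there (there (here iso))))))         = too-big iso (s≤s (≤-trans G≤14 ≤-literal))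
  among (there (there (there (there (there (there (here iso))))))) = too-big iso (s≤s (≤-trans G≤14 ≤-literal))

unique₇ : ∀ G → CubicOf 7 6 G → order G ≤ 18 → G ≅ pappus
unique₇ G c G≤18 = among (classified₆ G (proj₁ c) (girth≥ c) G≤18)
  where
  among : Any (G ≅_) targets₆ → G ≅ pappus
  among (here iso)                                                 = too-thin c iso heawood-width
  among (there (here iso))                                         = iso
  among (there (there (here iso)))                                 = too-thin c iso möbiusKantor-width
  among (there (there (there (here iso))))                         = too-thin c iso girthSix₁-width
  among (there (there (there (there (here iso)))))                 = too-thin c iso girthSix₂-width
  among (there (there (there (there (there (here iso))))))         = too-thin c iso girthSix₃-width
  among (there (there (there (there (there (there (here iso))))))) = too-thin c iso girthSix₄-width

unique₈ : ∀ G → CubicOf 8 7 G → order G ≤ 24 → G ≅ mcGee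
unique₈ G c G≤24 = among (classified₇ G (proj₁ c) (girth≥ c) G≤24)
  where
  among : Any (G ≅_) targets₇ → G ≅ mcGee
  among (here iso) = iso

unique₉ : ∀ G → CubicOf 9 8 G → order G ≤ 30 → G ≅ tutteCoxeter
unique₉ G c G≤30 = among (classified₈ G (proj₁ c) (girth≥ c) (≤-trans G≤30 ≤-literal))
  where
  among : Any (G ≅_) targets₈ → G ≅ tutteCoxeter
  among (here iso)         = iso
  among (there (here iso)) = too-big iso (s≤s (≤-trans G≤30 ≤-literal))

unique₁₀ : ∀ G → CubicOf 10 8 G → order G ≤ 34 → G ≅ G10
unique₁₀ G c G≤34 = among (classified₈ G (proj₁ c) (girth≥ c) G≤34)
  where
  among : Any (G ≅_) targets₈ → G ≅ G10
  among (here iso)         = too-thin c iso tutteCoxeter-width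
  among (there (here iso)) = iso

theorem3 :
    (∃[ g ] (Isξ 3 g × UniqueSmallest (CubicOf 3 g) K₃,₃)) ×
    (∃[ g ] (Isξ 5 g × UniqueSmallest (CubicOf 5 g) petersen)) ×
    (∃[ g ] (Isξ 6 g × UniqueSmallest (CubicOf 6 g) heawood)) ×
    (∃[ g ] (Isξ 7 g × UniqueSmallest (CubicOf 7 g) pappus)) ×
    (∃[ g ] (Isξ 8 g × UniqueSmallest (CubicOf 8 g) mcGee)) ×
    (∃[ g ] (Isξ 9 g × UniqueSmallest (CubicOf 9 g) tutteCoxeter)) ×
    (∃[ g ] (Isξ 10 g × UniqueSmallest (CubicOf 10 g) G10)) ×
    ( Isξ 4 4
    × Smallest (CubicOf 4 4) cube
    × Smallest (CubicOf 4 4) twistedCube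
    × ¬ (cube ≅ twistedCube)
    × (∀ H → Smallest (CubicOf 4 4) H → (H ≅ cube) ⊎ (H ≅ twistedCube)))
theorem3 =
    -- Girth 5 pushes the width above 4 at once, so the bound for `k = 4` serves `k = 3` too. In the
    -- same way girth 7 covers 6 and 7, and girth 9 covers 9 and 10.
    (4 , isξ 3 4 K₃,₃ K₃,₃-cubicOf (λ G c g D → ≤-trans ≤-literal (PathWidth.girth5⇒width>4 G c g D))
       , uniqueSmallest 3 4 K₃,₃ K₃,₃-cubicOf unique₃)
  , (5 , isξ 5 5 petersen petersen-cubicOf PathWidth.girth6⇒width>5
       , uniqueSmallest 5 5 petersen petersen-cubicOf unique₅)
  , (6 , isξ 6 6 heawood heawood-cubicOf (λ G c g D → ≤-trans ≤-literal (PathWidth.girth7⇒width>7 G c g D))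
       , uniqueSmallest 6 6 heawood heawood-cubicOf unique₆)
  , (6 , isξ 7 6 pappus pappus-cubicOf PathWidth.girth7⇒width>7
       , uniqueSmallest 7 6 pappus pappus-cubicOf unique₇)
  , (7 , isξ 8 7 mcGee mcGee-cubicOf PathWidth.girth8⇒width>8
       , uniqueSmallest 8 7 mcGee mcGee-cubicOf unique₈)
  , (8 , isξ 9 8 tutteCoxeter tutteCoxeter-cubicOf (λ G c g D → ≤-trans ≤-literal (PathWidth.girth9⇒width>10 G c g D))
       , uniqueSmallest 9 8 tutteCoxeter tutteCoxeter-cubicOf unique₉)
  , (8 , isξ 10 8 G10 G10-cubicOf PathWidth.girth9⇒width>10
       , uniqueSmallest 10 8 G10 G10-cubicOf unique₁₀)
  , ( isξ 4 4 cube cube-cubicOf PathWidth.girth5⇒width>4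
    , smallest 4 4 cube cube-cubicOf order₄
    , smallest 4 4 twistedCube twistedCube-cubicOf order₄
    , cube≇twistedCube
    , λ { H (c , least) → unique₄ H c (least cube cube-cubicOf) })
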